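{- Let $k$ be a positive integer and $Q\ge 36$ an integer. Let $G$ be a multigraph (self-loops allowed) and $S,R\subseteq V(G)$ with $S\cap R=\emptyset$ and $|S|\ge 2$. Suppose $v\in S$ is incident to no self-loops, $d(v)=Qk$, and $P_k(v)=P_1\sqcup\cdots\sqcup P_k$ is a balanced edge subpartition of $E(v)$. If $S$ is $Qk$-edge-connected in $G$ and every vertex of $R$ is incident to at least $(Q-2)k$ edges, then there exist $k$ pairwise edge-disjoint $S$-subgraphs $H_1,\ldots,H_k$ of $G$ that balance $S\cup R$ and extend $P_k(v)$.
   Context: $E(u)$ denotes the set of edges incident to $u$. A set $S$ is $m$-edge-connected in $G$ if any two vertices of $S$ are joined by $m$ edge-disjoint paths. An $S$-subgraph is a subgraph of $G$ in which all vertices of $S$ lie in one connected component. A partition $E(u)=P_1'\sqcup\cdots\sqcup P_k'$ is balanced if $|P_i'|\ge 2$ for all $i$. A subpartition $P_1\sqcup\cdots\sqcup P_k\subseteq E(u)$ (parts may be empty) is balanced if there is a balanced partition $E(u)=P_1'\sqcup\cdots\sqcup P_k'$ with $P_i\subseteq P_i'$ for all $i$. Edge-disjoint subgraphs $H_1,\ldots,H_k$ balance $u$ if $E(u)\cap E(H_1),\ldots,E(u)\cap E(H_k)$ is a balanced subpartition of $E(u)$; they balance a set $X$ if they balance every vertex of $X$. They extend $P_k(v)$ if for every $i$, $P_i\subseteq E(H_i)$ and $v$ is not a cut vertex of $H_i$. -}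

module Defs where

open import Data.Nat using (ℕ; zero; suc; _+_; _≤_)
open import Data.Fin using (Fin; _≟_)
open import Data.Fin.Subset using (Subset; _∈_; _⊆_; _∩_; ∁; ∣_∣; Empty)
open import Data.Vec using (tabulate)
open import Data.List using (map; allFin)
open import Data.Nat.ListAction using (sum)
open import Data.Product using (Σ; ∃; ∃-syntax; _×_; _,_; proj₁; proj₂)
open import Data.Sum using (_⊎_)
open import Data.Bool using (Bool; true; false; _∨_)
open import Relation.Nullary using (¬_; Dec; yes; no)
open import Relation.Nullary.Decidable using (⌊_⌋)
open import Relation.Binary.PropositionalEquality using (_≡_; _≢_)

-- A finite multigraph with vertex set Fin n and edge set Fin m.
-- Each edge has two (ordered, but orientation is irrelevant) endpoints;
-- an edge whose two endpoints coincide is a self-loop. Parallel edges allowed.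
record Multigraph : Set where
  field
    n    : ℕ
    m    : ℕ
    ends : Fin m → Fin n × Fin n

open Multigraph public

Vertex : Multigraph → Set
Vertex G = Fin (n G)

Edge : Multigraph → Set
Edge G = Fin (m G)

-- Set of edges of G (as a subgraph, given by its edge set)
EdgeSet : Multigraph → Set
EdgeSet G = Subset (m G)

incidentB : (G : Multigraph) → Vertex G → Edge G → Bool
incidentB G u e = ⌊ proj₁ (ends G e) ≟ u ⌋ ∨ ⌊ proj₂ (ends G e) ≟ u ⌋

E : (G : Multigraph) → Vertex G → EdgeSet G
E G u = tabulate (incidentB G u)

SelfLoopAt : (G : Multigraph) → Edge G → Vertex G → Set
SelfLoopAt G e u = (proj₁ (ends G e) ≡ u) × (proj₂ (ends G e) ≡ u)

-- degree d(u): number of edge-ends at u (a self-loop counts twice)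
endCount : (G : Multigraph) → Vertex G → Edge G → ℕ
endCount G u e = ind (proj₁ (ends G e) ≟ u) + ind (proj₂ (ends G e) ≟ u)
  where
  ind : ∀ {A : Set} → Dec A → ℕ
  ind (yes _) = 1
  ind (no _)  = 0

deg : (G : Multigraph) → Vertex G → ℕ
deg G u = sum (map (endCount G u) (allFin (m G)))

Joins : (G : Multigraph) → Edge G → Vertex G → Vertex G → Set
Joins G e y z = (ends G e ≡ (y , z)) ⊎ (ends G e ≡ (z , y))

data Conn (G : Multigraph) (A : EdgeSet G) (x : Vertex G) : Vertex G → Set where
  here : Conn G A x x
  step : ∀ {y z} → Conn G A x y → (e : Edge G) → e ∈ A → Joins G e y z → Conn G A x z

PairwiseDisjoint : (G : Multigraph) {k : ℕ} → (Fin k → EdgeSet G) → Set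
PairwiseDisjoint G {k} H = ∀ (i j : Fin k) → i ≢ j → Empty (H i ∩ H j)

-- S is c-edge-connected in G: any two vertices of S are joined by c
-- pairwise edge-disjoint paths (each path represented by its edge set)
EdgeConnected : (G : Multigraph) → ℕ → Subset (n G) → Set
EdgeConnected G c S =
  ∀ x y → x ∈ S → y ∈ S →
    Σ (Fin c → EdgeSet G) λ D → PairwiseDisjoint G D × (∀ j → Conn G (D j) x y)

SSubgraph : (G : Multigraph) → Subset (n G) → EdgeSet G → Set
SSubgraph G S A = ∀ x y → x ∈ S → y ∈ S → Conn G A x y

BalancedPartition : (G : Multigraph) (k : ℕ) → EdgeSet G → (Fin k → EdgeSet G) → Set
BalancedPartition G k F P' =
  (∀ i → P' i ⊆ F) ×
  PairwiseDisjoint G P' ×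
  (∀ e → e ∈ F → ∃[ i ] (e ∈ P' i)) ×
  (∀ i → 2 ≤ ∣ P' i ∣)

BalancedSubpartition : (G : Multigraph) (k : ℕ) → EdgeSet G → (Fin k → EdgeSet G) → Set
BalancedSubpartition G k F P =
  Σ (Fin k → EdgeSet G) λ P' → BalancedPartition G k F P' × (∀ i → P i ⊆ P' i)

Balances : (G : Multigraph) {k : ℕ} → (Fin k → EdgeSet G) → Vertex G → Set
Balances G {k} H u = BalancedSubpartition G k (E G u) (λ i → E G u ∩ H i)

-- v is a cut vertex of the subgraph with edge set A: removing v increases the
-- number of components, i.e. two vertices other than v connected in A become
-- disconnected once v (and all its incident edges) is deleted
CutVertex : (G : Multigraph) → EdgeSet G → Vertex G → Set
CutVertex G A v =
  ∃[ x ] ∃[ y ] (x ≢ v × y ≢ v × Conn G A x y × ¬ Conn G (A ∩ ∁ (E G v)) x y)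

Extends : (G : Multigraph) {k : ℕ} → (Fin k → EdgeSet G) → (Fin k → EdgeSet G) → Vertex G → Set
Extends G {k} H P v = ∀ i → (P i ⊆ H i) × ¬ CutVertex G (H i) v

{-# OPTIONS --safe #-}

-- Induction on the number of edges, for a statement about cuts: every cut separating S has at
-- least K = Qk edges, and v has exactly K, coloured with each colour used twice.
-- A tight cut with edges on both sides is contracted, once on either side; balance at the
-- contracted vertex makes the colouring found on one side a legal colouring at v for the other.
-- An edge in no tight cut is deleted, and a pair of edges at a vertex outside S ∪ R is split off
-- when this keeps the cuts large (vertices of R with 2k spare edges count as outside R). If
-- nothing applies, uncrossing shows that all edges meet S and that the vertices outside S ∪ R
-- ("hubs") are isolated or have three edges, all to S.
-- The hubs then act as hyperedges on the terminals W = (S ∪ R) ∖ {v}; those next to v inherit a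
-- colour. A supermodular form of matroid union packs 2k disjoint connected hypergraphs on W, two
-- for each colour, so that each colour has degree two at every terminal. This fails only if some
-- bipartition of W is crossed by fewer than 2k of the uncoloured hyperedges. Then nearly all edges
-- at v lead to hubs that join the two classes, the packing works inside the classes, and the few
-- colours not yet joining the classes can be given a crossing hyperedge each.
module Submission where

open import Data.Nat using (ℕ; zero; suc; _+_; _*_; _∸_; _⊔_; _≤_; _<_; _≤ᵇ_; _<ᵇ_; _≤?_; _<?_; z≤n; s≤s; >-nonZero)
import Data.Nat
open import Data.Nat.Properties hiding (_≟_; _≤?_; _<?_)
open import Data.Nat.Tactic.RingSolver using (solve)
open import Data.Bool using (Bool; true; false; _∧_; _∨_; not; _xor_; T; if_then_else_)
import Data.Bool.Properties as Boolₚ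
open import Data.Fin using (Fin; zero; suc; _≟_; toℕ; fromℕ<)
import Data.Fin as Fin
import Data.Fin.Properties as Finₚ
open import Data.Fin.Subset.Properties using (anySubset?)
open import Data.Vec using (lookup; tabulate)
open import Data.Vec.Properties using (lookup∘tabulate)
open import Data.List using (List; []; _∷_)
open import Data.Maybe using (Maybe; just; nothing; fromMaybe)
open import Data.Maybe.Properties using (just-injective)
open import Data.Product using (Σ; ∃; _×_; _,_; proj₁; proj₂)
open import Data.Sum using (_⊎_; inj₁; inj₂; [_,_]′)
open import Data.Empty using (⊥; ⊥-elim)
open import Function using (_∘_)
open import Relation.Binary using (IsEquivalence; tri<; tri≈; tri>)
import Relation.Binary.Construct.On as On
open import Relation.Binary.PropositionalEquality using (_≡_; _≢_; _≗_; refl; sym; trans; cong; cong₂; subst; subst₂; isEquivalence; module ≡-Reasoning)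
open import Relation.Nullary using (¬_; Dec; yes; no)
open import Relation.Nullary.Decidable using (⌊_⌋; map′; ¬?; decidable-stable; _×-dec_)
open import Algebra.Properties.CommutativeMonoid.Sum +-0-commutativeMonoid using (sum; sum-cong-≗; ∑-distrib-+; ∑-comm)

-- Linear arithmetic: to derive a ≤ b from l ≤ r, exhibit the slack s in an equation
-- between sums, which the ring solver can then check.
≤-by : ∀ {a b l r} s → l ≤ r → a + r + s ≡ b + l → a ≤ b
≤-by {a} {b} {l} {r} s l≤r eq = +-cancelʳ-≤ r a b (begin
  a + r      ≤⟨ m≤m+n (a + r) s ⟩
  a + r + s  ≡⟨ eq ⟩
  b + l      ≤⟨ +-monoʳ-≤ b l≤r ⟩
  b + r      ∎)
  where open ≤-Reasoning

Pred𝔹 : ℕ → Set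
Pred𝔹 zero    = Bool
Pred𝔹 (suc n) = Bool → Pred𝔹 n

tautology : ∀ n → Pred𝔹 n → Bool
tautology zero    b = b
tautology (suc n) f = tautology n (f true) ∧ tautology n (f false)

Holds : ∀ n → Pred𝔹 n → Set
Holds zero    b = T b
Holds (suc n) f = ∀ b → Holds n (f b)

∧-split : ∀ a b → T (a ∧ b) → T a × T b
∧-split true b t = _ , t

by-cases : ∀ n f → T (tautology n f) → Holds n f
by-cases zero    f t = t
by-cases (suc n) f t true  = by-cases n (f true) (proj₁ (∧-split (tautology n (f true)) _ t))
by-cases (suc n) f t false = by-cases n (f false) (proj₂ (∧-split (tautology n (f true)) _ t))

⟦_⟧ : Bool → ℕ
⟦ true ⟧  = 1
⟦ false ⟧ = 0

⟦⟧≤1 : ∀ b → ⟦ b ⟧ ≤ 1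
⟦⟧≤1 true  = ≤-refl
⟦⟧≤1 false = z≤n

≡true : ∀ {b} → T b → b ≡ true
≡true {true} _ = refl

T≡ : ∀ {b} → b ≡ true → T b
T≡ refl = _

≢true : ∀ {b} → ¬ b ≡ true → b ≡ false
≢true {true}  h = ⊥-elim (h refl)
≢true {false} h = refl

true≢false : ∀ {b} → b ≡ true → b ≡ false → ⊥
true≢false refl ()

⟦⟧-mono : ∀ {a b} → (a ≡ true → b ≡ true) → ⟦ a ⟧ ≤ ⟦ b ⟧
⟦⟧-mono {false}    h = z≤n
⟦⟧-mono {true} {b} h = ≤-reflexive (sym (cong ⟦_⟧ (h refl)))

∧-true : ∀ {a b} → a ≡ true → b ≡ true → a ∧ b ≡ true
∧-true refl refl = refl

∧-trueˡ : ∀ {a b} → a ∧ b ≡ true → a ≡ true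
∧-trueˡ {true} h = refl

∧-trueʳ : ∀ {a b} → a ∧ b ≡ true → b ≡ true
∧-trueʳ {true} h = h

∨-true : ∀ {a b} → a ∨ b ≡ true → a ≡ true ⊎ b ≡ true
∨-true {true}  h = inj₁ refl
∨-true {false} h = inj₂ h

∨-trueˡ : ∀ {a b} → a ≡ true → a ∨ b ≡ true
∨-trueˡ refl = refl

∨-trueʳ : ∀ {a b} → b ≡ true → a ∨ b ≡ true
∨-trueʳ {true}  h = refl
∨-trueʳ {false} h = h

not-true : ∀ {a} → not a ≡ true → a ≡ false
not-true {false} h = refl

not-false : ∀ {a} → a ≡ false → not a ≡ true
not-false refl = refl

xor-≢ : ∀ {a b} → a xor b ≡ true → a ≢ b
xor-≢ {true}  {false} h ()
xor-≢ {false} {true}  h ()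

xor-≡ : ∀ {a b} → a xor b ≡ false → a ≡ b
xor-≡ {true}  {true}  h = refl
xor-≡ {false} {false} h = refl

≡-xor : ∀ {a b} → a ≡ b → a xor b ≡ false
≡-xor {true}  refl = refl
≡-xor {false} refl = refl

bool? : (b : Bool) → b ≡ true ⊎ b ≡ false
bool? true  = inj₁ refl
bool? false = inj₂ refl

is : ∀ {n} → Fin n → Fin n → Bool
is u y = ⌊ y ≟ u ⌋

is-refl : ∀ {n} (u : Fin n) → is u u ≡ true
is-refl u with u ≟ u
... | yes _ = refl
... | no ¬p = ⊥-elim (¬p refl)

is-≡ : ∀ {n} {u y : Fin n} → is u y ≡ true → y ≡ u
is-≡ {u = u} {y} h with y ≟ u
... | yes p = p

is-≢ : ∀ {n} {u y : Fin n} → y ≢ u → is u y ≡ false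
is-≢ {u = u} {y} h with y ≟ u
... | yes p = ⊥-elim (h p)
... | no _  = refl

is-true : ∀ {n} {u y : Fin n} → y ≡ u → is u y ≡ true
is-true {u = u} refl = is-refl u

is-false : ∀ {n} {u y : Fin n} → is u y ≡ false → y ≢ u
is-false h e = true≢false (is-true e) h

-- Finite sums and counting

-- Opaque, so that the summand can be inferred from a sum.
opaque
  ∑ : ∀ {n} → (Fin n → ℕ) → ℕ
  ∑ = sum

  ∑-empty : (f : Fin 0 → ℕ) → ∑ f ≡ 0
  ∑-empty f = refl

  ∑-suc : ∀ {n} (f : Fin (suc n) → ℕ) → ∑ f ≡ f zero + ∑ (f ∘ suc)
  ∑-suc f = refl

  ∑-swap : ∀ {m n} (f : Fin m → Fin n → ℕ) → ∑ (λ i → ∑ (f i)) ≡ ∑ (λ j → ∑ (λ i → f i j))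
  ∑-swap = ∑-comm

  ∑-cong : ∀ {n} {f g : Fin n → ℕ} → f ≗ g → ∑ f ≡ ∑ g
  ∑-cong = sum-cong-≗

  ∑-+ : ∀ {n} (f g : Fin n → ℕ) → ∑ (λ e → f e + g e) ≡ ∑ f + ∑ g
  ∑-+ = ∑-distrib-+

  ∑-mono : ∀ {n} {f g : Fin n → ℕ} → (∀ e → f e ≤ g e) → ∑ f ≤ ∑ g
  ∑-mono {zero}  h = z≤n
  ∑-mono {suc n} h = +-mono-≤ (h zero) (∑-mono (h ∘ suc))

  ∑-< : ∀ {n} {f g : Fin n → ℕ} → (∀ e → f e ≤ g e) → ∀ e → f e < g e → ∑ f < ∑ g
  ∑-< h zero    lt = +-mono-<-≤ lt (∑-mono (h ∘ suc))
  ∑-< h (suc e) lt = +-mono-≤-< (h zero) (∑-< (h ∘ suc) e lt)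

  ∑-squeeze : ∀ {n} {f g : Fin n → ℕ} → (∀ e → f e ≤ g e) → ∑ g ≤ ∑ f → ∀ e → f e ≡ g e
  ∑-squeeze {f = f} {g} h le e with f e <? g e
  ... | yes lt = ⊥-elim (<⇒≱ (∑-< h e lt) le)
  ... | no ¬lt = ≤-antisym (h e) (≮⇒≥ ¬lt)

  ∑-const : ∀ n c → ∑ {n} (λ _ → c) ≡ n * c
  ∑-const zero    c = refl
  ∑-const (suc n) c = cong (c +_) (∑-const n c)

  ∑-zero : ∀ {n} {f : Fin n → ℕ} → (∀ e → f e ≡ 0) → ∑ f ≡ 0
  ∑-zero {n} h = trans (∑-cong h) (trans (∑-const n 0) (*-zeroʳ n))

  ∑-* : ∀ {n} c (f : Fin n → ℕ) → ∑ (λ e → c * f e) ≡ c * ∑ f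
  ∑-* {zero}  c f = sym (*-zeroʳ c)
  ∑-* {suc n} c f = trans (cong (c * f zero +_) (∑-* c (f ∘ suc))) (sym (*-distribˡ-+ c (f zero) _))

  term≤∑ : ∀ {n} (f : Fin n → ℕ) e → f e ≤ ∑ f
  term≤∑ f zero    = m≤m+n _ _
  term≤∑ f (suc e) = ≤-trans (term≤∑ (f ∘ suc) e) (m≤n+m _ _)

  two-terms≤∑ : ∀ {n} (f : Fin n → ℕ) {a b} → a ≢ b → f a + f b ≤ ∑ f
  two-terms≤∑ f {zero}  {zero}  h = ⊥-elim (h refl)
  two-terms≤∑ f {zero}  {suc b} h = +-monoʳ-≤ (f zero) (term≤∑ (f ∘ suc) b)
  two-terms≤∑ f {suc a} {zero}  h =
    ≤-trans (≤-reflexive (+-comm (f (suc a)) (f zero))) (+-monoʳ-≤ (f zero) (term≤∑ (f ∘ suc) a))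
  two-terms≤∑ f {suc a} {suc b} h =
    ≤-trans (two-terms≤∑ (f ∘ suc) (h ∘ cong suc)) (m≤n+m _ _)

  three-terms≤∑ : ∀ {n} (f : Fin n → ℕ) {a b c} → a ≢ b → a ≢ c → b ≢ c → f a + f b + f c ≤ ∑ f
  three-terms≤∑ {n} f {a} {b} {c} a≢b a≢c b≢c =
    ≤-trans (+-mono-≤ left right) (≤-reflexive (trans (sym (∑-+ f₁ f₂)) (∑-cong {g = f} pointwise)))
    where
    pick : Bool → ℕ → ℕ
    pick true  x = x
    pick false x = 0
    f₁ f₂ : Fin n → ℕ
    f₁ e = pick (not (is c e)) (f e)
    f₂ e = pick (is c e) (f e)
    pointwise : ∀ e → f₁ e + f₂ e ≡ f e
    pointwise e with is c e
    ... | true  = refl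
    ... | false = +-identityʳ _
    left : f a + f b ≤ ∑ f₁
    left = ≤-trans (≤-reflexive (cong₂ _+_ (sym (cong (λ z → pick (not z) (f a)) (is-≢ a≢c)))
                                           (sym (cong (λ z → pick (not z) (f b)) (is-≢ b≢c)))))
                   (two-terms≤∑ f₁ a≢b)
    right : f c ≤ ∑ f₂
    right = ≤-trans (≤-reflexive (sym (cong (λ z → pick z (f c)) (is-refl c)))) (term≤∑ f₂ c)

  positive-term : ∀ {n} (f : Fin n → ℕ) → 0 < ∑ f → ∃ λ e → 0 < f e
  positive-term {zero}  f ()
  positive-term {suc n} f h with f zero in eq
  ... | suc x = zero , subst (0 <_) (sym eq) (s≤s z≤n)
  ... | zero  with positive-term (f ∘ suc) h
  ...   | e , p = suc e , p

  ∑-is : ∀ {n} (u : Fin n) (f : Fin n → ℕ) → ∑ (λ y → ⟦ is u y ⟧ * f y) ≡ f u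
  ∑-is {suc n} zero f = trans (cong₂ _+_ (+-identityʳ (f zero)) (∑-zero {f = λ y → ⟦ is zero (suc y) ⟧ * f (suc y)} (λ y → refl))) (+-identityʳ (f zero))
  ∑-is {suc n} (suc u) f = trans (∑-cong pointwise) (∑-is u (f ∘ suc))
    where
    pointwise : ∀ y → ⟦ is (suc u) (suc y) ⟧ * f (suc y) ≡ ⟦ is u y ⟧ * f (suc y)
    pointwise y with y ≟ u
    ... | yes _ = refl
    ... | no _  = refl

  is-sym : ∀ {n} (a b : Fin n) → is a b ≡ is b a
  is-sym a b with b ≟ a | a ≟ b
  ... | yes _ | yes _ = refl
  ... | no _  | no _  = refl
  ... | yes p | no q  = ⊥-elim (q (sym p))
  ... | no p  | yes q = ⊥-elim (p (sym q))

  ∑-is-1 : ∀ {n} (u : Fin n) → ∑ (λ y → ⟦ is u y ⟧) ≡ 1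
  ∑-is-1 u = trans (∑-cong (λ y → sym (*-identityʳ ⟦ is u y ⟧))) (∑-is u (λ _ → 1))

  ∑-update : ∀ {n} (f g : Fin n → ℕ) e → (∀ e′ → e′ ≢ e → f e′ ≡ g e′) → ∑ f + g e ≡ ∑ g + f e
  ∑-update {suc n} f g zero h = begin
    f zero + ∑ (f ∘ suc) + g zero ≡⟨ cong (λ z → f zero + z + g zero) (∑-cong (λ e → h (suc e) λ ())) ⟩
    f zero + ∑ (g ∘ suc) + g zero ≡⟨ swap (f zero) (∑ (g ∘ suc)) (g zero) ⟩
    g zero + ∑ (g ∘ suc) + f zero ∎
    where
    open ≡-Reasoning
    swap : ∀ a b c → a + b + c ≡ c + b + a
    swap a b c = solve (a ∷ b ∷ c ∷ [])
  ∑-update {suc n} f g (suc e) h = begin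
    f zero + ∑ (f ∘ suc) + g (suc e)   ≡⟨ +-assoc (f zero) _ _ ⟩
    f zero + (∑ (f ∘ suc) + g (suc e)) ≡⟨ cong₂ _+_ (h zero λ ()) (∑-update (f ∘ suc) (g ∘ suc) e (λ e′ ne → h (suc e′) (ne ∘ Finₚ.suc-injective))) ⟩
    g zero + (∑ (g ∘ suc) + f (suc e)) ≡⟨ sym (+-assoc (g zero) _ _) ⟩
    g zero + ∑ (g ∘ suc) + f (suc e)   ∎
    where open ≡-Reasoning

count : ∀ {n} → (Fin n → Bool) → ℕ
count X = ∑ (λ e → ⟦ X e ⟧)

count-mono : ∀ {n} {X Y : Fin n → Bool} → (∀ e → X e ≡ true → Y e ≡ true) → count X ≤ count Y
count-mono h = ∑-mono (λ e → ⟦⟧-mono (h e))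

count-pos : ∀ {n} (X : Fin n → Bool) {e} → X e ≡ true → 1 ≤ count X
count-pos X {e} h = ≤-trans (≤-reflexive (sym (cong ⟦_⟧ h))) (term≤∑ (λ e → ⟦ X e ⟧) e)

count-2 : ∀ {n} (X : Fin n → Bool) {a b} → a ≢ b → X a ≡ true → X b ≡ true → 2 ≤ count X
count-2 X a≢b ha hb =
  ≤-trans (≤-reflexive (sym (cong₂ _+_ (cong ⟦_⟧ ha) (cong ⟦_⟧ hb)))) (two-terms≤∑ (λ e → ⟦ X e ⟧) a≢b)

count-3 : ∀ {n} (X : Fin n → Bool) {a b c} → a ≢ b → a ≢ c → b ≢ c →
          X a ≡ true → X b ≡ true → X c ≡ true → 3 ≤ count X
count-3 X a≢b a≢c b≢c ha hb hc =
  ≤-trans (≤-reflexive (sym (cong₂ _+_ (cong₂ _+_ (cong ⟦_⟧ ha) (cong ⟦_⟧ hb)) (cong ⟦_⟧ hc))))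
          (three-terms≤∑ (λ e → ⟦ X e ⟧) a≢b a≢c b≢c)

count-witness : ∀ {n} (X : Fin n → Bool) → 1 ≤ count X → ∃ λ e → X e ≡ true
count-witness X h with positive-term (λ e → ⟦ X e ⟧) h
... | e , p = e , pos (X e) p
  where
  pos : ∀ b → 0 < ⟦ b ⟧ → b ≡ true
  pos true _ = refl

hasColour : ∀ {k} → Maybe (Fin k) → Fin k → Bool
hasColour nothing  i = false
hasColour (just j) i = is i j

hasColour-≡ : ∀ {k} {c : Maybe (Fin k)} {i} → hasColour c i ≡ true → c ≡ just i
hasColour-≡ {c = just j} h = cong just (is-≡ h)

hasColour-refl : ∀ {k} {c : Maybe (Fin k)} {i} → c ≡ just i → hasColour c i ≡ true
hasColour-refl {i = i} refl = is-refl i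

record Distribution {m k} (q : Fin k → ℕ) (F : Fin m → Bool) : Set where
  field
    to     : Fin m → Maybe (Fin k)
    within : ∀ e i → to e ≡ just i → F e ≡ true
    enough : ∀ i → q i ≤ count (λ e → hasColour (to e) i)

distribute : ∀ {m} k (q : Fin k → ℕ) (F : Fin m → Bool) → ∑ q ≤ count F → Distribution q F
distribute zero q F le = record { to = λ _ → nothing ; within = λ e i () ; enough = λ () }
distribute {m} (suc k) q F le = finish (goal (q zero) (q ∘ suc) F (≤-trans (≤-reflexive (sym (∑-suc q))) le))
  where
  Goal : (q₀ : ℕ) (q′ : Fin k → ℕ) (F : Fin m → Bool) → Set
  Goal q₀ q′ F = Σ (Fin m → Maybe (Fin (suc k))) λ h →
    (∀ e i → h e ≡ just i → F e ≡ true) ×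
    (q₀ ≤ count (λ e → hasColour (h e) zero)) ×
    (∀ i → q′ i ≤ count (λ e → hasColour (h e) (suc i)))
  finish : Goal (q zero) (q ∘ suc) F → Distribution q F
  finish (h , sub , h₀ , hs) = record { to = h ; within = sub ; enough = λ { zero → h₀ ; (suc i) → hs i } }
  without : (F : Fin m → Bool) → Fin m → Fin m → Bool
  without F e e′ = F e′ ∧ not (is e e′)
  without-count : ∀ F e → F e ≡ true → suc (count (without F e)) ≡ count F
  without-count F e he = trans (+-comm 1 _) (trans (cong (count (without F e) +_) (sym (cong ⟦_⟧ he)))
     (trans (∑-update _ _ e off) (trans (cong (count F +_) (cong ⟦_⟧ at)) (+-identityʳ _))))
    where
    off : ∀ e′ → e′ ≢ e → ⟦ without F e e′ ⟧ ≡ ⟦ F e′ ⟧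
    off e′ ne rewrite is-≢ {u = e} {e′} ne with F e′
    ... | true  = refl
    ... | false = refl
    at : without F e e ≡ false
    at rewrite is-refl e with F e
    ... | true  = refl
    ... | false = refl
  goal : ∀ q₀ (q′ : Fin k → ℕ) (F : Fin m → Bool) → q₀ + ∑ q′ ≤ count F → Goal q₀ q′ F
  goal zero q′ F le with distribute k q′ F le
  ... | record { to = h ; within = sub ; enough = enough } = shift ∘ h , sub′ , z≤n , λ i → ≤-trans (enough i) (count-mono (λ e → same e i))
    where
    shift : Maybe (Fin k) → Maybe (Fin (suc k))
    shift nothing  = nothing
    shift (just i) = just (suc i)
    sub′ : ∀ e i → shift (h e) ≡ just i → F e ≡ true
    sub′ e i eq with h e in he
    ... | just j = sub e j he
    same : ∀ e i → hasColour (h e) i ≡ true → hasColour (shift (h e)) (suc i) ≡ true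
    same e i eq with h e
    ... | just j = is-true (cong suc (is-≡ eq))
  goal (suc q₀) q′ F le with count-witness F (≤-trans (s≤s z≤n) le)
  ... | e , he with goal q₀ q′ (without F e) (≤-pred (≤-trans le (≤-reflexive (sym (without-count F e he)))))
  ... | h , sub , h₀ , hs = h′ , sub′ , more , λ i → ≤-trans (hs i) (count-mono (λ e′ → keep e′ i))
    where
    h′ : Fin m → Maybe (Fin (suc k))
    h′ e′ with e′ ≟ e
    ... | yes _ = just zero
    ... | no _  = h e′
    he∉ : ∀ i → h e ≢ just i
    he∉ i eq = true≢false (is-refl e) (not-true (∧-trueʳ {a = F e} (sub e i eq)))
    sub′ : ∀ e′ i → h′ e′ ≡ just i → F e′ ≡ true
    sub′ e′ i eq with e′ ≟ e
    ... | yes refl = he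
    ... | no _     = ∧-trueˡ (sub e′ i eq)
    keep : ∀ e′ i → hasColour (h e′) (suc i) ≡ true → hasColour (h′ e′) (suc i) ≡ true
    keep e′ i eq with e′ ≟ e
    ... | yes refl = ⊥-elim (he∉ (suc i) (hasColour-≡ eq))
    ... | no _     = eq
    keep₀ : ∀ e′ → hasColour (h e′) zero ≡ true → hasColour (h′ e′) zero ≡ true
    keep₀ e′ eq with e′ ≟ e
    ... | yes refl = refl
    ... | no _     = eq
    new : hasColour (h′ e) zero ≡ true
    new with e ≟ e
    ... | yes _ = refl
    ... | no ne = ⊥-elim (ne refl)
    old : hasColour (h e) zero ≡ false
    old = ≢true (λ eq → he∉ zero (hasColour-≡ eq))
    more : suc q₀ ≤ count (λ e′ → hasColour (h′ e′) zero)
    more = ≤-trans (s≤s h₀) (∑-< (λ e′ → ⟦⟧-mono (keep₀ e′)) e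
             (subst₂ _<_ (sym (cong ⟦_⟧ old)) (sym (cong ⟦_⟧ new)) ≤-refl))
search : ∀ {n} {P : (Fin n → Bool) → Set} → (∀ {X Y} → X ≗ Y → P X → P Y) → (∀ X → Dec (P X)) → Dec (∃ P)
search {P = P} ext P? = map′ (λ (s , p) → lookup s , p)
  (λ (X , p) → tabulate X , ext (λ e → sym (lookup∘tabulate X e)) p) (anySubset? (λ s → P? (lookup s)))

infixl 6 _∪ᵇ_ _⊕_
infixl 7 _∩ᵇ_ _∖_
infix 4 _⊆ᵇ_

_∪ᵇ_ _∩ᵇ_ _∖_ : ∀ {m} → (Fin m → Bool) → (Fin m → Bool) → Fin m → Bool
(A ∪ᵇ B) e = A e ∨ B e
(A ∩ᵇ B) e = A e ∧ B e
(A ∖ B) e = A e ∧ not (B e)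

_⊕_ : ∀ {m} → (Fin m → Bool) → Fin m → Fin m → Bool
A ⊕ e = A ∪ᵇ is e

_⊆ᵇ_ : ∀ {m} → (Fin m → Bool) → (Fin m → Bool) → Set
A ⊆ᵇ B = ∀ e → A e ≡ true → B e ≡ true

count-cong : ∀ {m} {A B : Fin m → Bool} → A ≗ B → count A ≡ count B
count-cong h = ∑-cong (λ e → cong ⟦_⟧ (h e))

b≤ : ∀ {a b} → T (a ≤ᵇ b) → a ≤ b
b≤ {a} {b} = ≤ᵇ⇒≤ a b

-- Connected components

-- L maps every vertex to the least vertex of its component in the graph with adjacency Ed;
-- `joined` says that L only identifies vertices joined by a path.
record Labelling {n} (Ed : Fin n → Fin n → Set) : Set₁ where
  field
    L          : Fin n → Fin n
    idempotent : ∀ z → L (L z) ≡ L z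
    decreasing : ∀ z → L z Fin.≤ z
    closed     : ∀ {a b} → Ed a b → L a ≡ L b
    joined     : ∀ {_~_ : Fin n → Fin n → Set} → IsEquivalence _~_ → (∀ {a b} → Ed a b → a ~ b) → ∀ z → L z ~ z

  universal : ∀ {X : Set} (g : Fin n → X) → (∀ {a b} → Ed a b → g a ≡ g b) → ∀ z → g (L z) ≡ g z
  universal g = joined (On.isEquivalence g isEquivalence)

roots : ∀ {n} → (Fin n → Fin n) → ℕ
roots L = count (λ z → is z (L z))

module _ {n} {Ed₁ Ed₂ : Fin n → Fin n → Set} (ℓ₁ : Labelling Ed₁) (ℓ₂ : Labelling Ed₂)
         (sub : ∀ {a b} → Ed₁ a b → Ed₂ a b) where
  private
    module ℓ₁ = Labelling ℓ₁
    module ℓ₂ = Labelling ℓ₂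

  coarser : ∀ z → ℓ₂.L (ℓ₁.L z) ≡ ℓ₂.L z
  coarser = ℓ₁.universal ℓ₂.L (λ ab → ℓ₂.closed (sub ab))

  coarser-root : ∀ z → ℓ₂.L z ≡ z → ℓ₁.L z ≡ z
  coarser-root z fix = Finₚ.≤-antisym (ℓ₁.decreasing z)
    (subst (Fin._≤ ℓ₁.L z) (trans (coarser z) fix) (ℓ₂.decreasing (ℓ₁.L z)))

  roots-antitone : roots ℓ₂.L ≤ roots ℓ₁.L
  roots-antitone = count-mono (λ z h → is-true (coarser-root z (is-≡ h)))

  same-roots⇒same-labels : roots ℓ₁.L ≤ roots ℓ₂.L → ∀ z → ℓ₁.L z ≡ ℓ₂.L z
  same-roots⇒same-labels le z = trans (sym (is-≡ fixed)) (coarser z)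
    where
    pointwise = ∑-squeeze (λ z → ⟦⟧-mono {is z (ℓ₂.L z)} {is z (ℓ₁.L z)} (λ h → is-true (coarser-root z (is-≡ h)))) le
    ⟦⟧-true : ∀ {b} → ⟦ b ⟧ ≡ 1 → b ≡ true
    ⟦⟧-true {true} _ = refl
    fixed : is (ℓ₁.L z) (ℓ₂.L (ℓ₁.L z)) ≡ true
    fixed = ⟦⟧-true (trans (pointwise (ℓ₁.L z)) (cong ⟦_⟧ (is-true (ℓ₁.idempotent z))))

relabel : ∀ {n} {Ed₁ Ed₂ : Fin n → Fin n → Set} → (∀ {a b} → Ed₁ a b → Ed₂ a b) →
  (∀ {a b} → Ed₂ a b → Ed₁ a b) → Labelling Ed₁ → Labelling Ed₂
relabel to from ℓ = record
  { L = L ; idempotent = idempotent ; decreasing = decreasing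
  ; closed = closed ∘ from ; joined = λ eq h → joined eq (h ∘ to) }
  where open Labelling ℓ

Joined : ∀ {n} → (Fin n → Fin n → Set) → Fin n → Fin n → Fin n → Fin n → Set
Joined Ed a b x y = Ed x y ⊎ (x ≡ a × y ≡ b)

module _ {n} {Ed : Fin n → Fin n → Set} (ℓ : Labelling Ed) where
  open Labelling ℓ

  redirect : Fin n → Fin n → Fin n → Fin n
  redirect lo hi z with z ≟ hi
  ... | yes _ = lo
  ... | no _  = z

  redirect-hi : ∀ lo hi → redirect lo hi hi ≡ lo
  redirect-hi lo hi with hi ≟ hi
  ... | yes _ = refl
  ... | no ¬p = ⊥-elim (¬p refl)

  redirect-other : ∀ lo hi {z} → z ≢ hi → redirect lo hi z ≡ z
  redirect-other lo hi {z} ne with z ≟ hi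
  ... | yes p = ⊥-elim (ne p)
  ... | no _  = refl

  redirect-roots : ∀ {lo hi} → L lo ≡ lo → L hi ≡ hi → lo ≢ hi →
    roots (λ z → redirect lo hi (L z)) + 1 ≡ roots L
  redirect-roots {lo} {hi} flo fhi ne =
    trans (cong (roots (λ z → redirect lo hi (L z)) +_) (sym (∑-is-1 hi)))
          (trans (sym (∑-+ _ _)) (∑-cong pointwise))
    where
    pointwise : ∀ z → ⟦ is z (redirect lo hi (L z)) ⟧ + ⟦ is hi z ⟧ ≡ ⟦ is z (L z) ⟧
    pointwise z with z ≟ hi
    ... | yes refl rewrite fhi | redirect-hi lo hi | is-≢ ne | is-refl hi = refl
    ... | no z≢hi with L z ≟ hi
    ...   | no _  = +-identityʳ _
    ...   | yes p rewrite p | is-≢ {u = z} {hi} (z≢hi ∘ sym) =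
      trans (+-identityʳ _) (cong ⟦_⟧ (is-≢ (λ lo≡z → ne (trans (sym flo) (trans (cong L lo≡z) p)))))

  merge-ordered : ∀ {a b lo hi} → (L a ≡ lo × L b ≡ hi) ⊎ (L a ≡ hi × L b ≡ lo) → lo Fin.< hi → Labelling (Joined Ed a b)
  merge-ordered {a} {b} {lo} {hi} ab lt = record
    { L = L′ ; idempotent = idem ; decreasing = dec ; closed = clo ; joined = uni }
    where
    L′ : Fin n → Fin n
    L′ z = redirect lo hi (L z)
    fix : ∀ {c d} → L c ≡ d → L d ≡ d
    fix {c} refl = idempotent c
    flo : L lo ≡ lo
    flo = [ fix ∘ proj₁ , fix ∘ proj₂ ]′ ab
    idem : ∀ z → L′ (L′ z) ≡ L′ z
    idem z with L z ≟ hi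
    ... | yes _ = trans (cong (redirect lo hi) flo) (redirect-other lo hi (Finₚ.<⇒≢ lt))
    ... | no ne = trans (cong (redirect lo hi) (idempotent z)) (redirect-other lo hi ne)
    dec : ∀ z → L′ z Fin.≤ z
    dec z with L z ≟ hi
    ... | yes p = ≤-trans (<⇒≤ lt) (subst (Fin._≤ z) p (decreasing z))
    ... | no _  = decreasing z
    lohi : redirect lo hi lo ≡ redirect lo hi hi
    lohi = trans (redirect-other lo hi (Finₚ.<⇒≢ lt)) (sym (redirect-hi lo hi))
    clo : ∀ {x y} → Joined Ed a b x y → L′ x ≡ L′ y
    clo (inj₁ e) = cong (redirect lo hi) (closed e)
    clo (inj₂ (refl , refl)) =
      [ (λ (p , q) → trans (cong (redirect lo hi) p) (trans lohi (cong (redirect lo hi) (sym q))))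
      , (λ (p , q) → trans (cong (redirect lo hi) p) (trans (sym lohi) (cong (redirect lo hi) (sym q)))) ]′ ab
    uni : ∀ {_~_ : Fin n → Fin n → Set} → IsEquivalence _~_ → (∀ {x y} → Joined Ed a b x y → x ~ y) → ∀ z → L′ z ~ z
    uni {_~_} eq h z with L z ≟ hi
    ... | no _  = joined eq (h ∘ inj₁) z
    ... | yes p = ~.trans lo~hi (subst (_~ z) p (u z))
      where
      module ~ = IsEquivalence eq
      u = joined eq (h ∘ inj₁)
      a~b : a ~ b
      a~b = h (inj₂ (refl , refl))
      lo~hi : lo ~ hi
      lo~hi =
        [ (λ (p , q) → ~.trans (subst (_~ a) p (u a)) (~.trans a~b (~.sym (subst (_~ b) q (u b)))))
        , (λ (p , q) → ~.trans (subst (_~ b) q (u b)) (~.trans (~.sym a~b) (~.sym (subst (_~ a) p (u a))))) ]′ ab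

  merge : ∀ a b → Σ (Labelling (Joined Ed a b)) λ ℓ′ →
    roots (Labelling.L ℓ′) + ⟦ not (is (L b) (L a)) ⟧ ≡ roots L
  merge a b with L a ≟ L b
  ... | yes p = record { L = L ; idempotent = idempotent ; decreasing = decreasing
                       ; closed = λ { (inj₁ e) → closed e ; (inj₂ (refl , refl)) → p }
                       ; joined = λ eq h → joined eq (h ∘ inj₁) }
              , +-identityʳ _
  ... | no ne with Finₚ.<-cmp (L a) (L b)
  ...   | tri< lt _ _ = merge-ordered (inj₁ (refl , refl)) lt
          , redirect-roots (idempotent a) (idempotent b) ne
  ...   | tri≈ _ p _ = ⊥-elim (ne p)
  ...   | tri> _ _ gt = merge-ordered (inj₂ (refl , refl)) gt
          , redirect-roots (idempotent b) (idempotent a) (ne ∘ sym)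

Edges : ∀ {n m} → (Fin m → Fin n × Fin n) → (Fin m → Bool) → Fin n → Fin n → Set
Edges link A a b = ∃ λ e → A e ≡ true × link e ≡ (a , b)

labelling : ∀ {n m} (link : Fin m → Fin n × Fin n) (A : Fin m → Bool) → Labelling (Edges link A)
labelling {m = zero} link A = record
  { L = λ z → z ; idempotent = λ z → refl ; decreasing = λ z → ≤-refl
  ; closed = λ { (() , _) } ; joined = λ eq h z → IsEquivalence.refl eq }
labelling {m = suc m} link A with A zero in eq
... | false = relabel (λ (e , h) → suc e , h)
                      (λ { (zero , h , _) → ⊥-elim (true≢false h eq) ; (suc e , h) → e , h })
                      (labelling (link ∘ suc) (A ∘ suc))
... | true  = relabel (λ { (inj₁ (e , h)) → suc e , h ; (inj₂ (refl , refl)) → zero , eq , refl })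
                      (λ { (zero , _ , refl) → inj₂ (refl , refl) ; (suc e , h) → inj₁ (e , h) })
                      (proj₁ (merge (labelling (link ∘ suc) (A ∘ suc)) (proj₁ (link zero)) (proj₂ (link zero))))

record Supermodular {m} (κ : (Fin m → Bool) → ℕ) : Set where
  field
    ext          : ∀ {A B} → A ≗ B → κ A ≡ κ B
    antitone     : ∀ {A B} → A ⊆ᵇ B → κ B ≤ κ A
    supermodular : ∀ A B → κ A + κ B ≤ κ (A ∪ᵇ B) + κ (A ∩ᵇ B)

module _ {m} (κ : (Fin m → Bool) → ℕ) (ext : ∀ {A B} → A ≗ B → κ A ≡ κ B)
  (diminishing : ∀ A B e → A ⊆ᵇ B → κ (A ⊕ e) + κ B ≤ κ A + κ (B ⊕ e)) where

  private
    below : ℕ → (Fin m → Bool) → Fin m → Bool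
    below j D e = D e ∧ (toℕ e <ᵇ j)

    below-suc : ∀ j D (j<m : j < m) → D (fromℕ< j<m) ≡ true → ∀ e → below (suc j) D e ≡ (below j D ⊕ fromℕ< j<m) e
    below-suc j D j<m h e with e ≟ fromℕ< j<m
    ... | yes refl rewrite h | Finₚ.toℕ-fromℕ< j<m = trans (≡true (<⇒<ᵇ (n<1+n j))) (sym (Boolₚ.∨-zeroʳ _))
    ... | no ne = trans (cong (D e ∧_) (same (λ p → ne (Finₚ.toℕ-injective (trans p (sym (Finₚ.toℕ-fromℕ< j<m)))))))
                        (sym (Boolₚ.∨-identityʳ _))
      where
      same : toℕ e ≢ j → (toℕ e <ᵇ suc j) ≡ (toℕ e <ᵇ j)
      same ne with toℕ e <ᵇ suc j in p | toℕ e <ᵇ j in q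
      ... | true  | true  = refl
      ... | false | false = refl
      ... | true  | false = ⊥-elim (true≢false (≡true (<⇒<ᵇ (≤∧≢⇒< (≤-pred (<ᵇ⇒< (toℕ e) (suc j) (T≡ p))) ne))) q)
      ... | false | true  = ⊥-elim (true≢false (≡true (<⇒<ᵇ (m<n⇒m<1+n (<ᵇ⇒< (toℕ e) j (T≡ q))))) p)

    below-suc′ : ∀ j D (j<m : j < m) → D (fromℕ< j<m) ≡ false → ∀ e → below (suc j) D e ≡ below j D e
    below-suc′ j D j<m h e with D e in De
    ... | false = refl
    ... | true with toℕ e <ᵇ suc j in p | toℕ e <ᵇ j in q
    ...   | true  | true  = refl
    ...   | false | false = refl
    ...   | false | true  = ⊥-elim (true≢false (≡true (<⇒<ᵇ (m<n⇒m<1+n (<ᵇ⇒< (toℕ e) j (T≡ q))))) p)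
    ...   | true  | false = ⊥-elim (true≢false (≡true (<⇒<ᵇ (≤∧≢⇒< (≤-pred (<ᵇ⇒< (toℕ e) (suc j) (T≡ p))) ne))) q)
      where
      ne : toℕ e ≢ j
      ne eq = true≢false De (trans (cong D (Finₚ.toℕ-injective (trans eq (sym (Finₚ.toℕ-fromℕ< j<m))))) h)

  grow : ∀ I J D → I ⊆ᵇ J → κ (I ∪ᵇ D) + κ J ≤ κ I + κ (J ∪ᵇ D)
  grow I J D I⊆J = subst₂ _≤_ (cong (_+ κ J) (ext (λ e → cong (I e ∨_) (all e)))) (cong (κ I +_) (ext (λ e → cong (J e ∨_) (all e))))
                          (go m ≤-refl)
    where
    all : ∀ e → below m D e ≡ D e
    all e rewrite ≡true (<⇒<ᵇ (Finₚ.toℕ<n e)) = Boolₚ.∧-identityʳ (D e)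
    none : ∀ e → below 0 D e ≡ false
    none e = Boolₚ.∧-zeroʳ (D e)
    go : ∀ j → j ≤ m → κ (I ∪ᵇ below j D) + κ J ≤ κ I + κ (J ∪ᵇ below j D)
    go zero _ = ≤-reflexive (cong₂ _+_ (ext (λ e → trans (cong (I e ∨_) (none e)) (Boolₚ.∨-identityʳ _)))
                                       (ext (λ e → sym (trans (cong (J e ∨_) (none e)) (Boolₚ.∨-identityʳ _)))))
    go (suc j) j<m with D (fromℕ< j<m) in eq
    ... | false = subst₂ _≤_ (cong (_+ κ J) (ext (λ e → cong (I e ∨_) (sym (below-suc′ j D j<m eq e)))))
                             (cong (κ I +_) (ext (λ e → cong (J e ∨_) (sym (below-suc′ j D j<m eq e))))) (go j (<⇒≤ j<m))
    ... | true  = subst₂ _≤_ (cong (_+ κ J) (ext (step I))) (cong (κ I +_) (ext (step J)))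
      (≤-by 0 (+-mono-≤ (go j (<⇒≤ j<m)) (diminishing (I ∪ᵇ below j D) (J ∪ᵇ below j D) (fromℕ< j<m) sub)) (shuffle (κ (J ∪ᵇ b ⊕ fromℕ< j<m)) (κ (I ∪ᵇ b ⊕ fromℕ< j<m)) (κ I) (κ J) (κ (I ∪ᵇ b)) (κ (J ∪ᵇ b))))
      where
      b = below j D
      step : ∀ K e → (K ∪ᵇ below j D ⊕ fromℕ< j<m) e ≡ (K ∪ᵇ below (suc j) D) e
      step K e = trans (Boolₚ.∨-assoc (K e) _ _) (cong (K e ∨_) (sym (below-suc j D j<m eq e)))
      sub : (I ∪ᵇ below j D) ⊆ᵇ (J ∪ᵇ below j D)
      sub e h with ∨-true {I e} h
      ... | inj₁ p = ∨-trueˡ (I⊆J e p)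
      ... | inj₂ p = ∨-trueʳ {J e} p
      shuffle : ∀ x y i j a b → y + j + (i + b + (a + x)) + 0 ≡ i + x + (a + j + (y + b))
      shuffle x y i j a b = solve (x ∷ y ∷ i ∷ j ∷ a ∷ b ∷ [])

components : ∀ {n m} → (Fin m → Fin n × Fin n) → (Fin m → Bool) → ℕ
components link A = roots (Labelling.L (labelling link A))

Edges-mono : ∀ {n m} {link : Fin m → Fin n × Fin n} {A B} → A ⊆ᵇ B → ∀ {a b} → Edges link A a b → Edges link B a b
Edges-mono sub (e , h , eq) = e , sub e h , eq

module _ {n m} (link : Fin m → Fin n × Fin n) where
  private
    lab : (Fin m → Bool) → Fin n → Fin n
    lab A = Labelling.L (labelling link A)

  components-antitone : ∀ {A B} → A ⊆ᵇ B → components link B ≤ components link A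
  components-antitone {A} {B} sub = roots-antitone (labelling link A) (labelling link B) (Edges-mono sub)

  components-ext : ∀ {A B} → A ≗ B → components link A ≡ components link B
  components-ext h = ≤-antisym (components-antitone (λ e p → trans (h e) p)) (components-antitone (λ e p → trans (sym (h e)) p))

  components-⊕ : ∀ A e → components link (A ⊕ e) + ⟦ not (is (lab A (proj₂ (link e))) (lab A (proj₁ (link e)))) ⟧ ≡ components link A
  components-⊕ A e with merge (labelling link A) (proj₁ (link e)) (proj₂ (link e))
  ... | ℓ′ , eq = trans (cong (_+ _) (≤-antisym (roots-antitone ℓ′ (labelling link (A ⊕ e)) to)
                                                (roots-antitone (labelling link (A ⊕ e)) ℓ′ from))) eq
    where
    to : ∀ {a b} → Joined (Edges link A) (proj₁ (link e)) (proj₂ (link e)) a b → Edges link (A ⊕ e) a b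
    to (inj₁ (e′ , h , p)) = e′ , ∨-trueˡ h , p
    to (inj₂ (refl , refl)) = e , ∨-trueʳ {A e} (is-refl e) , refl
    from : ∀ {a b} → Edges link (A ⊕ e) a b → Joined (Edges link A) (proj₁ (link e)) (proj₂ (link e)) a b
    from (e′ , h , refl) with ∨-true {A e′} h
    ... | inj₁ p = inj₁ (e′ , p , refl)
    ... | inj₂ p with is-≡ {u = e} {e′} p
    ...   | refl = inj₂ (refl , refl)

  components-diminishing : ∀ A B e → A ⊆ᵇ B →
    components link (A ⊕ e) + components link B ≤ components link A + components link (B ⊕ e)
  components-diminishing A B e sub = subst₂ (λ x y → components link (A ⊕ e) + x ≤ y + components link (B ⊕ e))
    (components-⊕ B e) (components-⊕ A e)
    (≤-by 0 (⟦⟧-mono finer) (shuffle (components link (A ⊕ e)) (components link (B ⊕ e)) _ _))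
    where
    a = proj₁ (link e)
    b = proj₂ (link e)
    c = coarser (labelling link A) (labelling link B) (Edges-mono sub)
    finer : not (is (lab B b) (lab B a)) ≡ true → not (is (lab A b) (lab A a)) ≡ true
    finer h = not-false (is-≢ λ eq → is-false (not-true h) (trans (sym (c a)) (trans (cong (lab B) eq) (c b))))
    shuffle : ∀ x y p q → x + (y + p) + q + 0 ≡ x + q + y + p
    shuffle x y p q = solve (x ∷ y ∷ p ∷ q ∷ [])

  components-supermodular : Supermodular (components link)
  components-supermodular = record
    { ext = components-ext ; antitone = components-antitone
    ; supermodular = λ A B →
        let I⊆A = λ e (h : (A ∩ᵇ B) e ≡ true) → ∧-trueˡ h
            absorb = λ e → absorption (A e) (B e)
        in subst₂ _≤_
             (trans (cong (_+ components link A) (components-ext absorb)) (+-comm (components link B) _))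
             (+-comm (components link (A ∩ᵇ B)) _)
             (grow (components link) components-ext components-diminishing (A ∩ᵇ B) A B I⊆A) }
    where
    absorption : ∀ a b → (a ∧ b) ∨ b ≡ b
    absorption true  true  = refl
    absorption true  false = refl
    absorption false b     = refl

∘-supermodular : ∀ {m M} {κ : (Fin m → Bool) → ℕ} → Supermodular κ → (f : Fin m → Fin M) (U : Fin m → Bool) →
  Supermodular (λ A → κ (U ∩ᵇ (A ∘ f)))
∘-supermodular S f U = record
  { ext = λ h → ext (λ e → cong (U e ∧_) (h (f e)))
  ; antitone = λ sub → antitone (λ e h → ∧-true (∧-trueˡ h) (sub (f e) (∧-trueʳ {U e} h)))
  ; supermodular = λ A B → ≤-trans (supermodular _ _) (≤-reflexive (cong₂ _+_
      (ext (λ e → sym (Boolₚ.∧-distribˡ-∨ (U e) (A (f e)) (B (f e)))))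
      (ext (λ e → meet (U e) (A (f e)) (B (f e)))))) }
  where
  open Supermodular S
  meet : ∀ u a b → (u ∧ a) ∧ (u ∧ b) ≡ u ∧ (a ∧ b)
  meet true  a b = refl
  meet false a b = refl

∑-update₂ : ∀ {n} (f g : Fin n → ℕ) {a b} → a ≢ b → (∀ e → e ≢ a → e ≢ b → f e ≡ g e) →
  ∑ f + (g a + g b) ≡ ∑ g + (f a + f b)
∑-update₂ {n} f g {a} {b} a≢b off = begin
  ∑ f + (g a + g b) ≡⟨ sym (+-assoc (∑ f) (g a) (g b)) ⟩
  ∑ f + g a + g b   ≡⟨ cong (λ z → ∑ f + z + g b) (sym at-a) ⟩
  ∑ f + h a + g b   ≡⟨ cong (_+ g b) (∑-update f h a (λ e ne → sym (off-a e ne))) ⟩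
  ∑ h + f a + g b   ≡⟨ swap (∑ h) (f a) (g b) ⟩
  ∑ h + g b + f a   ≡⟨ cong (_+ f a) (∑-update h g b off-b) ⟩
  ∑ g + h b + f a   ≡⟨ cong (λ z → ∑ g + z + f a) (off-a b (a≢b ∘ sym)) ⟩
  ∑ g + f b + f a   ≡⟨ trans (swap (∑ g) (f b) (f a)) (+-assoc (∑ g) (f a) (f b)) ⟩
  ∑ g + (f a + f b) ∎
  where
  open ≡-Reasoning
  swap : ∀ x y z → x + y + z ≡ x + z + y
  swap x y z = solve (x ∷ y ∷ z ∷ [])
  h : Fin n → ℕ
  h e = if is a e then g e else f e
  at-a : h a ≡ g a
  at-a rewrite is-refl a = refl
  off-a : ∀ e → e ≢ a → h e ≡ f e
  off-a e ne rewrite is-≢ ne = refl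
  off-b : ∀ e → e ≢ b → h e ≡ g e
  off-b e ne with e ≟ a
  ... | yes refl = refl
  ... | no ne′   = off e ne′ ne

if-at : ∀ {A : Set} {m} (e : Fin m) {p q : A} → (if is e e then p else q) ≡ p
if-at e rewrite is-refl e = refl

if-off : ∀ {A : Set} {m} {e e′ : Fin m} {p q : A} → e′ ≢ e → (if is e e′ then p else q) ≡ q
if-off ne rewrite is-≢ ne = refl

missing : ∀ {m} (A B : Fin m → Bool) → count (A ∩ᵇ B) < count A → ∃ λ e → A e ≡ true × B e ≡ false
missing A B lt with count-witness (A ∖ B) (+-cancelˡ-≤ (count (A ∩ᵇ B)) _ _
    (≤-trans (≤-reflexive (+-comm _ 1)) (≤-trans lt (≤-reflexive (trans (∑-cong pointwise) (∑-+ _ _))))))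
  where
  pointwise : ∀ e → ⟦ A e ⟧ ≡ ⟦ (A ∩ᵇ B) e ⟧ + ⟦ (A ∖ B) e ⟧
  pointwise e with A e | B e
  ... | false | _     = refl
  ... | true  | true  = refl
  ... | true  | false = refl
... | e , h = e , ∧-trueˡ h , not-true (∧-trueʳ {A e} h)

count-pair : ∀ {n} (X : Fin n → Bool) → 2 ≤ count X → ∃ λ a → ∃ λ b → a ≢ b × X a ≡ true × X b ≡ true
count-pair X two with count-witness X (≤-trans (s≤s z≤n) two)
... | a , Xa with missing X (is a) one
  where
  one : count (X ∩ᵇ is a) < count X
  one = ≤-trans (s≤s (≤-trans (count-mono (λ e → ∧-trueʳ {X e})) (≤-reflexive (∑-is-1 a)))) two
...   | b , Xb , ne = a , b , (λ { refl → true≢false (is-refl a) ne }) , Xa , Xb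

-- A hub has three edges: p and q to the two sides of a partition, and ⟦ w ⟧ to v. If 2 ≤ p, the
-- hub joins the first side, where it costs its other edges; otherwise it costs p edges there.
majority-numbers : ∀ w c p q → p + q + ⟦ w ⟧ ≡ 3 → (1 ≤ p → 1 ≤ q → c ≡ true) →
  (if 2 ≤ᵇ p then q + ⟦ w ⟧ else p) + (if 2 ≤ᵇ q then p + ⟦ w ⟧ else q) ≤ 2 * ⟦ not w ∧ c ⟧ + (⟦ w ⟧ + ⟦ w ∧ c ⟧)
majority-numbers false c p q eq h = go p q (trans (sym (+-identityʳ (p + q))) eq) h
  where
  go : ∀ p q → p + q ≡ 3 → (1 ≤ p → 1 ≤ q → c ≡ true) →
    (if 2 ≤ᵇ p then q + 0 else p) + (if 2 ≤ᵇ q then p + 0 else q) ≤ 2 * ⟦ c ⟧ + 0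
  go 0 .3 refl h = z≤n
  go 1 .2 refl h rewrite h (s≤s z≤n) (s≤s z≤n) = ≤-refl
  go 2 .1 refl h rewrite h (s≤s z≤n) (s≤s z≤n) = ≤-refl
  go 3 .0 refl h = z≤n
  go (suc (suc (suc (suc p)))) q () h
majority-numbers true  c p q eq h = go p q (+-cancelʳ-≡ 1 (p + q) 2 eq) h
  where
  go : ∀ p q → p + q ≡ 2 → (1 ≤ p → 1 ≤ q → c ≡ true) →
    (if 2 ≤ᵇ p then q + 1 else p) + (if 2 ≤ᵇ q then p + 1 else q) ≤ 2 * 0 + (1 + ⟦ c ⟧)
  go 0 .2 refl h = m≤m+n 1 _
  go 1 .1 refl h rewrite h (s≤s z≤n) (s≤s z≤n) = ≤-refl
  go 2 .0 refl h = m≤m+n 1 _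
  go (suc (suc (suc p))) q () h

many-components : ∀ k r t u f → (32 * k + r) * t ≤ 4 * (u + f) + 2 * (36 * k + r) → f ≤ k + k → 3 ≤ t →
  (k + k) * t ≤ u + (k + k)
many-components k r t u f le fk t≥3 = *-cancelˡ-≤ 4 (subst (λ t → 4 * ((k + k) * t) ≤ 4 * (u + (k + k))) (m+[n∸m]≡n t≥3)
  (≤-by (24 * k * w + r * w + r) (+-mono-≤ (subst (λ t → (32 * k + r) * t ≤ 4 * (u + f) + 2 * (36 * k + r)) (sym (m+[n∸m]≡n t≥3)) le) (*-monoʳ-≤ 4 fk))
    (equation w)))
  where
  w = t ∸ 3
  equation : ∀ w → 4 * ((k + k) * (3 + w)) + (4 * (u + f) + 2 * (36 * k + r) + 4 * (k + k)) + (24 * k * w + r * w + r)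
                 ≡ 4 * (u + (k + k)) + ((32 * k + r) * (3 + w) + 4 * f)
  equation w = solve (k ∷ r ∷ w ∷ u ∷ f ∷ [])

class : ∀ {M N} → (Fin M → Maybe (Fin N)) → Fin N → Fin M → Bool
class C j e = hasColour (C e) j

∅ : ∀ {M} → Fin M → Bool
∅ _ = false

-- Matroid union for supermodular κ: the elements of U are coloured one at a time, keeping
-- the inequality `Invariant`. An element e that could go to no colour would give, for each
-- colour, a tight set that absorbs e; the union of these sets is tight and absorbs e in all
-- colours, which violates the inequality.
module Packing {M} (κ : (Fin M → Bool) → ℕ) (S : Supermodular κ) (N κ₀ : ℕ) (κ₀≤ : ∀ A → κ₀ ≤ κ A) where
  open Supermodular S

  Φ : (Fin M → Maybe (Fin N)) → (Fin M → Bool) → ℕ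
  Φ C A = ∑ (λ j → κ (class C j ∪ᵇ A))

  Invariant : (Fin M → Maybe (Fin N)) → (Fin M → Bool) → Set
  Invariant C U = ∀ A → Φ C A ≤ count (U ∖ A) + N * κ₀

  Violation : (Fin M → Maybe (Fin N)) → (Fin M → Bool) → (Fin M → Bool) → Set
  Violation C U A = count (U ∖ A) + N * κ₀ < Φ C A

  violation? : ∀ C U → Dec (∃ (Violation C U))
  violation? C U = search
    (λ {X} {Y} h → subst₂ _<_ (cong (_+ N * κ₀) (count-cong (λ e → cong (λ z → U e ∧ not z) (h e))))
                              (∑-cong (λ j → ext (λ e → cong (class C j e ∨_) (h e)))))
    (λ A → _ <? _)

  module Step (C : Fin M → Maybe (Fin N)) (U : Fin M → Bool) (inv : Invariant C U)
              (e : Fin M) (e∈U : U e ≡ true) (Ce : C e ≡ nothing) where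

    put : Fin N → Fin M → Maybe (Fin N)
    put i e′ with e′ ≟ e
    ... | yes _ = just i
    ... | no _  = C e′

    put-other : ∀ i {e′} → e′ ≢ e → put i e′ ≡ C e′
    put-other i {e′} ne with e′ ≟ e
    ... | yes p = ⊥-elim (ne p)
    ... | no _  = refl

    U⁻ : Fin M → Bool
    U⁻ = U ∖ is e

    Tight : (Fin M → Bool) → Set
    Tight A = A e ≡ false × count (U ∖ A) + N * κ₀ ≤ Φ C A

    Absorbs : Fin N → (Fin M → Bool) → Set
    Absorbs i A = κ (class C i ∪ᵇ A) ≤ κ (class C i ∪ᵇ (A ⊕ e))

    class-put : ∀ i → class (put i) i ≗ class C i ⊕ e
    class-put i e′ with e′ ≟ e
    ... | yes refl = trans (is-refl i) (sym (Boolₚ.∨-zeroʳ _))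
    ... | no _     = sym (Boolₚ.∨-identityʳ _)

    class-⊆-put : ∀ i j → class C j ⊆ᵇ class (put i) j
    class-⊆-put i j e′ h with e′ ≟ e
    ... | yes refl rewrite Ce = ⊥-elim (true≢false h refl)
    ... | no _     = h

    remove-e : ∀ A → count (U ∖ (A ∖ is e)) ≡ suc (count (U⁻ ∖ A))
    remove-e A = trans (sym (+-identityʳ _)) (trans (cong (count (U ∖ (A ∖ is e)) +_) (sym at))
      (trans (∑-update _ _ e off) (trans (cong (count (U⁻ ∖ A) +_) at′) (+-comm _ 1))))
      where
      off : ∀ e′ → e′ ≢ e → ⟦ (U ∖ (A ∖ is e)) e′ ⟧ ≡ ⟦ (U⁻ ∖ A) e′ ⟧
      off e′ ne rewrite is-≢ ne with A e′ | U e′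
      ... | true  | true  = refl
      ... | true  | false = refl
      ... | false | true  = refl
      ... | false | false = refl
      at : ⟦ (U⁻ ∖ A) e ⟧ ≡ 0
      at rewrite is-refl e | e∈U = refl
      at′ : ⟦ (U ∖ (A ∖ is e)) e ⟧ ≡ 1
      at′ rewrite is-refl e | e∈U | Boolₚ.∧-zeroʳ (A e) = refl

    insert-e : ∀ A → A e ≡ false → count (U ∖ A) ≡ suc (count (U ∖ (A ⊕ e)))
    insert-e A Ae = trans (sym (+-identityʳ _)) (trans (cong (count (U ∖ A) +_) (sym at))
      (trans (∑-update _ _ e off) (trans (cong (count (U ∖ (A ⊕ e)) +_) at′) (+-comm _ 1))))
      where
      off : ∀ e′ → e′ ≢ e → ⟦ (U ∖ A) e′ ⟧ ≡ ⟦ (U ∖ (A ⊕ e)) e′ ⟧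
      off e′ ne rewrite is-≢ ne | Boolₚ.∨-identityʳ (A e′) = refl
      at : ⟦ (U ∖ (A ⊕ e)) e ⟧ ≡ 0
      at rewrite is-refl e | Boolₚ.∨-zeroʳ (A e) = cong ⟦_⟧ (Boolₚ.∧-zeroʳ (U e))
      at′ : ⟦ (U ∖ A) e ⟧ ≡ 1
      at′ rewrite Ae | e∈U = refl

    tight-of : ∀ i → ∃ (Violation (put i) U⁻) → ∃ λ A → Tight A × Absorbs i A
    tight-of i (A , viol) = A′ , (A′e , ≤-trans low mid) , ≤-trans (≤-reflexive (sym (eq i))) (≤-reflexive (ext same))
      where
      A′ = A ∖ is e
      A′e : A′ e ≡ false
      A′e rewrite is-refl e = Boolₚ.∧-zeroʳ (A e)
      low : count (U ∖ A′) + N * κ₀ ≤ Φ (put i) A′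
      low = ≤-trans (≤-trans (≤-reflexive (cong (_+ N * κ₀) (remove-e A))) viol)
                    (∑-mono (λ j → antitone (λ e′ h → [ ∨-trueˡ , (λ p → ∨-trueʳ {class (put i) j e′} (∧-trueˡ p)) ]′ (∨-true {class (put i) j e′} h))))
      pointwise : ∀ j → κ (class (put i) j ∪ᵇ A′) ≤ κ (class C j ∪ᵇ A′)
      pointwise j = antitone (λ e′ h → [ (λ p → ∨-trueˡ (class-⊆-put i j e′ p)) , ∨-trueʳ {class (put i) j e′} ]′ (∨-true {class C j e′} h))
      mid : Φ (put i) A′ ≤ Φ C A′
      mid = ∑-mono pointwise
      eq : ∀ j → κ (class (put i) j ∪ᵇ A′) ≡ κ (class C j ∪ᵇ A′)
      eq = ∑-squeeze pointwise (≤-trans (inv A′) low)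
      same : (class (put i) i ∪ᵇ A′) ≗ (class C i ∪ᵇ (A′ ⊕ e))
      same e′ rewrite class-put i e′ with class C i e′ | is e e′ | A′ e′
      ... | true  | _     | _     = refl
      ... | false | true  | true  = refl
      ... | false | true  | false = refl
      ... | false | false | true  = refl
      ... | false | false | false = refl

    tight-∪ : ∀ {A B} → Tight A → Tight B → Tight (A ∪ᵇ B)
    tight-∪ {A} {B} (Ae , tA) (Be , tB) = cong₂ _∨_ Ae Be ,
      ≤-by 0 (+-mono-≤ (+-mono-≤ tA tB) (+-mono-≤ sup (inv (A ∩ᵇ B))))
        (trans (shuffle (count (U ∖ (A ∪ᵇ B))) (N * κ₀) (Φ C A) (Φ C B) (Φ C (A ∪ᵇ B)) (Φ C (A ∩ᵇ B)) (count (U ∖ (A ∩ᵇ B))))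
          (trans (cong (λ z → Φ C (A ∪ᵇ B) + ((z + (N * κ₀ + N * κ₀)) + (Φ C A + Φ C B + Φ C (A ∩ᵇ B)))) (sym modular))
            (shuffle′ (count (U ∖ A)) (count (U ∖ B)) (N * κ₀) (Φ C A) (Φ C B) (Φ C (A ∪ᵇ B)) (Φ C (A ∩ᵇ B)))))
      where
      modular : count (U ∖ A) + count (U ∖ B) ≡ count (U ∖ (A ∪ᵇ B)) + count (U ∖ (A ∩ᵇ B))
      modular = trans (sym (∑-+ _ _)) (trans (∑-cong pointwise) (∑-+ _ _))
        where
        pointwise : ∀ e → ⟦ (U ∖ A) e ⟧ + ⟦ (U ∖ B) e ⟧ ≡ ⟦ (U ∖ (A ∪ᵇ B)) e ⟧ + ⟦ (U ∖ (A ∩ᵇ B)) e ⟧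
        pointwise e with U e | A e | B e
        ... | false | _     | _     = refl
        ... | true  | true  | true  = refl
        ... | true  | true  | false = refl
        ... | true  | false | true  = refl
        ... | true  | false | false = refl
      sup : Φ C A + Φ C B ≤ Φ C (A ∪ᵇ B) + Φ C (A ∩ᵇ B)
      sup = ≤-trans (≤-reflexive (sym (∑-+ _ _))) (≤-trans (∑-mono pointwise) (≤-reflexive (∑-+ _ _)))
        where
        join : ∀ c a b → (c ∨ a) ∨ (c ∨ b) ≡ c ∨ (a ∨ b)
        join true  a b = refl
        join false a b = refl
        meet : ∀ c a b → (c ∨ a) ∧ (c ∨ b) ≡ c ∨ (a ∧ b)
        meet true  a b = refl
        meet false a b = refl
        pointwise : ∀ j → κ (class C j ∪ᵇ A) + κ (class C j ∪ᵇ B) ≤ κ (class C j ∪ᵇ (A ∪ᵇ B)) + κ (class C j ∪ᵇ (A ∩ᵇ B))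
        pointwise j = ≤-trans (supermodular _ _) (≤-reflexive (cong₂ _+_
          (ext (λ e → join (class C j e) (A e) (B e))) (ext (λ e → meet (class C j e) (A e) (B e)))))
      shuffle : ∀ u n a b x y w → u + n + (a + b + (x + y + (w + n))) + 0 ≡ x + ((u + w + (n + n)) + (a + b + y))
      shuffle u n a b x y w = solve (u ∷ n ∷ a ∷ b ∷ x ∷ y ∷ w ∷ [])
      shuffle′ : ∀ p q n a b x y → x + ((p + q + (n + n)) + (a + b + y)) ≡ x + (p + n + (q + n) + (a + b + y))
      shuffle′ p q n a b x y = solve (p ∷ q ∷ n ∷ a ∷ b ∷ x ∷ y ∷ [])

    absorbs-⊆ : ∀ {i A B} → A ⊆ᵇ B → B e ≡ false → Absorbs i A → Absorbs i B
    absorbs-⊆ {i} {A} {B} sub Be absorbs = ≤-by 0 (+-mono-≤ (supermodular (c ∪ᵇ (A ⊕ e)) (c ∪ᵇ B)) absorbs)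
      (trans (cong₂ (λ x y → κ (c ∪ᵇ B) + (x + y + κ (c ∪ᵇ (A ⊕ e))) + 0) (ext join) (ext meet))
             (shuffle (κ (c ∪ᵇ B)) (κ (c ∪ᵇ (B ⊕ e))) (κ (c ∪ᵇ A)) (κ (c ∪ᵇ (A ⊕ e)))))
      where
      c = class C i
      shuffle : ∀ b be a ae → b + (be + a + ae) + 0 ≡ be + (ae + b + a)
      shuffle b be a ae = solve (b ∷ be ∷ a ∷ ae ∷ [])
      join : (c ∪ᵇ (A ⊕ e)) ∪ᵇ (c ∪ᵇ B) ≗ c ∪ᵇ (B ⊕ e)
      join e′ with c e′ | A e′ in p | B e′ in q | is e e′
      ... | true  | _     | _     | _     = refl
      ... | false | true  | true  | _     = refl
      ... | false | true  | false | _     = ⊥-elim (true≢false (sub e′ p) q)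
      ... | false | false | true  | true  = refl
      ... | false | false | true  | false = refl
      ... | false | false | false | true  = refl
      ... | false | false | false | false = refl
      meet : (c ∪ᵇ (A ⊕ e)) ∩ᵇ (c ∪ᵇ B) ≗ c ∪ᵇ A
      meet e′ with e′ ≟ e
      ... | yes refl rewrite Ce | Be | ≢true (λ h → true≢false (sub e h) Be) = refl
      ... | no _ with c e′ | A e′ in p | B e′ in q
      ...   | true  | _     | _     = refl
      ...   | false | true  | true  = refl
      ...   | false | true  | false = ⊥-elim (true≢false (sub e′ p) q)
      ...   | false | false | true  = refl
      ...   | false | false | false = refl

    union : ∀ n (As : Fin (suc n) → ∃ Tight) → Σ (∃ Tight) λ B → ∀ i → proj₁ (As i) ⊆ᵇ proj₁ B
    union zero    As = As zero , λ { zero e h → h }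
    union (suc n) As with union n (As ∘ suc)
    ... | (B , tB) , sub = (proj₁ (As zero) ∪ᵇ B , tight-∪ (proj₂ (As zero)) tB) ,
      λ { zero e h → ∨-trueˡ h ; (suc i) e h → ∨-trueʳ {proj₁ (As zero) e} (sub i e h) }

    not-all-violated : ∀ n → N ≡ suc n → ¬ (∀ i → ∃ (Violation (put i) U⁻))
    not-all-violated n refl viol with union n (λ i → let (A , t , _) = tight-of i (viol i) in A , t)
    ... | (B , Be , tB) , sub = <⇒≱ (≤-trans (≤-reflexive (cong (_+ N * κ₀) (sym (insert-e B Be)))) (≤-trans tB
            (∑-mono (λ i → absorbs-⊆ {i} (sub i) Be (proj₂ (proj₂ (tight-of i (viol i)))))))) (inv (B ⊕ e))

    extend : ∀ n → N ≡ suc n → Σ (Fin N) λ i → Invariant (put i) U⁻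
    extend n refl with Finₚ.any? (λ i → ¬? (violation? (put i) U⁻))
    ... | yes (i , ok) = i , λ A → ≮⇒≥ (λ lt → ok (A , lt))
    ... | no all = ⊥-elim (not-all-violated n refl (λ i → decidable-stable (violation? (put i) U⁻) (λ ¬v → all (i , ¬v))))

  Packed : (Fin M → Bool) → Set
  Packed U₀ = Σ (Fin M → Maybe (Fin N)) λ C → (∀ e j → C e ≡ just j → U₀ e ≡ true) × (∀ j → κ (class C j) ≤ κ₀)

  colour-all : ∀ {n} → N ≡ suc n → ∀ U₀ fuel C U → count U ≤ fuel → Invariant C U →
    (∀ e → U e ≡ true → C e ≡ nothing × U₀ e ≡ true) → (∀ e j → C e ≡ just j → U₀ e ≡ true) → Packed U₀
  colour-all {n} eq U₀ fuel C U le inv U∅ C⊆ with Finₚ.any? (λ e → U e Boolₚ.≟ true)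
  ... | no none = C , C⊆ , λ j → ≤-reflexive (trans (ext (λ e → sym (Boolₚ.∨-identityʳ _)))
                    (sym (∑-squeeze {f = λ _ → κ₀} {λ j → κ (class C j ∪ᵇ ∅)} (λ j → κ₀≤ _)
                      (≤-trans (inv ∅) (≤-reflexive (trans (cong (_+ N * κ₀) (∑-zero (λ e → cong ⟦_⟧ (empty e)))) (sym (∑-const N κ₀))))) j)))
    where
    empty : ∀ e → (U ∖ ∅) e ≡ false
    empty e rewrite ≢true (λ h → none (e , h)) = refl
  colour-all {n} eq U₀ zero C U le inv U∅ C⊆ | yes (e , h) = ⊥-elim (<⇒≱ (count-pos U h) le)
  colour-all {n} eq U₀ (suc fuel) C U le inv U∅ C⊆ | yes (e , h) =
    let i , inv′ = extend n eq in colour-all eq U₀ fuel (put i) U⁻ small inv′ (free i) (within i)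
    where
    open Step C U inv e h (proj₁ (U∅ e h))
    small : count U⁻ ≤ fuel
    small = ≤-pred (≤-trans (∑-< (λ e′ → ⟦⟧-mono (∧-trueˡ {U e′})) e (subst₂ _<_ (cong ⟦_⟧ (sym out)) (cong ⟦_⟧ (sym h)) ≤-refl)) le)
      where
      out : U⁻ e ≡ false
      out rewrite is-refl e = Boolₚ.∧-zeroʳ (U e)
    free : ∀ i e′ → U⁻ e′ ≡ true → put i e′ ≡ nothing × U₀ e′ ≡ true
    free i e′ p = trans (put-other i (is-false (not-true (∧-trueʳ {U e′} p)))) (proj₁ (U∅ e′ (∧-trueˡ p))) , proj₂ (U∅ e′ (∧-trueˡ p))
    within : ∀ i e′ j → put i e′ ≡ just j → U₀ e′ ≡ true
    within i e′ j p with e′ ≟ e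
    ... | yes refl = proj₂ (U∅ e h)
    ... | no _     = C⊆ e′ j p

  pack : ∀ {n} → N ≡ suc n → ∀ U → (∀ A → N * κ A ≤ count (U ∖ A) + N * κ₀) → Packed U
  pack eq U h = colour-all eq U (count U) (λ _ → nothing) U ≤-refl
    (λ A → ≤-trans (≤-reflexive (∑-const N (κ A))) (h A)) (λ e p → refl , p) (λ e j ())

Graph : ℕ → ℕ → Set
Graph n m = Fin m → Fin n × Fin n

module _ {n m} (ends : Graph n m) where
  src tgt : Fin m → Fin n
  src e = proj₁ (ends e)
  tgt e = proj₂ (ends e)

  δ : (Fin n → Bool) → Fin m → Bool
  δ X e = X (src e) xor X (tgt e)

  d : (Fin n → Bool) → ℕ
  d X = count (δ X)

  far : Fin n → Fin m → Fin n
  far u e = if is u (src e) then tgt e else src e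

  live : Fin m → Bool
  live e = not (is (src e) (tgt e))

  δ-cong : ∀ {X Y} → X ≗ Y → ∀ e → δ X e ≡ δ Y e
  δ-cong h e = cong₂ _xor_ (h (src e)) (h (tgt e))

  d-cong : ∀ {X Y} → X ≗ Y → d X ≡ d Y
  d-cong h = count-cong (δ-cong h)

  δ-not : ∀ X e → δ (not ∘ X) e ≡ δ X e
  δ-not X e with X (src e) | X (tgt e)
  ... | true  | true  = refl
  ... | true  | false = refl
  ... | false | true  = refl
  ... | false | false = refl

  d-not : ∀ X → d (not ∘ X) ≡ d X
  d-not X = count-cong (δ-not X)

  δ-ends : ∀ {u e} → δ (is u) e ≡ true →
    (src e ≡ u × tgt e ≢ u × far u e ≡ tgt e) ⊎ (tgt e ≡ u × src e ≢ u × far u e ≡ src e)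
  δ-ends {u} {e} h with src e ≟ u | tgt e ≟ u
  ... | yes p | no q  = inj₁ (p , q , refl)
  ... | no p  | yes q = inj₂ (q , p , refl)

  far≢ : ∀ {u e} → δ (is u) e ≡ true → far u e ≢ u
  far≢ {u} {e} h with δ-ends {u} {e} h
  ... | inj₁ (_ , ne , eq) = λ p → ne (trans (sym eq) p)
  ... | inj₂ (_ , ne , eq) = λ p → ne (trans (sym eq) p)

  src-δ : ∀ {u e} → src e ≡ u → tgt e ≢ u → δ (is u) e ≡ true
  src-δ p q = cong₂ _xor_ (is-true p) (is-≢ q)

  tgt-δ : ∀ {u e} → tgt e ≡ u → src e ≢ u → δ (is u) e ≡ true
  tgt-δ p q = cong₂ _xor_ (is-≢ q) (is-true p)

  far-src : ∀ {u e} → src e ≡ u → far u e ≡ tgt e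
  far-src {u} {e} p = cong (λ b → if b then tgt e else src e) (is-true p)

  far-tgt : ∀ {u e} → src e ≢ u → far u e ≡ src e
  far-tgt {u} {e} p = cong (λ b → if b then tgt e else src e) (is-≢ p)

  δ-at : ∀ {u e} X → δ (is u) e ≡ true → δ X e ≡ X u xor X (far u e)
  δ-at {u} {e} X h with δ-ends {u} {e} h
  ... | inj₁ (p , _ , q) = cong₂ _xor_ (cong X p) (cong X (sym q))
  ... | inj₂ (p , _ , q) = trans (Boolₚ.xor-comm (X (src e)) _) (cong₂ _xor_ (cong X p) (cong X (sym q)))

  δ-far : ∀ {u e} → δ (is u) e ≡ true → δ (is (far u e)) e ≡ true
  δ-far {u} {e} h = trans (δ-at (is (far u e)) h) (cong₂ _xor_ (is-≢ (far≢ h ∘ sym)) (is-refl (far u e)))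

  far-far : ∀ {u e} → δ (is u) e ≡ true → far (far u e) e ≡ u
  far-far {u} {e} h with δ-ends {u} {e} h
  ... | inj₁ (p , ne , q) = trans (far-tgt (λ r → ne (trans (trans (sym q) (sym r)) p))) p
  ... | inj₂ (p , ne , q) = trans (far-src (sym q)) p

  live-δ : ∀ {e} → live e ≡ true → δ (is (src e)) e ≡ true × δ (is (tgt e)) e ≡ true
  live-δ {e} h = src-δ refl ne , tgt-δ refl (ne ∘ sym)
    where
    ne : tgt e ≢ src e
    ne = is-false (not-true h)

  δ-live : ∀ {X e} → δ X e ≡ true → live e ≡ true
  δ-live {X} {e} h = not-false (is-≢ (λ p → xor-≢ h (cong X (sym p))))

degree : ∀ {n m k} → Graph n m → (Fin m → Maybe (Fin k)) → Fin n → Fin k → ℕ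
degree ends c u i = count (λ e → δ ends (is u) e ∧ hasColour (c e) i)

coloured uncoloured : ∀ {k} → Maybe (Fin k) → Bool
coloured (just _) = true
coloured nothing  = false
uncoloured c = not (coloured c)

∑-hasColour : ∀ {k} (c : Maybe (Fin k)) → ∑ (λ i → ⟦ hasColour c i ⟧) ≡ ⟦ coloured c ⟧
∑-hasColour nothing  = ∑-zero (λ _ → refl)
∑-hasColour (just j) = trans (∑-cong (λ i → cong ⟦_⟧ (is-sym i j))) (∑-is-1 j)

∑-by-colour : ∀ {m k} (F : Fin m → Bool) (c : Fin m → Maybe (Fin k)) →
  ∑ (λ i → count (λ e → F e ∧ hasColour (c e) i)) ≡ count (λ e → F e ∧ coloured (c e))
∑-by-colour F c = trans (∑-swap _) (∑-cong pointwise)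
  where
  pointwise : ∀ e → ∑ (λ i → ⟦ F e ∧ hasColour (c e) i ⟧) ≡ ⟦ F e ∧ coloured (c e) ⟧
  pointwise e with F e
  ... | true  = ∑-hasColour (c e)
  ... | false = ∑-zero (λ _ → refl)

coloured-or-not : ∀ {m k} (F : Fin m → Bool) (c : Fin m → Maybe (Fin k)) →
  count (λ e → F e ∧ coloured (c e)) + count (λ e → F e ∧ uncoloured (c e)) ≡ count F
coloured-or-not F c = trans (sym (∑-+ _ _)) (∑-cong pointwise)
  where
  pointwise : ∀ e → ⟦ F e ∧ coloured (c e) ⟧ + ⟦ F e ∧ uncoloured (c e) ⟧ ≡ ⟦ F e ⟧
  pointwise e with F e | c e
  ... | false | _       = refl
  ... | true  | just _  = refl
  ... | true  | nothing = refl

⊔-∸ : ∀ a → 2 ⊔ a ≡ a + (2 ∸ a)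
⊔-∸ zero                = refl
⊔-∸ (suc zero)          = refl
⊔-∸ (suc (suc a))       = sym (trans (cong (suc (suc a) +_) (0∸n≡0 a)) (+-identityʳ _))

complete : ∀ {m k} (F : Fin m → Bool) (c : Fin m → Maybe (Fin k)) (default : Fin m → Fin k) →
  ∑ (λ i → 2 ⊔ count (λ e → F e ∧ hasColour (c e) i)) ≤ count F →
  Σ (Fin m → Fin k) λ pc → (∀ e i → c e ≡ just i → pc e ≡ i) ×
    (∀ i → 2 ≤ count (λ e → F e ∧ is i (pc e)))
complete {m} {k} F c default le = pc , agrees , twice
  where
  a : Fin k → ℕ
  a i = count (λ e → F e ∧ hasColour (c e) i)
  free : Fin m → Bool
  free e = F e ∧ uncoloured (c e)
  room : ∑ (λ i → 2 ∸ a i) ≤ count free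
  room = +-cancelˡ-≤ (∑ a) _ _ (≤-trans (≤-reflexive (trans (sym (∑-+ _ _)) (∑-cong (λ i → sym (⊔-∸ (a i))))))
    (≤-trans le (≤-reflexive (trans (sym (coloured-or-not F c)) (cong (_+ count free) (sym (∑-by-colour F c)))))))
  open Distribution (distribute k (λ i → 2 ∸ a i) free room)
  pick : Fin m → Maybe (Fin k) → Maybe (Fin k) → Fin k
  pick e (just i) _        = i
  pick e nothing  (just i) = i
  pick e nothing  nothing  = default e
  pc : Fin m → Fin k
  pc e = pick e (c e) (to e)
  agrees : ∀ e i → c e ≡ just i → pc e ≡ i
  agrees e i h rewrite h = refl
  twice : ∀ i → 2 ≤ count (λ e → F e ∧ is i (pc e))
  twice i = ≤-trans (≤-trans (m≤n⊔m (a i) 2) (≤-trans (≤-reflexive (⊔-comm (a i) 2)) (≤-reflexive (⊔-∸ (a i)))))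
    (≤-trans (+-monoʳ-≤ (a i) (enough i)) (≤-trans (≤-reflexive (sym (∑-+ _ _))) (∑-mono pointwise)))
    where
    pointwise : ∀ e → ⟦ F e ∧ hasColour (c e) i ⟧ + ⟦ hasColour (to e) i ⟧ ≤ ⟦ F e ∧ is i (pc e) ⟧
    pointwise e with to e in eq
    ... | nothing with c e
    ...   | just j  = ≤-reflexive (+-identityʳ _)
    ...   | nothing rewrite Boolₚ.∧-zeroʳ (F e) = z≤n
    pointwise e | just j with F e | c e | within e j eq
    ...   | true | nothing | refl = ≤-refl

Sep : ∀ {n} → (Fin n → Bool) → (Fin n → Bool) → Set
Sep S X = (∃ λ s → S s ≡ true × X s ≡ true) × (∃ λ s → S s ≡ true × X s ≡ false)

Terminal : ∀ {n m k} → Graph n m → (Fin n → Bool) → Fin n → (Fin m → Fin k) → Fin k → Fin n → Set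
Terminal ends S v pc i y =
  (S y ≡ true × y ≢ v) ⊎ (∃ λ e → δ ends (is v) e ≡ true × pc e ≡ i × y ≡ far ends v e)

-- A set of vertices is a Boolean predicate, and a loop stands for a deleted edge. The budget
-- D u replaces |E(u)| in the balance condition: it still counts deleted edges and self-loops.
-- Connectivity in colour i is expressed dually: no cut avoiding the edges at v and the edges
-- of colour i separates two terminals.
module Problem (k Q n m : ℕ) where

  K : ℕ
  K = Q * k

  Closed : Graph n m → (Fin m → Maybe (Fin k)) → Fin n → Fin k → (Fin n → Bool) → Set
  Closed ends c v i g = ∀ e → c e ≡ just i → δ ends (is v) e ≡ false → g (src ends e) ≡ g (tgt ends e)

  record Instance (ends : Graph n m) (S R : Fin n → Bool) (D : Fin n → ℕ) (v : Fin n) (pc : Fin m → Fin k) : Set where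
    field
      v∈S      : S v ≡ true
      other    : ∃ λ s → S s ≡ true × s ≢ v
      cut      : ∀ X → Sep S X → K ≤ d ends X
      degree-v : d ends (is v) ≡ K
      budget   : ∀ u → u ≢ v → S u ∨ R u ≡ true → d ends (is u) ≤ D u
      budget-R : ∀ u → R u ≡ true → (Q ∸ 2) * k ≤ D u
      twice    : ∀ i → 2 ≤ count (λ e → δ ends (is v) e ∧ is i (pc e))

  record Solution (ends : Graph n m) (S R : Fin n → Bool) (D : Fin n → ℕ) (v : Fin n) (pc : Fin m → Fin k) : Set where
    field
      c         : Fin m → Maybe (Fin k)
      extends   : ∀ e → δ ends (is v) e ≡ true → c e ≡ just (pc e)
      connected : ∀ i g → Closed ends c v i g → ∀ y z →
                  Terminal ends S v pc i y → Terminal ends S v pc i z → g y ≡ g z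
      balanced  : ∀ u → u ≢ v → S u ∨ R u ≡ true → ∑ (λ i → 2 ⊔ degree ends c u i) ≤ D u

  size : Graph n m → ℕ
  size ends = count (live ends)

  Solvable : ℕ → Set
  Solvable N = ∀ ends S R D v pc → size ends < N → Instance ends S R D v pc → Solution ends S R D v pc

  contract : (Fin n → Fin n) → Graph n m → Graph n m
  contract φ ends e = φ (src ends e) , φ (tgt ends e)

  -- Contraction along a tight cut X with v ∉ X: once X is replaced by s, once its complement by v.
  module Contraction {ends S R D v pc} (I : Instance ends S R D v pc) (X : Fin n → Bool) (Xv : X v ≡ false)
    (s : Fin n) (s∈S : S s ≡ true) (Xs : X s ≡ true) (tight : d ends X ≡ K) where
    open Instance I

    φ₁ φ₂ : Fin n → Fin n
    φ₁ y = if X y then s else y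
    φ₂ y = if X y then y else v

    ends₁ ends₂ : Graph n m
    ends₁ = contract φ₁ ends
    ends₂ = contract φ₂ ends

    D₁ : Fin n → ℕ
    D₁ u = if is s u then K else D u

    fixed : (Fin n → Fin n) → Fin n → Bool
    fixed φ y = is y (φ y)

    in₁ : ∀ {y} → X y ≡ true → φ₁ y ≡ s
    in₁ h rewrite h = refl

    out₁ : ∀ {y} → X y ≡ false → φ₁ y ≡ y
    out₁ h rewrite h = refl

    in₂ : ∀ {y} → X y ≡ true → φ₂ y ≡ y
    in₂ h rewrite h = refl

    out₂ : ∀ {y} → X y ≡ false → φ₂ y ≡ v
    out₂ h rewrite h = refl

    apart : ∀ {y z} → X y ≡ true → X z ≡ false → y ≢ z
    apart p q refl = true≢false p q

    is-v₁ : ∀ y → is v (φ₁ y) ≡ is v y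
    is-v₁ y with X y in eq
    ... | true  = trans (is-≢ (apart Xs Xv)) (sym (is-≢ (apart eq Xv)))
    ... | false = refl

    is-v₂ : ∀ y → is v (φ₂ y) ≡ not (X y)
    is-v₂ y with X y in eq
    ... | true  = is-≢ (apart eq Xv)
    ... | false = is-refl v

    is-s₁ : ∀ y → is s (φ₁ y) ≡ X y
    is-s₁ y with X y in eq
    ... | true  = is-refl s
    ... | false = is-≢ (apart Xs eq ∘ sym)

    is-out₁ : ∀ {u} → X u ≡ false → ∀ y → is u (φ₁ y) ≡ is u y
    is-out₁ Xu y with X y in eq
    ... | true  = trans (is-≢ (apart Xs Xu)) (sym (is-≢ (apart eq Xu)))
    ... | false = refl

    is-in₂ : ∀ {u} → X u ≡ true → ∀ y → is u (φ₂ y) ≡ is u y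
    is-in₂ Xu y with X y in eq
    ... | true  = refl
    ... | false = trans (is-≢ (apart Xu Xv ∘ sym)) (sym (is-≢ (apart Xu eq ∘ sym)))

    δ₁ : ∀ e → δ ends₁ (is v) e ≡ δ ends (is v) e
    δ₁ e = cong₂ _xor_ (is-v₁ (src ends e)) (is-v₁ (tgt ends e))

    δ₂ : ∀ e → δ ends₂ (is v) e ≡ δ ends X e
    δ₂ e = trans (cong₂ _xor_ (is-v₂ (src ends e)) (is-v₂ (tgt ends e))) (δ-not ends X e)

    fixed-∨ : ∀ (φ : Fin n → Fin n) {u} → (S u ∧ fixed φ u) ∨ (R u ∧ fixed φ u) ≡ true → S u ∨ R u ≡ true × φ u ≡ u
    fixed-∨ φ {u} h with S u | R u | ∨-true {S u ∧ fixed φ u} h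
    ... | true  | _    | inj₁ p = refl , is-≡ p
    ... | true  | true | inj₂ p = refl , is-≡ p
    ... | false | true | inj₂ p = refl , is-≡ p

    ∨-fixed : ∀ (φ : Fin n → Fin n) {u} → S u ∨ R u ≡ true → φ u ≡ u → (S u ∧ fixed φ u) ∨ (R u ∧ fixed φ u) ≡ true
    ∨-fixed φ {u} h p rewrite p | is-refl u = trans (cong₂ _∨_ (Boolₚ.∧-identityʳ (S u)) (Boolₚ.∧-identityʳ (R u))) h

    contracted-cut : ∀ (φ : Fin n → Fin n) Y → Sep (λ y → S y ∧ fixed φ y) Y → K ≤ d (contract φ ends) Y
    contracted-cut φ Y ((a , Sa , Ya) , (b , Sb , Yb)) = cut (Y ∘ φ)
      ( (a , ∧-trueˡ Sa , trans (cong Y (is-≡ (∧-trueʳ {S a} Sa))) Ya)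
      , (b , ∧-trueˡ Sb , trans (cong Y (is-≡ (∧-trueʳ {S b} Sb))) Yb))

    S₁ R₁ S₂ R₂ : Fin n → Bool
    S₁ y = S y ∧ fixed φ₁ y
    R₁ y = R y ∧ fixed φ₁ y
    S₂ y = S y ∧ fixed φ₂ y
    R₂ y = R y ∧ fixed φ₂ y

    inst₁ : Instance ends₁ S₁ R₁ D₁ v pc
    inst₁ = record
      { v∈S = ∧-true v∈S (is-true (out₁ Xv))
      ; other = s , ∧-true s∈S (is-true (in₁ Xs)) , apart Xs Xv
      ; cut = contracted-cut φ₁
      ; degree-v = trans (count-cong δ₁) degree-v
      ; budget = λ u u≢v h → let SR , fix = fixed-∨ φ₁ h in budget₁ u u≢v SR fix
      ; budget-R = λ u h → budget-R₁ u (∧-trueˡ h)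
      ; twice = λ i → ≤-trans (twice i) (≤-reflexive (count-cong (λ e → cong (_∧ is i (pc e)) (sym (δ₁ e))))) }
      where
      budget₁ : ∀ u → u ≢ v → S u ∨ R u ≡ true → φ₁ u ≡ u → d ends₁ (is u) ≤ D₁ u
      budget₁ u u≢v SR fix with u ≟ s
      ... | yes refl = ≤-reflexive (trans (d-cong ends is-s₁) tight)
      ... | no u≢s with X u in eq
      ...   | true  = ⊥-elim (u≢s (sym fix))
      ...   | false = ≤-trans (≤-reflexive (d-cong ends (is-out₁ eq))) (budget u u≢v SR)
      budget-R₁ : ∀ u → R u ≡ true → (Q ∸ 2) * k ≤ D₁ u
      budget-R₁ u h with is s u
      ... | true  = *-monoˡ-≤ k (m∸n≤m Q 2)
      ... | false = budget-R u h

    module _ (sol₁ : Solution ends₁ S₁ R₁ D₁ v pc) where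
      private module sol₁ = Solution sol₁

      room : ∑ (λ i → 2 ⊔ count (λ e → δ ends X e ∧ hasColour (sol₁.c e) i)) ≤ count (δ ends X)
      room = ≤-trans (≤-reflexive (∑-cong (λ i → cong (2 ⊔_) (count-cong (λ e → cong (_∧ hasColour (sol₁.c e) i) (sym (d₁ e)))))))
        (≤-trans (sol₁.balanced s (apart Xs Xv) (∨-trueˡ (∧-true s∈S (is-true (in₁ Xs)))))
                 (≤-trans (≤-reflexive (cong (λ b → if b then K else D s) (is-refl s))) (≤-reflexive (sym tight))))
        where
        d₁ : ∀ e → δ ends₁ (is s) e ≡ δ ends X e
        d₁ e = δ-cong ends is-s₁ e

      pc₂-data = complete (δ ends X) sol₁.c pc room

      pc₂ : Fin m → Fin k
      pc₂ = proj₁ pc₂-data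

      pc₂-agrees : ∀ e i → sol₁.c e ≡ just i → pc₂ e ≡ i
      pc₂-agrees = proj₁ (proj₂ pc₂-data)

      inst₂ : Instance ends₂ S₂ R₂ D v pc₂
      inst₂ = record
        { v∈S = ∧-true v∈S (is-true (out₂ Xv))
        ; other = s , ∧-true s∈S (is-true (in₂ Xs)) , apart Xs Xv
        ; cut = contracted-cut φ₂
        ; degree-v = trans (count-cong δ₂) tight
        ; budget = λ u u≢v h → let SR , fix = fixed-∨ φ₂ h in budget₂ u u≢v SR fix
        ; budget-R = λ u h → budget-R u (∧-trueˡ h)
        ; twice = λ i → ≤-trans (proj₂ (proj₂ pc₂-data) i)
                          (≤-reflexive (count-cong (λ e → cong (_∧ is i (pc₂ e)) (sym (δ₂ e))))) }
        where
        budget₂ : ∀ u → u ≢ v → S u ∨ R u ≡ true → φ₂ u ≡ u → d ends₂ (is u) ≤ D u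
        budget₂ u u≢v SR fix with X u in eq
        ... | true  = ≤-trans (≤-reflexive (d-cong ends (is-in₂ eq))) (budget u u≢v SR)
        ... | false = ⊥-elim (u≢v (sym fix))

      module _ (sol₂ : Solution ends₂ S₂ R₂ D v pc₂) where
        private module sol₂ = Solution sol₂

        c : Fin m → Maybe (Fin k)
        c e = if X (src ends e) ∧ X (tgt ends e) then sol₂.c e else sol₁.c e

        c-inner : ∀ {e} → X (src ends e) ≡ true → X (tgt ends e) ≡ true → c e ≡ sol₂.c e
        c-inner p q rewrite p | q = refl

        c-src-out : ∀ {e} → X (src ends e) ≡ false → c e ≡ sol₁.c e
        c-src-out p rewrite p = refl

        c-tgt-out : ∀ {e} → X (tgt ends e) ≡ false → c e ≡ sol₁.c e
        c-tgt-out {e} p rewrite p | Boolₚ.∧-zeroʳ (X (src ends e)) = refl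

        not-v : ∀ {e} → X (src ends e) ≡ true → X (tgt ends e) ≡ true → δ ends (is v) e ≡ false
        not-v p q = cong₂ _xor_ (is-≢ (apart p Xv)) (is-≢ (apart q Xv))

        c-at-v : ∀ e → δ ends (is v) e ≡ true → c e ≡ sol₁.c e
        c-at-v e h with δ-ends ends {v} {e} h
        ... | inj₁ (p , _ , _) = c-src-out (trans (cong X p) Xv)
        ... | inj₂ (p , _ , _) = c-tgt-out (trans (cong X p) Xv)

        far₂ : ∀ {e y} → δ ends X e ≡ true → X y ≡ true → (y ≡ src ends e) ⊎ (y ≡ tgt ends e) → y ≡ far ends₂ v e
        far₂ {e} h Xy (inj₁ refl) = sym (trans (far-tgt ends₂ {v} {e} (λ p → apart Xy Xv (trans (sym (in₂ Xy)) p))) (in₂ Xy))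
        far₂ {e} h Xy (inj₂ refl) = sym (trans (far-src ends₂ {v} {e} (out₂ (≢true (λ p → xor-≢ h (trans p (sym Xy)))))) (in₂ Xy))

        module _ (i : Fin k) (g : Fin n → Bool) (closed : Closed ends c v i g) where

          closed₂ : Closed ends₂ sol₂.c v i g
          closed₂ e h δe with X (src ends e) in p | X (tgt ends e) in q
          ... | true  | true  = closed e (trans (c-inner p q) h) (not-v p q)
          ... | false | false = refl
          ... | true  | false = ⊥-elim (true≢false (src-tgt) δe)
            where
            src-tgt : is v (src ends e) xor is v v ≡ true
            src-tgt = cong₂ _xor_ (is-≢ (apart p Xv)) (is-refl v)
          ... | false | true  = ⊥-elim (true≢false (src-tgt) δe)
            where
            src-tgt : is v v xor is v (tgt ends e) ≡ true
            src-tgt = cong₂ _xor_ (is-refl v) (is-≢ (apart q Xv))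

          at-s : ∀ {y} → Terminal ends₂ S₂ v pc₂ i y → g y ≡ g s
          at-s {y} t = sol₂.connected i g closed₂ y s t (inj₁ (∧-true s∈S (is-true (in₂ Xs)) , apart Xs Xv))

          crossing : ∀ {e y} → sol₁.c e ≡ just i → δ ends X e ≡ true → X y ≡ true →
            (y ≡ src ends e) ⊎ (y ≡ tgt ends e) → g y ≡ g s
          crossing {e} h δX Xy end = at-s (inj₂ (e , trans (δ₂ e) δX , pc₂-agrees e i h , far₂ δX Xy end))

          closed₁ : Closed ends₁ sol₁.c v i g
          closed₁ e h δe = go (X (src ends e)) refl (X (tgt ends e)) refl
            where
            δe′ : δ ends (is v) e ≡ false
            δe′ = trans (sym (δ₁ e)) δe
            go : ∀ a → X (src ends e) ≡ a → ∀ b → X (tgt ends e) ≡ b → g (φ₁ (src ends e)) ≡ g (φ₁ (tgt ends e))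
            go true  p true  q = cong g (trans (in₁ p) (sym (in₁ q)))
            go false p false q = trans (cong g (out₁ p)) (trans (closed e (trans (c-src-out p) h) δe′) (cong g (sym (out₁ q))))
            go true  p false q = trans (cong g (in₁ p)) (trans (sym (crossing h (cong₂ _xor_ p q) p (inj₁ refl)))
              (trans (closed e (trans (c-tgt-out q) h) δe′) (cong g (sym (out₁ q)))))
            go false p true  q = trans (cong g (out₁ p)) (trans (closed e (trans (c-src-out p) h) δe′)
              (trans (crossing h (cong₂ _xor_ p q) q (inj₂ refl)) (cong g (sym (in₁ q)))))

          representative : ∀ y → Terminal ends S v pc i y → ∃ λ y′ → Terminal ends₁ S₁ v pc i y′ × g y ≡ g y′
          representative y (inj₁ (Sy , y≢v)) with bool? (X y)
          ... | inj₁ Xy = s , inj₁ (∧-true s∈S (is-true (in₁ Xs)) , apart Xs Xv) , at-s (inj₁ (∧-true Sy (is-true (in₂ Xy)) , y≢v))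
          ... | inj₂ Xy = y , inj₁ (∧-true Sy (is-true (out₁ Xy)) , y≢v) , refl
          representative y (inj₂ (e , h , p , refl)) with bool? (X (far ends v e))
          ... | inj₂ Xy = φ₁ (far ends v e) , inj₂ (e , trans (δ₁ e) h , p , far₁ e) , cong g (sym (out₁ Xy))
            where
            far₁ : ∀ e → φ₁ (far ends v e) ≡ far ends₁ v e
            far₁ e rewrite is-v₁ (src ends e) with is v (src ends e)
            ... | true  = refl
            ... | false = refl
          ... | inj₁ Xy = φ₁ (far ends v e) , inj₂ (e , trans (δ₁ e) h , p , far₁ e) ,
                trans (crossing (trans (sol₁.extends e (trans (δ₁ e) h)) (cong just p)) δX Xy which) (cong g (sym (in₁ Xy)))
            where
            far₁ : ∀ e → φ₁ (far ends v e) ≡ far ends₁ v e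
            far₁ e rewrite is-v₁ (src ends e) with is v (src ends e)
            ... | true  = refl
            ... | false = refl
            δX : δ ends X e ≡ true
            δX = trans (δ-at ends X h) (cong₂ _xor_ Xv Xy)
            which : (far ends v e ≡ src ends e) ⊎ (far ends v e ≡ tgt ends e)
            which with δ-ends ends {v} {e} h
            ... | inj₁ (_ , _ , q) = inj₂ q
            ... | inj₂ (_ , _ , q) = inj₁ q

        glued : Solution ends S R D v pc
        glued = record
          { c = c
          ; extends = λ e h → trans (c-at-v e h) (sol₁.extends e (trans (δ₁ e) h))
          ; connected = λ i g closed y z ty tz →
              let y′ , ty′ , gy = representative i g closed y ty
                  z′ , tz′ , gz = representative i g closed z tz
              in trans gy (trans (sol₁.connected i g (closed₁ i g closed) y′ z′ ty′ tz′) (sym gz))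
          ; balanced = balanced }
          where
          balanced : ∀ u → u ≢ v → S u ∨ R u ≡ true → ∑ (λ i → 2 ⊔ degree ends c u i) ≤ D u
          balanced u u≢v SR with bool? (X u)
          ... | inj₁ Xu = ≤-trans (∑-mono (λ i → ⊔-monoʳ-≤ 2 (count-mono (λ e h → ∧-true
                (trans (δ-cong ends (is-in₂ Xu) e) (∧-trueˡ h)) (colour e i (∧-trueˡ h) (∧-trueʳ {δ ends (is u) e} h))))))
                (sol₂.balanced u u≢v (∨-fixed φ₂ SR (in₂ Xu)))
            where
            colour : ∀ e i → δ ends (is u) e ≡ true → hasColour (c e) i ≡ true → hasColour (sol₂.c e) i ≡ true
            colour e i h hc with X (src ends e) in p | X (tgt ends e) in q
            ... | true  | true  = hc
            ... | true  | false = hasColour-refl (trans (sol₂.extends e (trans (δ₂ e) (cong₂ _xor_ p q))) (cong just (pc₂-agrees e i (hasColour-≡ hc))))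
            ... | false | true  = hasColour-refl (trans (sol₂.extends e (trans (δ₂ e) (cong₂ _xor_ p q))) (cong just (pc₂-agrees e i (hasColour-≡ hc))))
            ... | false | false = ⊥-elim (true≢false h (cong₂ _xor_ (is-≢ (apart Xu p ∘ sym)) (is-≢ (apart Xu q ∘ sym))))
          ... | inj₂ Xu = ≤-trans (∑-mono (λ i → ⊔-monoʳ-≤ 2 (count-mono (λ e h → ∧-true
                (trans (δ-cong ends (is-out₁ Xu) e) (∧-trueˡ h))
                (trans (cong (λ z → hasColour z i) (sym (colour e (∧-trueˡ h)))) (∧-trueʳ {δ ends (is u) e} h))))))
                (≤-trans (sol₁.balanced u u≢v (∨-fixed φ₁ SR (out₁ Xu)))
                         (≤-reflexive (cong (λ b → if b then K else D u) (is-≢ (apart Xs Xu ∘ sym)))))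
            where
            colour : ∀ e → δ ends (is u) e ≡ true → c e ≡ sol₁.c e
            colour e h with δ-ends ends {u} {e} h
            ... | inj₁ (p , _ , _) = c-src-out (trans (cong X p) Xu)
            ... | inj₂ (p , _ , _) = c-tgt-out (trans (cong X p) Xu)

  contract-size : ∀ ends (φ : Fin n → Fin n) e → live ends e ≡ true → φ (src ends e) ≡ φ (tgt ends e) →
    size (contract φ ends) < size ends
  contract-size ends φ e h p = ∑-< (λ e′ → ⟦⟧-mono (λ l → not-false (is-≢ (λ q → is-false (not-true l) (cong φ q))))) e
    (subst₂ _<_ (cong ⟦_⟧ (sym (cong not (is-true (sym p))))) (cong ⟦_⟧ (sym h)) ≤-refl)

  sparse⇒balanced : ∀ (ends : Graph n m) (c : Fin m → Maybe (Fin k)) u D →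
    count (λ e → δ ends (is u) e ∧ coloured (c e)) + k * 2 ≤ D → ∑ (λ i → 2 ⊔ degree ends c u i) ≤ D
  sparse⇒balanced ends c u D le = ≤-trans (∑-mono (λ i → m⊔n≤m+n 2 (degree ends c u i)))
    (≤-trans (≤-reflexive (trans (∑-+ (λ _ → 2) _) (trans (cong₂ _+_ (∑-const k 2) (∑-by-colour (δ ends (is u)) c)) (+-comm (k * 2) _)))) le)

  coloured≤d : ∀ (ends : Graph n m) (c : Fin m → Maybe (Fin k)) u → count (λ e → δ ends (is u) e ∧ coloured (c e)) ≤ d ends (is u)
  coloured≤d ends c u = count-mono (λ e → ∧-trueˡ {δ ends (is u) e})

  module Restrict {ends S R D v pc} (I : Instance ends S R D v pc) where
    open Instance I

    R′ : Fin n → Bool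
    R′ u = R u ∧ (D u <ᵇ d ends (is u) + k * 2)

    weaken : ∀ {u} → S u ∨ R′ u ≡ true → S u ∨ R u ≡ true
    weaken {u} h with S u
    ... | true  = refl
    ... | false = ∧-trueˡ h

    restricted : Instance ends S R′ D v pc
    restricted = record
      { v∈S = v∈S ; other = other ; cut = cut ; degree-v = degree-v ; budget = λ u ne h → budget u ne (weaken h)
      ; budget-R = λ u h → budget-R u (∧-trueˡ h) ; twice = twice }

    R′-tight : ∀ {u} → R′ u ≡ true → D u < d ends (is u) + k * 2
    R′-tight {u} h = <ᵇ⇒< _ _ (T≡ (∧-trueʳ {R u} h))

    unrestrict : Solution ends S R′ D v pc → Solution ends S R D v pc
    unrestrict sol = record { c = c ; extends = extends ; connected = connected ; balanced = bal }
      where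
      open Solution sol
      bal : ∀ u → u ≢ v → S u ∨ R u ≡ true → ∑ (λ i → 2 ⊔ degree ends c u i) ≤ D u
      bal u ne h with S u ∨ R′ u in eq
      ... | true  = balanced u ne eq
      ... | false = sparse⇒balanced ends c u (D u)
            (≤-trans (+-monoˡ-≤ (k * 2) (coloured≤d ends c u)) (≮⇒≥ (λ lt → true≢false (in-R′ lt) eq)))
        where
        in-R′ : D u < d ends (is u) + k * 2 → S u ∨ R′ u ≡ true
        in-R′ lt with S u | R u
        ... | true  | _    = refl
        ... | false | true = ≡true (<⇒<ᵇ lt)

  module Deletion {ends S R D v pc} (I : Instance ends S R D v pc) (e₀ : Fin m) (alive : live ends e₀ ≡ true)
    (slack : ∀ X → Sep S X → δ ends X e₀ ≡ true → K < d ends X) where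
    open Instance I

    ends′ : Graph n m
    ends′ e = if is e₀ e then (src ends e₀ , src ends e₀) else ends e

    at : ends′ e₀ ≡ (src ends e₀ , src ends e₀)
    at = if-at e₀

    off : ∀ {e} → e ≢ e₀ → ends′ e ≡ ends e
    off = if-off

    δ-at₀ : ∀ X → δ ends′ X e₀ ≡ false
    δ-at₀ X = trans (cong (λ p → X (proj₁ p) xor X (proj₂ p)) at) (≡-xor {X (src ends e₀)} refl)

    δ-off : ∀ X {e} → e ≢ e₀ → δ ends′ X e ≡ δ ends X e
    δ-off X ne = cong (λ p → X (proj₁ p) xor X (proj₂ p)) (off ne)

    d-eq : ∀ X → d ends X ≡ d ends′ X + ⟦ δ ends X e₀ ⟧
    d-eq X = trans (sym (+-identityʳ _)) (trans (cong (d ends X +_) (sym (cong ⟦_⟧ (δ-at₀ X))))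
      (∑-update _ _ e₀ (λ e ne → cong ⟦_⟧ (sym (δ-off X ne)))))

    sep-v : Sep S (is v)
    sep-v = (v , v∈S , is-refl v) , (proj₁ other , proj₁ (proj₂ other) , is-≢ (proj₂ (proj₂ other)))

    v∉e₀ : δ ends (is v) e₀ ≡ false
    v∉e₀ = ≢true (λ h → <⇒≢ (slack (is v) sep-v h) (sym degree-v))

    δv : ∀ e → δ ends′ (is v) e ≡ δ ends (is v) e
    δv e with e ≟ e₀
    ... | yes refl = trans (≡-xor {is v (src ends e)} refl) (sym v∉e₀)
    ... | no _     = refl

    d-≤ : ∀ X → d ends′ X ≤ d ends X
    d-≤ X = ≤-trans (m≤m+n _ _) (≤-reflexive (sym (d-eq X)))

    deleted : Instance ends′ S R D v pc
    deleted = record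
      { v∈S = v∈S ; other = other ; cut = cut′
      ; degree-v = trans (count-cong δv) degree-v
      ; budget = λ u ne h → ≤-trans (d-≤ (is u)) (budget u ne h)
      ; budget-R = budget-R
      ; twice = λ i → ≤-trans (twice i) (≤-reflexive (count-cong (λ e → cong (_∧ is i (pc e)) (sym (δv e))))) }
      where
      cut′ : ∀ X → Sep S X → K ≤ d ends′ X
      cut′ X sep with δ ends X e₀ in eq
      ... | true  = ≤-pred (≤-trans (slack X sep eq) (≤-reflexive (trans (d-eq X) (trans (cong (d ends′ X +_) (cong ⟦_⟧ eq)) (+-comm _ 1)))))
      ... | false = ≤-trans (cut X sep) (≤-reflexive (trans (d-eq X) (trans (cong (d ends′ X +_) (cong ⟦_⟧ eq)) (+-identityʳ _))))

    smaller : size ends′ < size ends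
    smaller = ∑-< pointwise e₀ (subst₂ _<_ (cong ⟦_⟧ (sym dead)) (cong ⟦_⟧ (sym alive)) ≤-refl)
      where
      dead : live ends′ e₀ ≡ false
      dead = trans (cong (λ p → not (is (proj₁ p) (proj₂ p))) at) (cong not (is-refl (src ends e₀)))
      pointwise : ∀ e → ⟦ live ends′ e ⟧ ≤ ⟦ live ends e ⟧
      pointwise e with e ≟ e₀
      ... | yes refl = ≤-trans (≤-reflexive (cong (⟦_⟧ ∘ not) (is-refl (src ends e)))) z≤n
      ... | no _     = ≤-refl

    undelete : Solution ends′ S R D v pc → Solution ends S R D v pc
    undelete sol = record { c = c′ ; extends = ext′ ; connected = conn ; balanced = bal }
      where
      open Solution sol
      c′ : Fin m → Maybe (Fin k)
      c′ e = if is e₀ e then nothing else c e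
      ext′ : ∀ e → δ ends (is v) e ≡ true → c′ e ≡ just (pc e)
      ext′ e h with e ≟ e₀
      ... | yes refl = ⊥-elim (true≢false h v∉e₀)
      ... | no ne    = extends e (trans (δv e) h)
      terminal : ∀ {i y} → Terminal ends S v pc i y → Terminal ends′ S v pc i y
      terminal (inj₁ p) = inj₁ p
      terminal (inj₂ (e , h , p , q)) = inj₂ (e , trans (δv e) h , p ,
        trans q (cong (λ p → if is v (proj₁ p) then proj₂ p else proj₁ p) (sym (off (λ { refl → true≢false h v∉e₀ })))))
      conn : ∀ i g → Closed ends c′ v i g → ∀ y z → Terminal ends S v pc i y → Terminal ends S v pc i z → g y ≡ g z
      conn i g closed y z ty tz = connected i g closed′ y z (terminal ty) (terminal tz)
        where
        closed′ : Closed ends′ c v i g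
        closed′ e h δe with e ≟ e₀
        ... | yes refl = refl
        ... | no ne    = closed e (trans (if-off ne) h) δe
      bal : ∀ u → u ≢ v → S u ∨ R u ≡ true → ∑ (λ i → 2 ⊔ degree ends c′ u i) ≤ D u
      bal u ne h = ≤-trans (∑-mono (λ i → ⊔-monoʳ-≤ 2 (count-mono (pointwise i)))) (balanced u ne h)
        where
        pointwise : ∀ i e → δ ends (is u) e ∧ hasColour (c′ e) i ≡ true → δ ends′ (is u) e ∧ hasColour (c e) i ≡ true
        pointwise i e h with e ≟ e₀
        ... | yes refl = ⊥-elim (true≢false h (Boolₚ.∧-zeroʳ _))
        ... | no ne    = h

  -- Splitting off the pair xa, xb of edges e, f: e becomes ab, f disappears.
  module Splitting {ends S R D v pc} (I : Instance ends S R D v pc) (x : Fin n) (e f : Fin m)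
    (x∉ : S x ∨ R x ≡ false) (xe : δ ends (is x) e ≡ true) (xf : δ ends (is x) f ≡ true)
    (a≢b : far ends x e ≢ far ends x f) (b≢v : far ends x f ≢ v)
    (safe : ∀ Y → Sep S Y → Y (far ends x e) ≡ true → Y (far ends x f) ≡ true → Y x ≡ false → K + 2 ≤ d ends Y) where
    open Instance I

    a b : Fin n
    a = far ends x e
    b = far ends x f

    e≢f : e ≢ f
    e≢f refl = a≢b refl

    x≢v : x ≢ v
    x≢v refl = true≢false (∨-trueˡ v∈S) x∉

    ends′ : Graph n m
    ends′ e′ = if is f e′ then (b , b) else (if is e e′ then (a , b) else ends e′)

    at-f : ends′ f ≡ (b , b)
    at-f = if-at f

    at-e : ends′ e ≡ (a , b)
    at-e = trans (if-off e≢f) (if-at e)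

    off : ∀ {e′} → e′ ≢ e → e′ ≢ f → ends′ e′ ≡ ends e′
    off ne nf = trans (if-off nf) (if-off ne)

    δ′-f : ∀ Y → δ ends′ Y f ≡ false
    δ′-f Y = trans (cong (λ p → Y (proj₁ p) xor Y (proj₂ p)) at-f) (≡-xor {Y b} refl)

    δ′-e : ∀ Y → δ ends′ Y e ≡ Y a xor Y b
    δ′-e Y = cong (λ p → Y (proj₁ p) xor Y (proj₂ p)) at-e

    δ′-off : ∀ Y {e′} → e′ ≢ e → e′ ≢ f → δ ends′ Y e′ ≡ δ ends Y e′
    δ′-off Y ne nf = cong (λ p → Y (proj₁ p) xor Y (proj₂ p)) (off ne nf)

    d-eq : ∀ Y → d ends′ Y + (⟦ Y x xor Y a ⟧ + ⟦ Y x xor Y b ⟧) ≡ d ends Y + ⟦ Y a xor Y b ⟧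
    d-eq Y = begin
      d ends′ Y + (⟦ Y x xor Y a ⟧ + ⟦ Y x xor Y b ⟧)
        ≡⟨ cong (d ends′ Y +_) (cong₂ _+_ (cong ⟦_⟧ (sym (δ-at ends Y xe))) (cong ⟦_⟧ (sym (δ-at ends Y xf)))) ⟩
      d ends′ Y + (⟦ δ ends Y e ⟧ + ⟦ δ ends Y f ⟧)
        ≡⟨ ∑-update₂ _ _ e≢f (λ e′ ne nf → cong ⟦_⟧ (δ′-off Y ne nf)) ⟩
      d ends Y + (⟦ δ ends′ Y e ⟧ + ⟦ δ ends′ Y f ⟧)
        ≡⟨ cong (d ends Y +_) (cong₂ _+_ (cong ⟦_⟧ (δ′-e Y)) (cong ⟦_⟧ (δ′-f Y))) ⟩
      d ends Y + (⟦ Y a xor Y b ⟧ + 0)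
        ≡⟨ cong (d ends Y +_) (+-identityʳ _) ⟩
      d ends Y + ⟦ Y a xor Y b ⟧ ∎
      where open ≡-Reasoning

    d-≤ : ∀ Y → d ends′ Y ≤ d ends Y
    d-≤ Y = ≤-by 0 (triangle (Y x) (Y a) (Y b)) (trans (+-identityʳ _) (d-eq Y))
      where
      triangle : ∀ x a b → ⟦ a xor b ⟧ ≤ ⟦ x xor a ⟧ + ⟦ x xor b ⟧
      triangle x a b = b≤ (by-cases 3 (λ x a b → ⟦ a xor b ⟧ ≤ᵇ ⟦ x xor a ⟧ + ⟦ x xor b ⟧) _ x a b)

    cut′ : ∀ Y → Sep S Y → K ≤ d ends′ Y
    cut′ Y sep = go (Y x) refl (Y a) refl (Y b) refl
      where
      sep-not : Sep S (not ∘ Y)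
      sep-not = let (p , Sp , Yp) , (q , Sq , Yq) = sep in (q , Sq , not-false Yq) , (p , Sp , cong not Yp)
      keep : ∀ {x′ a′ b′} → Y x ≡ x′ → Y a ≡ a′ → Y b ≡ b′ → ⟦ x′ xor a′ ⟧ + ⟦ x′ xor b′ ⟧ ≤ ⟦ a′ xor b′ ⟧ → K ≤ d ends′ Y
      keep refl refl refl le = ≤-trans (cut Y sep) (≤-by 0 le (trans (+-identityʳ _) (sym (d-eq Y))))
      drop : ⟦ Y x xor Y a ⟧ + ⟦ Y x xor Y b ⟧ ≡ 2 → ⟦ Y a xor Y b ⟧ ≡ 0 → K + 2 ≤ d ends Y → K ≤ d ends′ Y
      drop p q le = +-cancelʳ-≤ 2 _ _ (≤-trans le (≤-reflexive
        (trans (sym (+-identityʳ _)) (trans (cong (d ends Y +_) (sym q)) (trans (sym (d-eq Y)) (cong (d ends′ Y +_) p))))))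
      twos : ∀ {x′ a′ b′} → Y x ≡ x′ → Y a ≡ a′ → Y b ≡ b′ → ⟦ Y x xor Y a ⟧ + ⟦ Y x xor Y b ⟧ ≡ ⟦ x′ xor a′ ⟧ + ⟦ x′ xor b′ ⟧
      twos refl refl refl = refl
      zeros : ∀ {a′ b′} → Y a ≡ a′ → Y b ≡ b′ → ⟦ Y a xor Y b ⟧ ≡ ⟦ a′ xor b′ ⟧
      zeros refl refl = refl
      go : ∀ x′ → Y x ≡ x′ → ∀ a′ → Y a ≡ a′ → ∀ b′ → Y b ≡ b′ → K ≤ d ends′ Y
      go false p true  q true  r = drop (twos p q r) (zeros q r) (safe Y sep q r p)
      go true  p false q false r = drop (twos p q r) (zeros q r)
        (≤-trans (safe (not ∘ Y) sep-not (not-false q) (not-false r) (cong not p)) (≤-reflexive (d-not ends Y)))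
      go false p true  q false r = keep p q r ≤-refl
      go false p false q true  r = keep p q r ≤-refl
      go false p false q false r = keep p q r ≤-refl
      go true  p true  q true  r = keep p q r ≤-refl
      go true  p true  q false r = keep p q r ≤-refl
      go true  p false q true  r = keep p q r ≤-refl

    v∉f : δ ends (is v) f ≡ false
    v∉f = trans (δ-at ends (is v) xf) (cong₂ _xor_ (is-≢ x≢v) (is-≢ b≢v))

    δv : ∀ e′ → δ ends′ (is v) e′ ≡ δ ends (is v) e′
    δv e′ with e′ ≟ f
    ... | yes refl = trans (≡-xor {is v b} refl) (sym v∉f)
    ... | no nf with e′ ≟ e
    ...   | yes refl = trans (trans (cong (is v a xor_) (is-≢ b≢v)) (Boolₚ.xor-identityʳ _))
                             (sym (trans (δ-at ends (is v) xe) (cong (_xor is v a) (is-≢ x≢v))))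
    ...   | no _ = refl

    split : Instance ends′ S R D v pc
    split = record
      { v∈S = v∈S ; other = other ; cut = cut′
      ; degree-v = trans (count-cong δv) degree-v
      ; budget = λ u ne h → ≤-trans (d-≤ (is u)) (budget u ne h)
      ; budget-R = budget-R
      ; twice = λ i → ≤-trans (twice i) (≤-reflexive (count-cong (λ e′ → cong (_∧ is i (pc e′)) (sym (δv e′))))) }

    smaller : size ends′ < size ends
    smaller = ∑-< pointwise f (subst₂ _<_ (cong ⟦_⟧ (sym dead)) (cong ⟦_⟧ (sym (δ-live ends {is x} xf))) ≤-refl)
      where
      dead : live ends′ f ≡ false
      dead = trans (cong (λ p → not (is (proj₁ p) (proj₂ p))) at-f) (cong not (is-refl b))
      pointwise : ∀ e′ → ⟦ live ends′ e′ ⟧ ≤ ⟦ live ends e′ ⟧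
      pointwise e′ with e′ ≟ f
      ... | yes refl = ≤-trans (≤-reflexive (cong (⟦_⟧ ∘ not) (is-refl b))) z≤n
      ... | no nf with e′ ≟ e
      ...   | yes refl = ≤-trans (⟦⟧≤1 (not (is a b))) (≤-reflexive (sym (cong ⟦_⟧ (δ-live ends {is x} xe))))
      ...   | no _ = ≤-refl

    unsplit : Solution ends′ S R D v pc → Solution ends S R D v pc
    unsplit sol = record { c = c′ ; extends = ext′ ; connected = conn ; balanced = bal }
      where
      open Solution sol
      c′ : Fin m → Maybe (Fin k)
      c′ e′ = if is f e′ then c e else c e′
      ext′ : ∀ e′ → δ ends (is v) e′ ≡ true → c′ e′ ≡ just (pc e′)
      ext′ e′ h with e′ ≟ f
      ... | yes refl = ⊥-elim (true≢false h v∉f)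
      ... | no ne    = extends e′ (trans (δv e′) h)
      module _ (i : Fin k) (g : Fin n → Bool) (closed : Closed ends c′ v i g) where
        along : ∀ {e′} → δ ends (is x) e′ ≡ true → c′ e′ ≡ just i → δ ends (is v) e′ ≡ false → g x ≡ g (far ends x e′)
        along {e′} h ce h′ with δ-ends ends {x} {e′} h
        ... | inj₁ (p , _ , q) = trans (cong g (sym p)) (trans (closed e′ ce h′) (cong g (sym q)))
        ... | inj₂ (p , _ , q) = trans (cong g (sym p)) (trans (sym (closed e′ ce h′)) (cong g (sym q)))
        x-b : c e ≡ just i → g x ≡ g b
        x-b h = along xf (trans (if-at f) h) v∉f
        closed′ : Closed ends′ c v i g
        closed′ e′ h δe with e′ ≟ f
        ... | yes refl = refl
        ... | no nf with e′ ≟ e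
        ...   | yes refl = trans (sym (along xe (trans (if-off e≢f) h) (trans (sym (δv e)) (trans (δ′-e (is v)) δe)))) (x-b h)
        ...   | no _ = closed e′ (trans (if-off nf) h) δe
        representative : ∀ y → Terminal ends S v pc i y → ∃ λ y′ → Terminal ends′ S v pc i y′ × g y ≡ g y′
        representative y (inj₁ p) = y , inj₁ p , refl
        representative y (inj₂ (e′ , h , p , q)) with e′ ≟ f
        ... | yes refl = ⊥-elim (true≢false h v∉f)
        ... | no nf with e′ ≟ e
        ...   | no ne = y , inj₂ (e′ , trans (δv e′) h , p , trans q (cong (λ p → if is v (proj₁ p) then proj₂ p else proj₁ p) (sym (off ne nf)))) , refl
        ...   | yes refl = b , inj₂ (e , trans (δv e) h , p , sym (trans (cong (λ p → if is v (proj₁ p) then proj₂ p else proj₁ p) at-e) (cong (λ z → if z then b else a) a-v)))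
                             , trans (cong g (trans q (trans (cong (λ z → far ends z e) (sym (is-≡ a-v))) (far-far ends xe))))
                                     (x-b (trans (extends e (trans (δv e) h)) (cong just p)))
          where
          a-v : is v a ≡ true
          a-v = trans (cong (_xor is v a) (sym (is-≢ x≢v))) (trans (sym (δ-at ends (is v) xe)) h)
      conn : ∀ i g → Closed ends c′ v i g → ∀ y z → Terminal ends S v pc i y → Terminal ends S v pc i z → g y ≡ g z
      conn i g closed y z ty tz =
        let y′ , ty′ , gy = representative i g closed y ty
            z′ , tz′ , gz = representative i g closed z tz
        in trans gy (trans (connected i g (closed′ i g closed) y′ z′ ty′ tz′) (sym gz))
      bal : ∀ u → u ≢ v → S u ∨ R u ≡ true → ∑ (λ i → 2 ⊔ degree ends c′ u i) ≤ D u
      bal u ne h = ≤-trans (∑-mono (λ i → ⊔-monoʳ-≤ 2 (degree-≤ i))) (balanced u ne h)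
        where
        x≢u : x ≢ u
        x≢u refl = true≢false h x∉
        degree-≤ : ∀ i → degree ends c′ u i ≤ degree ends′ c u i
        degree-≤ i = ≤-by 0 moved (trans (+-identityʳ _) (∑-update₂ _ _ e≢f other-edges))
          where
          w = hasColour (c e) i
          other-edges : ∀ e′ → e′ ≢ e → e′ ≢ f →
            ⟦ δ ends (is u) e′ ∧ hasColour (c′ e′) i ⟧ ≡ ⟦ δ ends′ (is u) e′ ∧ hasColour (c e′) i ⟧
          other-edges e′ ne nf = cong₂ (λ p q → ⟦ p ∧ hasColour q i ⟧) (sym (δ′-off (is u) ne nf)) (if-off nf)
          at-u : ∀ {e′} → δ ends (is x) e′ ≡ true → δ ends (is u) e′ ≡ is u (far ends x e′)
          at-u h = trans (δ-at ends (is u) h) (cong (_xor is u _) (is-≢ x≢u))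
          disjoint : ∀ p q w → ¬ (p ≡ true × q ≡ true) → ⟦ p ∧ w ⟧ + ⟦ q ∧ w ⟧ ≤ ⟦ (p xor q) ∧ w ⟧ + 0
          disjoint true  true  w h = ⊥-elim (h (refl , refl))
          disjoint true  false w h = ≤-refl
          disjoint false q     w h = ≤-reflexive (sym (+-identityʳ _))
          moved : ⟦ δ ends (is u) e ∧ hasColour (c′ e) i ⟧ + ⟦ δ ends (is u) f ∧ hasColour (c′ f) i ⟧
                ≤ ⟦ δ ends′ (is u) e ∧ w ⟧ + ⟦ δ ends′ (is u) f ∧ hasColour (c f) i ⟧
          moved = subst₂ _≤_
            (cong₂ _+_ (cong₂ (λ p q → ⟦ p ∧ hasColour q i ⟧) (sym (at-u xe)) (sym (if-off e≢f)))
                       (cong₂ (λ p q → ⟦ p ∧ hasColour q i ⟧) (sym (at-u xf)) (sym (if-at f))))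
            (cong₂ _+_ (cong (λ p → ⟦ p ∧ w ⟧) (sym (δ′-e (is u))))
                       (sym (cong (λ p → ⟦ p ∧ hasColour (c f) i ⟧) (δ′-f (is u)))))
            (disjoint (is u a) (is u b) w (λ (p , q) → a≢b (trans (is-≡ p) (sym (is-≡ q)))))

  Inside : Graph n m → (Fin n → Bool) → Set
  Inside ends X = ∃ λ e → live ends e ≡ true × X (src ends e) ≡ true × X (tgt ends e) ≡ true

  record Irreducible (ends : Graph n m) (S R : Fin n → Bool) : Set where
    field
      no-cut   : ∀ X → Sep S X → d ends X ≡ K → Inside ends X → Inside ends (not ∘ X) → ⊥
      no-slack : ∀ e → live ends e ≡ true → ∃ λ X → Sep S X × d ends X ≡ K × δ ends X e ≡ true
      no-split : ∀ x e f → S x ∨ R x ≡ false → δ ends (is x) e ≡ true → δ ends (is x) f ≡ true →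
                 far ends x e ≢ far ends x f →
                 ∃ λ Y → Sep S Y × Y (far ends x e) ≡ true × Y (far ends x f) ≡ true × Y x ≡ false × d ends Y ≤ K + 1

  module Final {ends S R D v pc} (I : Instance ends S R D v pc) (irr : Irreducible ends S R) (2≤K : 2 ≤ K)
    (K′ : ℕ) (K′≤K : K′ ≤ K) (R-degree : ∀ u → R u ≡ true → K′ ≤ d ends (is u))
    (1≤k : 1 ≤ k) (r : ℕ) (K-eq : K ≡ 36 * k + r) (K′-eq : K′ ≡ 32 * k + r) where
    open Instance I
    open Irreducible irr

    sep-not : ∀ {X} → Sep S X → Sep S (not ∘ X)
    sep-not ((p , Sp , Yp) , (q , Sq , Yq)) = (q , Sq , not-false Yq) , (p , Sp , cong not Yp)

    inside-end : ∀ {X u e} → δ ends (is u) e ≡ true → X u ≡ true → X (far ends u e) ≡ true → Inside ends X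
    inside-end {X} {u} {e} h p q with δ-ends ends {u} {e} h
    ... | inj₁ (r , _ , s) = e , δ-live ends {is u} h , trans (cong X r) p , trans (cong X (sym s)) q
    ... | inj₂ (r , _ , s) = e , δ-live ends {is u} h , trans (cong X (sym s)) q , trans (cong X r) p

    record Star (X : Fin n → Bool) : Set where
      field
        centre : Fin n
        c∈S    : S centre ≡ true
        tight  : d ends (is centre) ≡ K
        same   : ∀ e → δ ends (is centre) e ≡ δ ends X e
        only   : ∀ {u e} → δ ends (is u) e ≡ true → X u ≡ true → u ≡ centre

    -- The vertex a ∈ S ∩ X already has K edges, so they are the whole cut.
    star : ∀ X → Sep S X → d ends X ≡ K → ¬ Inside ends X → Star X
    star X ((a , Sa , Xa) , (b , Sb , Xb)) dX indep = record
      { centre = a ; c∈S = Sa ; tight = trans (∑-cong same′) dX ; same = λ e → ⟦⟧-inj (same′ e) ; only = only }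
      where
      ⟦⟧-inj : ∀ {p q} → ⟦ p ⟧ ≡ ⟦ q ⟧ → p ≡ q
      ⟦⟧-inj {true}  {true}  h = refl
      ⟦⟧-inj {false} {false} h = refl
      out : ∀ {u e} → δ ends (is u) e ≡ true → X u ≡ true → X (far ends u e) ≡ false
      out h p = ≢true (λ q → indep (inside-end {X} h p q))
      sep-a : Sep S (is a)
      sep-a = (a , Sa , is-refl a) , (b , Sb , is-≢ (λ { refl → true≢false Xa Xb }))
      crosses : ∀ e → δ ends (is a) e ≡ true → δ ends X e ≡ true
      crosses e h = trans (δ-at ends X h) (cong₂ _xor_ Xa (out h Xa))
      same′ : ∀ e → ⟦ δ ends (is a) e ⟧ ≡ ⟦ δ ends X e ⟧
      same′ = ∑-squeeze (λ e → ⟦⟧-mono (crosses e)) (≤-trans (≤-reflexive dX) (cut (is a) sep-a))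
      only : ∀ {u e} → δ ends (is u) e ≡ true → X u ≡ true → u ≡ a
      only {u} {e} h p with is a u in eq
      ... | true  = is-≡ eq
      ... | false = ⊥-elim (true≢false (is-true far≡a) (is-≢ λ q → true≢false Xa (trans (cong X (sym q)) (out h p))))
        where
        far≡a : far ends u e ≡ a
        far≡a = is-≡ (trans (sym (trans (δ-at ends (is a) h) (cong (_xor is a (far ends u e)) eq)))
                       (trans (⟦⟧-inj (same′ e)) (trans (δ-at ends X h) (cong₂ _xor_ p (out h p)))))

    inside? : ∀ X → Dec (Inside ends X)
    inside? X = Finₚ.any? λ e → (live ends e Boolₚ.≟ true) ×-dec (X (src ends e) Boolₚ.≟ true) ×-dec (X (tgt ends e) Boolₚ.≟ true)

    tight-end : ∀ e → live ends e ≡ true → ∃ λ a → S a ≡ true × δ ends (is a) e ≡ true × d ends (is a) ≡ K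
    tight-end e h with no-slack e h
    ... | X , sep , dX , eX with inside? X
    ...   | no ¬in  = centre , c∈S , trans (same e) eX , tight
      where open Star (star X sep dX ¬in)
    ...   | yes ins = centre , c∈S , trans (same e) (trans (δ-not ends X e) eX) , tight
      where open Star (star (not ∘ X) (sep-not sep) (trans (d-not ends X) dX) (no-cut X sep dX ins))

    tight-far : ∀ {x e} → S x ≡ false → δ ends (is x) e ≡ true → S (far ends x e) ≡ true × d ends (is (far ends x e)) ≡ K
    tight-far {x} {e} Sx h with tight-end e (δ-live ends {is x} h)
    ... | a , Sa , ea , da = subst (λ z → S z ≡ true × d ends (is z) ≡ K) (sym far≡a) (Sa , da)
      where
      far≡a : far ends x e ≡ a
      far≡a = is-≡ (trans (cong (_xor is a (far ends x e)) (sym (is-≢ {u = a} {x} (λ { refl → true≢false Sa Sx })))) (trans (sym (δ-at ends (is a) h)) ea))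

    module At (x : Fin n) (x∉ : S x ∨ R x ≡ false) where

      Sx : S x ≡ false
      Sx with S x
      ... | false = refl

      ∂ : Fin m → Bool
      ∂ = δ ends (is x)

      into : (Fin n → Bool) → Fin m → Bool
      into Y e = ∂ e ∧ Y (far ends x e)

      dₓ : (Fin n → Bool) → ℕ
      dₓ Y = count (into Y)

      dₓ≤ : ∀ Y → Y x ≡ false → ∀ {c} → Sep S Y → d ends Y ≤ K + c → 2 * dₓ Y ≤ d ends (is x) + c
      dₓ≤ Y Yx {c} ((a , Sa , Ya) , (b , Sb , Yb)) le =
        ≤-by 0 (+-mono-≤ (cut Y⁺ sep⁺) le) (trans (shuffle (dₓ Y) K (d ends Y⁺) c) (trans (cong (_+ (c + K)) total) (shuffle′ (d ends Y) (d ends (is x)) c K)))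
        where
        Y⁺ : Fin n → Bool
        Y⁺ y = Y y ∨ is x y
        sep⁺ : Sep S Y⁺
        sep⁺ = (a , Sa , ∨-trueˡ Ya) , (b , Sb , cong₂ _∨_ Yb (is-≢ (λ { refl → true≢false Sb Sx })))
        shuffle : ∀ p K y c → 2 * p + (y + (K + c)) + 0 ≡ y + 2 * p + (c + K)
        shuffle p K y c = solve (p ∷ K ∷ y ∷ c ∷ [])
        shuffle′ : ∀ y x c K → y + x + (c + K) ≡ x + c + (K + y)
        shuffle′ y x c K = solve (y ∷ x ∷ c ∷ K ∷ [])
        total : d ends Y⁺ + 2 * dₓ Y ≡ d ends Y + d ends (is x)
        total = trans (cong (d ends Y⁺ +_) (sym (∑-* 2 _))) (trans (sym (∑-+ _ _)) (trans (∑-cong pointwise) (∑-+ _ _)))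
          where
          pointwise : ∀ e → ⟦ δ ends Y⁺ e ⟧ + 2 * ⟦ into Y e ⟧ ≡ ⟦ δ ends Y e ⟧ + ⟦ ∂ e ⟧
          pointwise e with ∂ e in h
          ... | true rewrite δ-at ends Y⁺ h | δ-at ends Y h | Yx | is-refl x | is-≢ (far≢ ends {x} {e} h) with Y (far ends x e)
          ...   | true  = refl
          ...   | false = refl
          pointwise e | false = cong₂ (λ p q → ⟦ p ⟧ + q) (lemma (xor-≡ h)) refl
            where
            lemma : is x (src ends e) ≡ is x (tgt ends e) → δ ends Y⁺ e ≡ δ ends Y e
            lemma p with is x (src ends e) in ps | is x (tgt ends e) in pt
            ... | false | false = cong₂ _xor_ (Boolₚ.∨-identityʳ (Y (src ends e))) (Boolₚ.∨-identityʳ (Y (tgt ends e)))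
            ... | true  | true  = trans (≡-xor (trans (Boolₚ.∨-zeroʳ (Y (src ends e))) (sym (Boolₚ.∨-zeroʳ (Y (tgt ends e))))))
                                        (sym (≡-xor (cong Y (trans (is-≡ ps) (sym (is-≡ pt))))))

      parallel≤ : ∀ {e} → ∂ e ≡ true → 2 * dₓ (is (far ends x e)) ≤ d ends (is x)
      parallel≤ {e} h = ≤-trans (dₓ≤ (is a) (is-≢ (far≢ ends h ∘ sym)) {0} sep (≤-reflexive (trans (proj₂ t) (sym (+-identityʳ K)))))
                                (≤-reflexive (+-identityʳ _))
        where
        a = far ends x e
        t = tight-far Sx h
        sep : Sep S (is a)
        sep with a ≟ v
        ... | yes p = (a , proj₁ t , is-refl a) , (proj₁ other , proj₁ (proj₂ other) , is-≢ (λ q → proj₂ (proj₂ other) (trans q p)))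
        ... | no ne = (a , proj₁ t , is-refl a) , (v , v∈S , is-≢ (ne ∘ sym))

      -- |δY| + |δZ| counts an edge from x to Y ∩ Z twice, and |δ(Y∖Z)| + |δ(Z∖Y)| does not count it.
      pair : ∀ Y Z → Y x ≡ false → Z x ≡ false → d ends (Y ∖ Z) + d ends (Z ∖ Y) + 2 * dₓ (Y ∩ᵇ Z) ≤ d ends Y + d ends Z
      pair Y Z Yx Zx = ≤-trans (≤-reflexive (trans (cong₂ _+_ (sym (∑-+ _ _)) (sym (∑-* 2 _))) (sym (∑-+ _ _))))
        (≤-trans (∑-mono pointwise) (≤-reflexive (∑-+ _ _)))
        where
        pointwise : ∀ e → ⟦ δ ends (Y ∖ Z) e ⟧ + ⟦ δ ends (Z ∖ Y) e ⟧ + 2 * ⟦ into (Y ∩ᵇ Z) e ⟧ ≤ ⟦ δ ends Y e ⟧ + ⟦ δ ends Z e ⟧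
        pointwise e with ∂ e in h
        ... | false = b≤ (by-cases 4 (λ y z y′ z′ → ⟦ (y ∧ not z) xor (y′ ∧ not z′) ⟧ + ⟦ (z ∧ not y) xor (z′ ∧ not y′) ⟧ + 0 ≤ᵇ ⟦ y xor y′ ⟧ + ⟦ z xor z′ ⟧) _
                        (Y (src ends e)) (Z (src ends e)) (Y (tgt ends e)) (Z (tgt ends e)))
        ... | true rewrite δ-at ends (Y ∖ Z) h | δ-at ends (Z ∖ Y) h | δ-at ends Y h | δ-at ends Z h | Yx | Zx =
          b≤ (by-cases 2 (λ y z → ⟦ y ∧ not z ⟧ + ⟦ z ∧ not y ⟧ + 2 * ⟦ y ∧ z ⟧ ≤ᵇ ⟦ y ⟧ + ⟦ z ⟧) _ (Y (far ends x e)) (Z (far ends x e)))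

      triple : ∀ Y Z W → Y x ≡ false → Z x ≡ false → W x ≡ false →
        d ends (Y ∩ᵇ Z ∩ᵇ W) + d ends (Y ∖ (Z ∪ᵇ W)) + (d ends (Z ∖ (W ∪ᵇ Y)) + d ends (W ∖ (Y ∪ᵇ Z))) + 2 * dₓ (Y ∩ᵇ Z ∩ᵇ W)
          ≤ d ends Y + d ends Z + d ends W
      triple Y Z W Yx Zx Wx =
        ≤-trans (≤-reflexive (trans (cong₂ _+_ (trans (cong₂ _+_ (sym (∑-+ _ _)) (sym (∑-+ _ _))) (sym (∑-+ _ _))) (sym (∑-* 2 _))) (sym (∑-+ _ _))))
          (≤-trans (∑-mono pointwise) (≤-reflexive (trans (∑-+ _ _) (cong (_+ d ends W) (∑-+ _ _)))))
        where
        pointwise : ∀ e → ⟦ δ ends (Y ∩ᵇ Z ∩ᵇ W) e ⟧ + ⟦ δ ends (Y ∖ (Z ∪ᵇ W)) e ⟧ + (⟦ δ ends (Z ∖ (W ∪ᵇ Y)) e ⟧ + ⟦ δ ends (W ∖ (Y ∪ᵇ Z)) e ⟧) + 2 * ⟦ into (Y ∩ᵇ Z ∩ᵇ W) e ⟧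
                    ≤ ⟦ δ ends Y e ⟧ + ⟦ δ ends Z e ⟧ + ⟦ δ ends W e ⟧
        pointwise e with ∂ e in h
        ... | false = b≤ (by-cases 6 (λ y z w y′ z′ w′ →
                ⟦ ((y ∧ z) ∧ w) xor ((y′ ∧ z′) ∧ w′) ⟧ + ⟦ (y ∧ not (z ∨ w)) xor (y′ ∧ not (z′ ∨ w′)) ⟧
                + (⟦ (z ∧ not (w ∨ y)) xor (z′ ∧ not (w′ ∨ y′)) ⟧ + ⟦ (w ∧ not (y ∨ z)) xor (w′ ∧ not (y′ ∨ z′)) ⟧) + 0
                ≤ᵇ ⟦ y xor y′ ⟧ + ⟦ z xor z′ ⟧ + ⟦ w xor w′ ⟧) _ (Y s) (Z s) (W s) (Y t) (Z t) (W t))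
          where
          s = src ends e
          t = tgt ends e
        ... | true rewrite δ-at ends (Y ∩ᵇ Z ∩ᵇ W) h | δ-at ends (Y ∖ (Z ∪ᵇ W)) h | δ-at ends (Z ∖ (W ∪ᵇ Y)) h | δ-at ends (W ∖ (Y ∪ᵇ Z)) h
                         | δ-at ends Y h | δ-at ends Z h | δ-at ends W h | Yx | Zx | Wx =
          b≤ (by-cases 3 (λ y z w → ⟦ (y ∧ z) ∧ w ⟧ + ⟦ y ∧ not (z ∨ w) ⟧ + (⟦ z ∧ not (w ∨ y) ⟧ + ⟦ w ∧ not (y ∨ z) ⟧) + 2 * ⟦ (y ∧ z) ∧ w ⟧
                ≤ᵇ ⟦ y ⟧ + ⟦ z ⟧ + ⟦ w ⟧) _ (Y (far ends x e)) (Z (far ends x e)) (W (far ends x e)))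

      record Dangerous (Y : Fin n → Bool) : Set where
        constructor dangerous
        field
          sep   : Sep S Y
          avoid : Y x ≡ false
          small : d ends Y ≤ K + 1

      end∈S : ∀ {e} → ∂ e ≡ true → S (far ends x e) ≡ true
      end∈S h = proj₁ (tight-far Sx h)

      module Crossing {Y Z} (DY : Dangerous Y) (DZ : Dangerous Z) {e₀ g f}
        (∂e₀ : ∂ e₀ ≡ true) (∂g : ∂ g ≡ true) (∂f : ∂ f ≡ true)
        (aY : Y (far ends x e₀) ≡ true) (aZ : Z (far ends x e₀) ≡ true)
        (bY : Y (far ends x g) ≡ true) (bZ : Z (far ends x g) ≡ false)
        (cY : Y (far ends x f) ≡ false) (cZ : Z (far ends x f) ≡ true) where
        private
          module DY = Dangerous DY
          module DZ = Dangerous DZ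

        sep-YZ : Sep S (Y ∖ Z)
        sep-YZ = (far ends x g , end∈S ∂g , ∧-true bY (not-false bZ)) , (far ends x f , end∈S ∂f , cong (_∧ not (Z (far ends x f))) cY)

        sep-ZY : Sep S (Z ∖ Y)
        sep-ZY = (far ends x f , end∈S ∂f , ∧-true cZ (not-false cY)) , (far ends x g , end∈S ∂g , cong (_∧ not (Y (far ends x g))) bZ)

        common : 1 ≤ dₓ (Y ∩ᵇ Z)
        common = count-pos (into (Y ∩ᵇ Z)) {e₀} (∧-true ∂e₀ (∧-true aY aZ))

        bound : d ends (Y ∖ Z) + d ends (Z ∖ Y) + 2 * dₓ (Y ∩ᵇ Z) ≤ (K + 1) + (K + 1)
        bound = ≤-trans (pair Y Z DY.avoid DZ.avoid) (+-mono-≤ DY.small DZ.small)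

        common≤1 : dₓ (Y ∩ᵇ Z) ≤ 1
        common≤1 = *-cancelˡ-≤ 2 (≤-by 0 (+-mono-≤ bound (+-mono-≤ (cut (Y ∖ Z) sep-YZ) (cut (Z ∖ Y) sep-ZY)))
          (shuffle (dₓ (Y ∩ᵇ Z)) (d ends (Y ∖ Z)) (d ends (Z ∖ Y)) K))
          where
          shuffle : ∀ p y z K → 2 * p + ((K + 1) + (K + 1) + (y + z)) + 0 ≡ 2 * 1 + (y + z + 2 * p + (K + K))
          shuffle p y z K = solve (p ∷ y ∷ z ∷ K ∷ [])

        tight : d ends (Y ∖ Z) ≡ K
        tight = ≤-antisym (≤-by 0 (+-mono-≤ bound (+-mono-≤ (cut (Z ∖ Y) sep-ZY) (*-monoʳ-≤ 2 common)))
          (shuffle (dₓ (Y ∩ᵇ Z)) (d ends (Y ∖ Z)) (d ends (Z ∖ Y)) K)) (cut (Y ∖ Z) sep-YZ)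
          where
          shuffle : ∀ p y z K → y + ((K + 1) + (K + 1) + (z + 2 * p)) + 0 ≡ K + (y + z + 2 * p + (K + 2 * 1))
          shuffle p y z K = solve (p ∷ y ∷ z ∷ K ∷ [])

        outside : Inside ends (not ∘ (Y ∖ Z))
        outside = inside-end {not ∘ (Y ∖ Z)} {x} {e₀} ∂e₀ (cong (λ z → not (z ∧ not (Z x))) DY.avoid)
                    (cong not (trans (cong (λ z → Y (far ends x e₀) ∧ not z) aZ) (Boolₚ.∧-zeroʳ (Y (far ends x e₀)))))

        single : Star (Y ∖ Z)
        single = star (Y ∖ Z) sep-YZ tight (λ ins → no-cut (Y ∖ Z) sep-YZ tight ins outside)

        one-end : ∀ {e e′} → ∂ e ≡ true → ∂ e′ ≡ true → (Y ∖ Z) (far ends x e) ≡ true → (Y ∖ Z) (far ends x e′) ≡ true →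
          far ends x e ≡ far ends x e′
        one-end h h′ p p′ = trans (Star.only single (δ-far ends h) p) (sym (Star.only single (δ-far ends h′) p′))

        only-e₀ : ∀ {e} → ∂ e ≡ true → Y (far ends x e) ≡ true → Z (far ends x e) ≡ true → e ≡ e₀
        only-e₀ {e} h p q with e ≟ e₀
        ... | yes eq = eq
        ... | no ne  = ⊥-elim (<⇒≱ (count-2 (into (Y ∩ᵇ Z)) ne (∧-true h (∧-true p q)) (∧-true ∂e₀ (∧-true aY aZ))) common≤1)

      into-strict : ∀ {A B : Fin n → Bool} → (∀ e → into A e ≡ true → into B e ≡ true) →
        ∀ {h} → ∂ h ≡ true → A (far ends x h) ≡ false → B (far ends x h) ≡ true → dₓ A < dₓ B
      into-strict {A} {B} sub {h} ∂h p q = ∑-< (λ e → ⟦⟧-mono (sub e)) h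
        (subst₂ _<_ (cong ⟦_⟧ (sym (trans (cong (∂ h ∧_) p) (Boolₚ.∧-zeroʳ (∂ h))))) (cong ⟦_⟧ (sym (∧-true ∂h q))) ≤-refl)

      module _ (3<dx : 3 < d ends (is x)) (e₀ : Fin m) (∂e₀ : ∂ e₀ ≡ true) where
        private
          dx = d ends (is x)
          a = far ends x e₀

        pair-set : ∀ {e f} → ∂ e ≡ true → ∂ f ≡ true → far ends x e ≢ far ends x f →
          ∃ λ Y → Dangerous Y × Y (far ends x e) ≡ true × Y (far ends x f) ≡ true
        pair-set {e} {f} h h′ ne with no-split x e f x∉ h h′ ne
        ... | Y , sep , p , q , r , le = Y , dangerous sep r le , p , q

        few : ∀ {Y} → Dangerous Y → 2 * dₓ Y ≤ dx + 1
        few {Y} D = dₓ≤ Y (Dangerous.avoid D) (Dangerous.sep D) (Dangerous.small D)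

        few< : ∀ {Y} → Dangerous Y → dₓ Y < dx
        few< {Y} DY = ≰⇒> λ ge → <⇒≱ 3<dx (≤-by 2 (+-mono-≤ (few DY) (*-monoʳ-≤ 2 ge)) (shuffle dx (dₓ Y)))
          where
          shuffle : ∀ x y → x + (x + 1 + 2 * y) + 2 ≡ 3 + (2 * y + 2 * x)
          shuffle x y = solve (x ∷ y ∷ [])

        fewer : ∀ {W} → Dangerous W → dx ≤ dₓ W + 1 → ⊥
        fewer {W} DW most = <⇒≱ 3<dx (≤-by 0 (+-mono-≤ (few DW) (*-monoʳ-≤ 2 most)) (shuffle dx (dₓ W)))
          where
          shuffle : ∀ x w → x + (x + 1 + 2 * (w + 1)) + 0 ≡ 3 + (2 * w + 2 * x)
          shuffle x w = solve (x ∷ w ∷ [])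

        three-apart : ∀ {Y Z W g f h} → Dangerous Y → Dangerous Z → Dangerous W → ∂ g ≡ true → ∂ f ≡ true → ∂ h ≡ true →
          Y a ≡ true → Z a ≡ true → W a ≡ true →
          Y (far ends x g) ≡ true → Z (far ends x g) ≡ false → W (far ends x g) ≡ false →
          Y (far ends x f) ≡ false → Z (far ends x f) ≡ true → W (far ends x f) ≡ false →
          Y (far ends x h) ≡ false → Z (far ends x h) ≡ false → W (far ends x h) ≡ true → ⊥
        three-apart {Y} {Z} {W} {g} {f} {h} DY DZ DW ∂g ∂f ∂h aY aZ aW bY bZ bW cY cZ cW zY zZ zW =
          <⇒≱ 2≤K (≤-by 0 (+-mono-≤ (≤-trans (triple Y Z W DY.avoid DZ.avoid DW.avoid) (+-mono-≤ (+-mono-≤ DY.small DZ.small) DW.small))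
              (+-mono-≤ (+-mono-≤ (+-mono-≤ (cut (Y ∩ᵇ Z ∩ᵇ W) s₀) (cut (Y ∖ (Z ∪ᵇ W)) s₁)) (+-mono-≤ (cut (Z ∖ (W ∪ᵇ Y)) s₂) (cut (W ∖ (Y ∪ᵇ Z)) s₃)))
                        (*-monoʳ-≤ 2 (count-pos (into (Y ∩ᵇ Z ∩ᵇ W)) {e₀} (∧-true ∂e₀ (∧-true (∧-true aY aZ) aW))))))
            (shuffle K (d ends (Y ∩ᵇ Z ∩ᵇ W)) (d ends (Y ∖ (Z ∪ᵇ W))) (d ends (Z ∖ (W ∪ᵇ Y))) (d ends (W ∖ (Y ∪ᵇ Z))) (dₓ (Y ∩ᵇ Z ∩ᵇ W))))
          where
          module DY = Dangerous DY
          module DZ = Dangerous DZ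
          module DW = Dangerous DW
          shuffle : ∀ K p q r s t → K + (K + 1 + (K + 1) + (K + 1) + (p + q + (r + s) + 2 * t)) + 0 ≡ 1 + (p + q + (r + s) + 2 * t + (K + K + (K + K) + 2 * 1))
          shuffle K p q r s t = solve (K ∷ p ∷ q ∷ r ∷ s ∷ t ∷ [])
          b = far ends x g
          c = far ends x f
          z = far ends x h
          s₀ : Sep S (Y ∩ᵇ Z ∩ᵇ W)
          s₀ = (a , end∈S ∂e₀ , ∧-true (∧-true aY aZ) aW) , (b , end∈S ∂g , trans (cong ((Y b ∧ Z b) ∧_) bW) (Boolₚ.∧-zeroʳ (Y b ∧ Z b)))
          s₁ : Sep S (Y ∖ (Z ∪ᵇ W))
          s₁ = (b , end∈S ∂g , ∧-true bY (cong not (cong₂ _∨_ bZ bW))) , (c , end∈S ∂f , cong (_∧ not (Z c ∨ W c)) cY)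
          s₂ : Sep S (Z ∖ (W ∪ᵇ Y))
          s₂ = (c , end∈S ∂f , ∧-true cZ (cong not (cong₂ _∨_ cW cY))) , (b , end∈S ∂g , cong (_∧ not (W b ∨ Y b)) bZ)
          s₃ : Sep S (W ∖ (Y ∪ᵇ Z))
          s₃ = (z , end∈S ∂h , ∧-true zW (cong not (cong₂ _∨_ zY zZ))) , (b , end∈S ∂g , cong (_∧ not (Y b ∨ Z b)) bW)

        -- Dangerous sets containing a can be enlarged (as to their edges from x) for ever.
        grow-dangerous : ∀ fuel Y → Dangerous Y → Y a ≡ true → dx ≤ fuel + dₓ Y → ⊥
        grow-dangerous zero       Y DY aY le = <⇒≱ (few< DY) le
        grow-dangerous (suc fuel) Y DY aY le = start (missing ∂ (λ e → Y (far ends x e)) (few< DY))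
          where
          bigger : ∀ {W} → Dangerous W → W a ≡ true → (∀ e → into Y e ≡ true → into W e ≡ true) →
            ∀ {h} → ∂ h ≡ true → Y (far ends x h) ≡ false → W (far ends x h) ≡ true → ⊥
          bigger {W} DW aW sub ∂h hY hW = grow-dangerous fuel W DW aW (≤-trans le (≤-trans (≤-reflexive (sym (+-suc fuel (dₓ Y))))
            (+-monoʳ-≤ fuel (into-strict {Y} {W} sub ∂h hY hW))))

          all-covered : ∀ {Z g f} → Dangerous Z → Z a ≡ true → ∂ g ≡ true → ∂ f ≡ true →
            Y (far ends x g) ≡ true → Z (far ends x g) ≡ false → Y (far ends x f) ≡ false → Z (far ends x f) ≡ true →
            (∀ h → ∂ h ≡ true → Y (far ends x h) ≡ false → Z (far ends x h) ≡ false → ⊥) →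
            (∃ λ W → Dangerous W × W (far ends x g) ≡ true × W (far ends x f) ≡ true) → ⊥
          all-covered {Z} DZ aZ ∂g ∂f bY bZ cY cZ none (W , DW , bW , cW) =
            fewer DW (≤-trans (∑-mono pointwise) (≤-trans (≤-reflexive (∑-+ _ _)) (+-monoʳ-≤ (dₓ W) YZ.common≤1)))
            where
            module YZ = Crossing DY DZ ∂e₀ ∂g ∂f aY aZ bY bZ cY cZ
            module ZY = Crossing DZ DY ∂e₀ ∂f ∂g aZ aY cZ cY bZ bY
            covered : ∀ e → ∂ e ≡ true → W (far ends x e) ≡ true ⊎ (Y ∩ᵇ Z) (far ends x e) ≡ true
            covered e h with bool? (Y (far ends x e)) | bool? (Z (far ends x e))
            ... | inj₁ p | inj₁ q = inj₂ (∧-true p q)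
            ... | inj₂ p | inj₂ q = ⊥-elim (none e h p q)
            ... | inj₁ p | inj₂ q = inj₁ (trans (cong W (YZ.one-end h ∂g (∧-true p (not-false q)) (∧-true bY (not-false bZ)))) bW)
            ... | inj₂ p | inj₁ q = inj₁ (trans (cong W (ZY.one-end h ∂f (∧-true q (not-false p)) (∧-true cZ (not-false cY)))) cW)
            pointwise : ∀ e → ⟦ ∂ e ⟧ ≤ ⟦ into W e ⟧ + ⟦ into (Y ∩ᵇ Z) e ⟧
            pointwise e with bool? (∂ e)
            ... | inj₂ h = ≤-trans (≤-reflexive (cong ⟦_⟧ h)) z≤n
            ... | inj₁ h with covered e h
            ...   | inj₁ p = ≤-trans (⟦⟧-mono (λ _ → ∧-true h p)) (m≤m+n _ _)
            ...   | inj₂ p = ≤-trans (⟦⟧-mono (λ _ → ∧-true h p)) (m≤n+m _ _)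

          third : ∀ {Z g f h} → Dangerous Z → Z a ≡ true → ∂ g ≡ true → ∂ f ≡ true → ∂ h ≡ true →
            Y (far ends x g) ≡ true → Z (far ends x g) ≡ false → Y (far ends x f) ≡ false → Z (far ends x f) ≡ true →
            Y (far ends x h) ≡ false → Z (far ends x h) ≡ false →
            (∃ λ W → Dangerous W × W a ≡ true × W (far ends x h) ≡ true) → ⊥
          third {Z} {g} {f} {h} DZ aZ ∂g ∂f ∂h bY bZ cY cZ zY zZ (W , DW , aW , zW) =
            cases (W (far ends x g)) refl (W (far ends x f)) refl
            where
            module YZ = Crossing DY DZ ∂e₀ ∂g ∂f aY aZ bY bZ cY cZ
            cases : ∀ p → W (far ends x g) ≡ p → ∀ q → W (far ends x f) ≡ q → ⊥
            cases true bW false cW = true≢false bY (trans (cong Y (WZ.one-end ∂g ∂h (∧-true bW (not-false bZ)) (∧-true zW (not-false zZ)))) zY)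
              where module WZ = Crossing DW DZ ∂e₀ ∂h ∂f aW aZ zW zZ cW cZ
            cases false bW true cW = true≢false cZ (trans (cong Z (WY.one-end ∂f ∂h (∧-true cW (not-false cY)) (∧-true zW (not-false zY)))) zZ)
              where module WY = Crossing DW DY ∂e₀ ∂h ∂g aW aY zW zY bW bY
            cases false bW false cW = three-apart DY DZ DW ∂g ∂f ∂h aY aZ aW bY bZ bW cY cZ cW zY zZ zW
            cases true bW true cW = bigger DW aW sub ∂h zY zW
              where
              sub : ∀ e → into Y e ≡ true → into W e ≡ true
              sub e hp with bool? (Z (far ends x e))
              ... | inj₁ q = ∧-true (∧-trueˡ hp) (trans (cong (W ∘ far ends x) (YZ.only-e₀ (∧-trueˡ hp) (∧-trueʳ {∂ e} hp) q)) aW)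
              ... | inj₂ q = ∧-true (∧-trueˡ hp) (trans (cong W (YZ.one-end (∧-trueˡ hp) ∂g (∧-true (∧-trueʳ {∂ e} hp) (not-false q)) (∧-true bY (not-false bZ)))) bW)

          start : (∃ λ f → ∂ f ≡ true × Y (far ends x f) ≡ false) → ⊥
          start (f , ∂f , cY) = step (pair-set ∂e₀ ∂f (λ eq → true≢false aY (trans (cong Y eq) cY)))
            where
            step : (∃ λ Z → Dangerous Z × Z a ≡ true × Z (far ends x f) ≡ true) → ⊥
            step (Z , DZ , aZ , cZ) with Finₚ.any? (λ g → (∂ g Boolₚ.≟ true) ×-dec (Y (far ends x g) Boolₚ.≟ true) ×-dec (Z (far ends x g) Boolₚ.≟ false))
            ... | no none = bigger DZ aZ (λ e hp → ∧-true (∧-trueˡ hp) (≢false (λ q → none (e , ∧-trueˡ hp , ∧-trueʳ {∂ e} hp , q)))) ∂f cY cZ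
              where
              ≢false : ∀ {b} → ¬ b ≡ false → b ≡ true
              ≢false {true}  h = refl
              ≢false {false} h = ⊥-elim (h refl)
            ... | yes (g , ∂g , bY , bZ) with Finₚ.any? (λ h → (∂ h Boolₚ.≟ true) ×-dec (Y (far ends x h) Boolₚ.≟ false) ×-dec (Z (far ends x h) Boolₚ.≟ false))
            ...   | no none = all-covered DZ aZ ∂g ∂f bY bZ cY cZ (λ h p q r → none (h , p , q , r))
                                (pair-set ∂g ∂f (λ eq → true≢false bY (trans (cong Y eq) cY)))
            ...   | yes (h , ∂h , zY , zZ) = third DZ aZ ∂g ∂f ∂h bY bZ cY cZ zY zZ
                                (pair-set ∂e₀ ∂h (λ eq → true≢false aY (trans (cong Y eq) zY)))

      degree-0-or-3 : d ends (is x) ≡ 0 ⊎ d ends (is x) ≡ 3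
      degree-0-or-3 = cases (d ends (is x)) refl
        where
        module _ (e₀ : Fin m) (∂e₀ : ∂ e₀ ≡ true) (pos : 1 ≤ d ends (is x)) where
          some-other : dₓ (is (far ends x e₀)) < d ends (is x)
          some-other = ≰⇒> λ ge → <⇒≱ pos
            (≤-by 0 (+-mono-≤ (parallel≤ ∂e₀) (*-monoʳ-≤ 2 ge)) (shuffle (d ends (is x)) (dₓ (is (far ends x e₀)))))
            where
            shuffle : ∀ x y → x + (x + 2 * y) + 0 ≡ 0 + (2 * y + 2 * x)
            shuffle x y = solve (x ∷ y ∷ [])
          start : (∃ λ f → ∂ f ≡ true × is (far ends x e₀) (far ends x f) ≡ false) →
            ∃ λ Y → Dangerous Y × Y (far ends x e₀) ≡ true × 2 ≤ dₓ Y
          start (f , ∂f , ne) with no-split x e₀ f x∉ ∂e₀ ∂f (λ eq → is-false ne (sym eq))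
          ... | Y , sep , aY , bY , Yx , le = Y , dangerous sep Yx le , aY ,
                count-2 (into Y) {e₀} {f} (λ { refl → is-false ne refl }) (∧-true ∂e₀ aY) (∧-true ∂f bY)
          exact : ∀ d′ → d ends (is x) ≡ suc d′ → (∃ λ Y → Dangerous Y × Y (far ends x e₀) ≡ true × 2 ≤ dₓ Y) → suc d′ ≡ 3
          exact d′ eq (Y , D@(dangerous sep Yx le) , aY , two) = which d′ eq
            where
            four : 4 ≤ d ends (is x) + 1
            four = ≤-trans (*-monoʳ-≤ 2 two) (dₓ≤ Y Yx sep le)
            which : ∀ d′ → d ends (is x) ≡ suc d′ → suc d′ ≡ 3
            which zero eq with ≤-trans four (≤-reflexive (cong (_+ 1) eq))
            ... | s≤s (s≤s ())
            which (suc zero) eq with ≤-trans four (≤-reflexive (cong (_+ 1) eq))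
            ... | s≤s (s≤s (s≤s ()))
            which (suc (suc zero)) eq = refl
            which (suc (suc (suc d″))) eq = ⊥-elim (grow-dangerous (≤-trans (s≤s (s≤s (s≤s (s≤s z≤n)))) (≤-reflexive (sym eq))) e₀ ∂e₀
              (d ends (is x)) Y D aY (m≤m+n _ _))
        cases : ∀ D → d ends (is x) ≡ D → d ends (is x) ≡ 0 ⊎ d ends (is x) ≡ 3
        cases zero     eq = inj₁ eq
        cases (suc d′) eq = let pos = ≤-trans (s≤s z≤n) (≤-reflexive (sym eq))
                                e₀ , ∂e₀ = count-witness ∂ pos
                            in inj₂ (trans eq (exact e₀ ∂e₀ pos d′ eq (start e₀ ∂e₀ pos (missing ∂ (λ e → is (far ends x e₀) (far ends x e)) (some-other e₀ ∂e₀ pos)))))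

    -- The structure of an irreducible graph. W is the set of terminals other than v; a hub is a
    -- vertex outside S ∪ R, of degree 3, all whose neighbours lie in S. The edges at a hub are
    -- handled as one item, named by the edge at v if there is one.

    W B : Fin n → Bool
    W y = (S y ∨ R y) ∧ not (is v y)
    B y = not (S y ∨ R y)

    B-∉ : ∀ {x} → B x ≡ true → S x ∨ R x ≡ false
    B-∉ h = not-true h

    B-S : ∀ {x} → B x ≡ true → S x ≡ false
    B-S {x} h with S x
    ... | false = refl

    S-B : ∀ {x} → S x ≡ true → B x ≡ false
    S-B h = cong not (∨-trueˡ h)

    W-B : ∀ {y} → W y ≡ true → B y ≡ false
    W-B {y} h = cong not (∧-trueˡ h)

    B-W : ∀ {y} → B y ≡ true → W y ≡ false
    B-W {y} h = ≢true (λ p → true≢false h (W-B p))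

    W-v : ∀ {y} → W y ≡ true → y ≢ v
    W-v {y} h = is-false (not-true (∧-trueʳ {S y ∨ R y} h))

    Wv : W v ≡ false
    Wv = ≢true (λ h → W-v h refl)

    S-W : ∀ {y} → S y ≡ true → y ≢ v → W y ≡ true
    S-W p q = ∧-true (∨-trueˡ p) (not-false (is-≢ q))

    not-W : ∀ {y} → B y ≡ false → W y ≡ false → y ≡ v
    not-W {y} p q with S y ∨ R y | is v y in eq
    ... | true | true = is-≡ eq

    B-v : ∀ {x} → B x ≡ true → x ≢ v
    B-v p refl = true≢false v∈S (B-S p)

    B-far : ∀ {x e} → B x ≡ true → δ ends (is x) e ≡ true → S (far ends x e) ≡ true
    B-far p h = proj₁ (tight-far (B-S p) h)

    degree-3 : ∀ {x e} → B x ≡ true → δ ends (is x) e ≡ true → d ends (is x) ≡ 3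
    degree-3 {x} {e} p h with At.degree-0-or-3 x (B-∉ p)
    ... | inj₂ q = q
    ... | inj₁ q = ⊥-elim (<⇒≱ (count-pos (δ ends (is x)) {e} h) (≤-reflexive q))

    parallel≤1 : ∀ {x e} → B x ≡ true → δ ends (is x) e ≡ true →
      count (λ f → δ ends (is x) f ∧ is (far ends x e) (far ends x f)) ≤ 1
    parallel≤1 {x} {e} p h = ≮⇒≥ λ two → <⇒≱ {3} ≤-refl (≤-trans (*-monoʳ-≤ 2 two)
      (≤-trans (At.parallel≤ x (B-∉ p) h) (≤-reflexive (degree-3 p h))))

    no-parallel : ∀ {x e f} → B x ≡ true → δ ends (is x) e ≡ true → δ ends (is x) f ≡ true → far ends x e ≡ far ends x f → e ≡ f
    no-parallel {x} {e} {f} p h h′ eq with e ≟ f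
    ... | yes q = q
    ... | no ne = ⊥-elim (<⇒≱ (count-2 (λ f → δ ends (is x) f ∧ is (far ends x e) (far ends x f)) ne
                    (∧-true h (is-refl _)) (∧-true h′ (is-true (sym eq)))) (parallel≤1 p h))

    ∂v-far : ∀ {x e} → x ≢ v → δ ends (is x) e ≡ true → δ ends (is v) e ≡ true → far ends x e ≡ v
    ∂v-far {x} {e} ne h hv = is-≡ (trans (cong (_xor is v (far ends x e)) (sym (is-≢ ne))) (trans (sym (δ-at ends (is v) h)) hv))

    far-∂v : ∀ {x e} → x ≢ v → δ ends (is x) e ≡ true → far ends x e ≡ v → δ ends (is v) e ≡ true
    far-∂v {x} {e} ne h eq = trans (δ-at ends (is v) h) (trans (cong (_xor is v (far ends x e)) (is-≢ ne)) (is-true eq))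

    v-edge-unique : ∀ {x e f} → B x ≡ true → δ ends (is x) e ≡ true → δ ends (is x) f ≡ true →
      δ ends (is v) e ≡ true → δ ends (is v) f ≡ true → e ≡ f
    v-edge-unique p h h′ hv hv′ = no-parallel p h h′ (trans (∂v-far (B-v p) h hv) (sym (∂v-far (B-v p) h′ hv′)))

    repOf : ∀ {x} → Dec (∃ λ e → δ ends (is x) e ∧ δ ends (is v) e ≡ true) → Dec (∃ λ e → δ ends (is x) e ≡ true) → Maybe (Fin m)
    repOf (yes (e , _)) _             = just e
    repOf (no _)        (yes (e , _)) = just e
    repOf (no _)        (no _)        = nothing

    opaque
      rep : Fin n → Maybe (Fin m)
      rep x = repOf {x} (Finₚ.any? λ e → _ Boolₚ.≟ true) (Finₚ.any? λ e → _ Boolₚ.≟ true)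

      rep-at : ∀ {x ℓ} → rep x ≡ just ℓ → δ ends (is x) ℓ ≡ true
      rep-at {x} = go (Finₚ.any? λ e → _ Boolₚ.≟ true) (Finₚ.any? λ e → _ Boolₚ.≟ true)
        where
        go : ∀ p q {ℓ} → repOf {x} p q ≡ just ℓ → δ ends (is x) ℓ ≡ true
        go (yes (e , h)) _             refl = ∧-trueˡ h
        go (no _)        (yes (e , h)) refl = h

      rep-v : ∀ {x ℓ e} → rep x ≡ just ℓ → δ ends (is x) e ≡ true → δ ends (is v) e ≡ true → δ ends (is v) ℓ ≡ true
      rep-v {x} {ℓ} {e} r he hv = go (Finₚ.any? λ e → _ Boolₚ.≟ true) (Finₚ.any? λ e → _ Boolₚ.≟ true) r
        where
        go : ∀ p q → repOf {x} p q ≡ just ℓ → δ ends (is v) ℓ ≡ true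
        go (yes (e , h)) _ refl = ∧-trueʳ {δ ends (is x) e} h
        go (no none)     _ _    = ⊥-elim (none (e , ∧-true he hv))

      rep-some : ∀ {x e} → δ ends (is x) e ≡ true → ∃ λ ℓ → rep x ≡ just ℓ
      rep-some {x} {e} h = go (Finₚ.any? λ e → _ Boolₚ.≟ true) (Finₚ.any? λ e → _ Boolₚ.≟ true)
        where
        go : ∀ p q → ∃ λ ℓ → repOf {x} p q ≡ just ℓ
        go (yes (e , _)) _             = e , refl
        go (no _)        (yes (e , _)) = e , refl
        go (no _)        (no none)     = ⊥-elim (none (e , h))

    opaque
      hub : Fin m → Maybe (Fin n)
      hub e = if live ends e ∧ B (src ends e) then just (src ends e)
              else if live ends e ∧ B (tgt ends e) then just (tgt ends e) else nothing

      hub-spec : ∀ {e x} → hub e ≡ just x → B x ≡ true × δ ends (is x) e ≡ true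
      hub-spec {e} h with live ends e ∧ B (src ends e) in p | live ends e ∧ B (tgt ends e) in q
      hub-spec {e} refl | true  | _    = ∧-trueʳ {live ends e} p , proj₁ (live-δ ends (∧-trueˡ p))
      hub-spec {e} refl | false | true = ∧-trueʳ {live ends e} q , proj₂ (live-δ ends (∧-trueˡ q))

      hub-at : ∀ {e x} → B x ≡ true → δ ends (is x) e ≡ true → hub e ≡ just x
      hub-at {e} {x} p h with δ-ends ends {x} {e} h
      ... | inj₁ (refl , ne , q) rewrite p | δ-live ends {is (src ends e)} {e} h = refl
      ... | inj₂ (refl , ne , q) rewrite δ-live ends {is (tgt ends e)} {e} h
                                       | S-B (subst (λ z → S z ≡ true) q (B-far p h)) | p = refl

      hub-nothing : ∀ {e} → hub e ≡ nothing → live ends e ≡ true → B (src ends e) ≡ false × B (tgt ends e) ≡ false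
      hub-nothing {e} h l = ≢true (λ p → absurd (trans (sym h) (hub-at p (proj₁ (live-δ ends l)))))
                          , ≢true (λ p → absurd (trans (sym h) (hub-at p (proj₂ (live-δ ends l)))))
        where
        absurd : ∀ {x : Fin n} → nothing ≡ just x → ⊥
        absurd ()

    hub-view : ∀ e → hub e ≡ nothing ⊎ ∃ λ x → B x ≡ true × δ ends (is x) e ≡ true
    hub-view e = view (hub e) refl
      where
      view : ∀ h → hub e ≡ h → hub e ≡ nothing ⊎ ∃ λ x → B x ≡ true × δ ends (is x) e ≡ true
      view nothing  p = inj₁ p
      view (just x) p = inj₂ (x , hub-spec p)

    labOf : Fin m → Maybe (Fin n) → Fin m
    labOf e nothing  = e
    labOf e (just x) = fromMaybe e (rep x)

    lab : Fin m → Fin m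
    lab e = labOf e (hub e)

    lab-nothing : ∀ {e} → hub e ≡ nothing → lab e ≡ e
    lab-nothing {e} h = cong (labOf e) h

    rep-lab : ∀ {x e} → B x ≡ true → δ ends (is x) e ≡ true → rep x ≡ just (lab e)
    rep-lab {x} {e} p h with rep-some {x} h
    ... | ℓ , r = trans r (cong just (sym (trans (cong (labOf e) (hub-at p h)) (cong (fromMaybe e) r))))

    lab-at : ∀ {x e} → B x ≡ true → δ ends (is x) e ≡ true → δ ends (is x) (lab e) ≡ true
    lab-at p h = rep-at (rep-lab p h)

    lab-same : ∀ {x e f} → B x ≡ true → δ ends (is x) e ≡ true → δ ends (is x) f ≡ true → lab e ≡ lab f
    lab-same p h h′ = just-injective (trans (sym (rep-lab p h)) (rep-lab p h′))

    lab-v : ∀ {e} → δ ends (is v) e ≡ true → lab e ≡ e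
    lab-v {e} hv with hub-view e
    ... | inj₁ p           = lab-nothing p
    ... | inj₂ (x , p , h) = v-edge-unique p (lab-at p h) h (rep-v (rep-lab p h) h hv) hv

    lab-idem : ∀ e → lab (lab e) ≡ lab e
    lab-idem e with hub-view e
    ... | inj₁ p           = cong lab (lab-nothing p)
    ... | inj₂ (x , p , h) = lab-same p (lab-at p h) h

    fibre-hub : ∀ {e ℓ x} → lab e ≡ ℓ → live ends e ≡ true → hub ℓ ≡ just x → δ ends (is x) e ≡ true
    fibre-hub {e} {ℓ} {x} refl l hℓ with hub-view e
    ... | inj₁ p           = subst (λ z → δ ends (is x) z ≡ true) (lab-nothing p) (proj₂ (hub-spec hℓ))
    ... | inj₂ (y , p , h) = subst (λ z → δ ends (is z) e ≡ true) (just-injective (trans (sym (hub-at p (lab-at p h))) hℓ)) h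

    fibre-nothing : ∀ {e ℓ} → lab e ≡ ℓ → hub ℓ ≡ nothing → e ≡ ℓ
    fibre-nothing {e} refl hℓ with hub-view e
    ... | inj₁ p           = sym (lab-nothing p)
    ... | inj₂ (y , p , h) with trans (sym (hub-at p (lab-at p h))) hℓ
    ...   | ()

    ψOf : Fin n → Maybe (Fin m) → Fin n
    ψOf x nothing  = v
    ψOf x (just ℓ) = far ends x ℓ

    -- hubs are contracted along their representative edge; those next to v thus disappear into v
    ψ : Fin n → Fin n
    ψ y = if B y then ψOf y (rep y) else y

    ψ-id : ∀ {y} → B y ≡ false → ψ y ≡ y
    ψ-id h rewrite h = refl

    ψ-hub : ∀ {x e} → B x ≡ true → δ ends (is x) e ≡ true → ψ x ≡ far ends x (lab e)
    ψ-hub {x} p h rewrite p = cong (ψOf x) (rep-lab p h)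

    link : Graph n m
    link e = ψ (src ends e) , ψ (tgt ends e)

    free : Fin m → Bool
    free ℓ = is ℓ (lab ℓ) ∧ not (δ ends (is v) ℓ)

    free-lab : ∀ {ℓ} → free ℓ ≡ true → lab ℓ ≡ ℓ
    free-lab h = is-≡ (∧-trueˡ h)

    free-v : ∀ {ℓ} → free ℓ ≡ true → δ ends (is v) ℓ ≡ false
    free-v {ℓ} h = not-true (∧-trueʳ {is ℓ (lab ℓ)} h)

    free-edge-v : ∀ {e} → free (lab e) ≡ true → δ ends (is v) e ≡ false
    free-edge-v {e} h = ≢true (λ hv → true≢false hv (trans (cong (δ ends (is v)) (sym (lab-v hv))) (free-v h)))

    dead-ends : ∀ {e} → live ends e ≡ false → src ends e ≡ tgt ends e
    dead-ends {e} h = sym (is-≡ (trans (sym (Boolₚ.not-involutive _)) (cong not h)))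

    link-hub : ∀ {x e} → B x ≡ true → δ ends (is x) e ≡ true →
      (link e ≡ (far ends x (lab e) , far ends x e)) ⊎ (link e ≡ (far ends x e , far ends x (lab e)))
    link-hub {x} {e} p h with δ-ends ends {x} {e} h
    ... | inj₁ (refl , _ , q) = inj₁ (cong₂ _,_ (ψ-hub p h) (trans (ψ-id (S-B (subst (λ z → S z ≡ true) q (B-far p h)))) (sym q)))
    ... | inj₂ (refl , _ , q) = inj₂ (cong₂ _,_ (trans (ψ-id (S-B (subst (λ z → S z ≡ true) q (B-far p h)))) (sym q)) (ψ-hub p h))

    free-link : ∀ {e} → free (lab e) ≡ true → live ends e ≡ true → W (ψ (src ends e)) ≡ true × W (ψ (tgt ends e)) ≡ true
    free-link {e} f l with hub-view e
    ... | inj₂ (x , p , h) = both (link-hub p h)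
      where
      W-far : ∀ {e′} → δ ends (is x) e′ ≡ true → δ ends (is v) e′ ≡ false → W (far ends x e′) ≡ true
      W-far h′ hv = S-W (B-far p h′) (λ eq → true≢false (far-∂v (B-v p) h′ eq) hv)
      w₁ : W (far ends x e) ≡ true
      w₁ = W-far h (free-edge-v f)
      w₂ : W (far ends x (lab e)) ≡ true
      w₂ = W-far (lab-at p h) (free-v f)
      both : (link e ≡ (far ends x (lab e) , far ends x e)) ⊎ (link e ≡ (far ends x e , far ends x (lab e))) →
        W (ψ (src ends e)) ≡ true × W (ψ (tgt ends e)) ≡ true
      both (inj₁ q) = trans (cong (W ∘ proj₁) q) w₂ , trans (cong (W ∘ proj₂) q) w₁
      both (inj₂ q) = trans (cong (W ∘ proj₁) q) w₁ , trans (cong (W ∘ proj₂) q) w₂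
    ... | inj₁ he = end bs (λ q → src-δ ends q (λ q′ → ne (trans q (sym q′)))) , end bt (λ q → tgt-δ ends q (λ q′ → ne (trans q′ (sym q))))
      where
      bs = proj₁ (hub-nothing he l)
      bt = proj₂ (hub-nothing he l)
      ne : src ends e ≢ tgt ends e
      ne q = is-false (not-true l) (sym q)
      end : ∀ {y} → B y ≡ false → (y ≡ v → δ ends (is v) e ≡ true) → W (ψ y) ≡ true
      end {y} p h = trans (cong W (ψ-id p)) (≢f (λ q → true≢false (h (not-W p q)) (free-edge-v f)))
        where
        ≢f : ¬ W y ≡ false → W y ≡ true
        ≢f h with W y
        ... | true  = refl
        ... | false = ⊥-elim (h refl)

    ∂v : Fin m → Bool
    ∂v = δ ends (is v)

    End : Fin n → Fin m → Set
    End y e = y ≡ src ends e ⊎ y ≡ tgt ends e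

    δ-End : ∀ {u e} → δ ends (is u) e ≡ true → End u e
    δ-End {u} {e} h with δ-ends ends {u} {e} h
    ... | inj₁ (p , _) = inj₁ (sym p)
    ... | inj₂ (p , _) = inj₂ (sym p)

    far-End : ∀ {u e} → δ ends (is u) e ≡ true → End (far ends u e) e
    far-End h = δ-End (δ-far ends h)

    other-End : ∀ {u y e} → δ ends (is u) e ≡ true → End y e → y ≢ u → y ≡ far ends u e
    other-End {u} {y} {e} h end ne with δ-ends ends {u} {e} h | end
    ... | inj₁ (p , _ , q) | inj₁ r = ⊥-elim (ne (trans r p))
    ... | inj₁ (p , _ , q) | inj₂ r = trans r (sym q)
    ... | inj₂ (p , _ , q) | inj₁ r = trans r (sym q)
    ... | inj₂ (p , _ , q) | inj₂ r = ⊥-elim (ne (trans r p))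

    -- g is a bipartition of W; the items with terminals on both sides cross it (cr).
    end : (Fin n → Bool) → Bool → Fin n → Bool
    end g b y = W y ∧ not (g y xor b)

    opaque
      touch : (Fin n → Bool) → Bool → Fin m → Bool
      touch g b ℓ = 0 <ᵇ count (λ e → is ℓ (lab e) ∧ (end g b (src ends e) ∨ end g b (tgt ends e)))

      touch-cong : ∀ {g g′} → g ≗ g′ → ∀ b ℓ → touch g b ℓ ≡ touch g′ b ℓ
      touch-cong h b ℓ = cong (0 <ᵇ_) (count-cong λ e → cong (is ℓ (lab e) ∧_)
        (cong₂ (λ p q → (W (src ends e) ∧ not (p xor b)) ∨ (W (tgt ends e) ∧ not (q xor b))) (h (src ends e)) (h (tgt ends e))))

      touch-intro : ∀ {g b ℓ e y} → lab e ≡ ℓ → End y e → W y ≡ true → g y ≡ b → touch g b ℓ ≡ true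
      touch-intro {g} {b} {ℓ} {e} {y} eq ye Wy gy = ≡true (<⇒<ᵇ (count-pos _ {e} (∧-true (is-true eq)
          ([ (λ { refl → ∨-trueˡ here }) , (λ { refl → ∨-trueʳ {end g b (src ends e)} here }) ]′ ye))))
        where
        here : end g b y ≡ true
        here = ∧-true Wy (not-false (≡-xor gy))

      touch-elim : ∀ {g b ℓ} → touch g b ℓ ≡ true → ∃ λ e → ∃ λ y → lab e ≡ ℓ × End y e × W y ≡ true × g y ≡ b
      touch-elim {g} {b} {ℓ} h with count-witness _ (<ᵇ⇒< 0 _ (T≡ h))
      ... | e , p with ∨-true {end g b (src ends e)} (∧-trueʳ {is ℓ (lab e)} p)
      ...   | inj₁ q = e , src ends e , is-≡ (∧-trueˡ p) , inj₁ refl , ∧-trueˡ q , xor-≡ (not-true (∧-trueʳ {W (src ends e)} q))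
      ...   | inj₂ q = e , tgt ends e , is-≡ (∧-trueˡ p) , inj₂ refl , ∧-trueˡ q , xor-≡ (not-true (∧-trueʳ {W (tgt ends e)} q))

    cr : (Fin n → Bool) → Fin m → Bool
    cr g ℓ = touch g true ℓ ∧ touch g false ℓ

    cr-touch : ∀ {g ℓ} b → cr g ℓ ≡ true → touch g b ℓ ≡ true
    cr-touch true  h = ∧-trueˡ h
    cr-touch {g} {ℓ} false h = ∧-trueʳ {touch g true ℓ} h

    End-live : ∀ {y e} → End y e → live ends e ≡ true → δ ends (is y) e ≡ true
    End-live (inj₁ refl) l = proj₁ (live-δ ends l)
    End-live (inj₂ refl) l = proj₂ (live-δ ends l)

    -- If Y avoids S, then it contains some u ∈ R, and all edges at u lead to S.
    large-cut : ∀ Y → Y v ≡ false → ∀ {u} → W u ≡ true → Y u ≡ true → K′ ≤ d ends Y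
    large-cut Y Yv {u} Wu Yu with Finₚ.any? (λ s → (S s Boolₚ.≟ true) ×-dec (Y s Boolₚ.≟ true))
    ... | yes (s , Ss , Ys) = ≤-trans K′≤K (cut Y ((s , Ss , Ys) , (v , v∈S , Yv)))
    ... | no none with ∨-true {S u} (∧-trueˡ Wu)
    ...   | inj₁ Su = ⊥-elim (none (u , Su , Yu))
    ...   | inj₂ Ru = ≤-trans (R-degree u Ru) (count-mono λ e h → trans (δ-at ends Y h)
                        (cong₂ _xor_ Yu (≢true λ q → none (far ends u e , proj₁ (tight-far Su h) , q))))
      where
      Su : S u ≡ false
      Su = ≢true λ p → none (u , p , Yu)

    ∑-fibres : (h : Fin m → ℕ) → ∑ h ≡ ∑ (λ ℓ → ∑ (λ e → ⟦ is ℓ (lab e) ⟧ * h e))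
    ∑-fibres h = sym (trans (∑-swap _) (∑-cong λ e → trans (∑-cong λ ℓ → cong (λ z → ⟦ z ⟧ * h e) (is-sym ℓ (lab e)))
      (∑-is (lab e) (λ _ → h e))))

    fibre-∅ : ∀ {ℓ} → lab ℓ ≢ ℓ → ∀ (h : Fin m → ℕ) → ∑ (λ e → ⟦ is ℓ (lab e) ⟧ * h e) ≡ 0
    fibre-∅ {ℓ} ne h = ∑-zero λ e → cong (λ z → ⟦ z ⟧ * h e) (is-≢ λ eq → ne (trans (cong lab (sym eq)) (trans (lab-idem e) eq)))

    fibre-∑≤ : ∀ {ℓ} (h : Fin m → ℕ) c → (∀ {x} → hub ℓ ≡ just x → h ℓ ≡ 0) → (∀ {e} → live ends e ≡ false → h e ≡ 0) →
      (∀ {e} → lab e ≡ ℓ → live ends e ≡ true → h e ≤ c) → lab ℓ ≡ ℓ → ∑ (λ e → ⟦ is ℓ (lab e) ⟧ * h e) ≤ 2 * c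
    fibre-∑≤ {ℓ} h c at-ℓ dead bound idem = by-hub (hub ℓ) refl
      where
      value : ∀ {e} b {x} → (is ℓ (lab e) ≡ true → h e ≤ x) → is ℓ (lab e) ≡ b → ⟦ b ⟧ * h e ≤ x
      value true  f p = ≤-trans (≤-reflexive (+-identityʳ _)) (f p)
      value false f p = z≤n
      by-hub : ∀ x → hub ℓ ≡ x → ∑ (λ e → ⟦ is ℓ (lab e) ⟧ * h e) ≤ 2 * c
      by-hub nothing hℓ = ≤-trans (∑-mono pointwise) (≤-trans (≤-reflexive (∑-is ℓ (λ _ → c))) (m≤m+n c _))
        where
        pointwise : ∀ e → ⟦ is ℓ (lab e) ⟧ * h e ≤ ⟦ is ℓ e ⟧ * c
        pointwise e = value (is ℓ (lab e)) (λ p → ≤-trans (le p) (≤-reflexive (sym (trans (cong (λ z → ⟦ z ⟧ * c) (is-true (fibre-nothing (is-≡ p) hℓ))) (+-identityʳ c))))) refl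
          where
          le : is ℓ (lab e) ≡ true → h e ≤ c
          le p with bool? (live ends e)
          ... | inj₁ l = bound (is-≡ p) l
          ... | inj₂ l = ≤-trans (≤-reflexive (dead l)) z≤n
      by-hub (just x) hℓ = +-cancelʳ-≤ c _ _ (≤-trans (≤-reflexive (cong (∑ (λ e → ⟦ is ℓ (lab e) ⟧ * h e) +_) (sym (∑-is ℓ (λ _ → c)))))
        (≤-trans (≤-reflexive (sym (∑-+ _ _))) (≤-trans (∑-mono pointwise) (≤-reflexive three))))
        where
        xℓ = hub-spec hℓ
        three : ∑ (λ e → c * ⟦ δ ends (is x) e ⟧) ≡ 2 * c + c
        three = trans (∑-* c _) (trans (cong (c *_) (degree-3 (proj₁ xℓ) (proj₂ xℓ))) (arith c))
          where
          arith : ∀ c → c * 3 ≡ 2 * c + c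
          arith c = solve (c ∷ [])
        pointwise : ∀ e → ⟦ is ℓ (lab e) ⟧ * h e + ⟦ is ℓ e ⟧ * c ≤ c * ⟦ δ ends (is x) e ⟧
        pointwise e with e ≟ ℓ
        ... | yes refl = ≤-trans (≤-reflexive (cong₂ _+_ (trans (cong (⟦ is e (lab e) ⟧ *_) (at-ℓ hℓ)) (*-zeroʳ ⟦ is e (lab e) ⟧)) (+-identityʳ c)))
                (≤-reflexive (sym (trans (cong (λ z → c * ⟦ z ⟧) (proj₂ xℓ)) (*-identityʳ c))))
        ... | no ne = ≤-trans (≤-reflexive (+-identityʳ _)) (value (is ℓ (lab e)) le refl)
          where
          le : is ℓ (lab e) ≡ true → h e ≤ c * ⟦ δ ends (is x) e ⟧
          le p with bool? (live ends e)
          ... | inj₂ l = ≤-trans (≤-reflexive (dead l)) z≤n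
          ... | inj₁ l = ≤-trans (bound (is-≡ p) l) (≤-reflexive (sym (trans (cong (λ z → c * ⟦ z ⟧) (fibre-hub (is-≡ p) l hℓ)) (*-identityʳ c))))

    module Crude (E : Fin m → Bool) (E-free : ∀ ℓ → E ℓ ≡ true → free ℓ ≡ true) where
      ℒ = labelling link (E ∘ lab)
      open Labelling ℒ public

      t : ℕ
      t = count (λ z → W z ∧ is z (L z))

      E-edge : ∀ {e} → E (lab e) ≡ true → live ends e ≡ true → W (ψ (src ends e)) ≡ true × W (ψ (tgt ends e)) ≡ true
      E-edge h = free-link (E-free _ h)

      dead-link : ∀ {e} → live ends e ≡ false → ψ (src ends e) ≡ ψ (tgt ends e)
      dead-link l = cong ψ (dead-ends l)

      L-edge : ∀ {e} → E (lab e) ≡ true → L (ψ (src ends e)) ≡ L (ψ (tgt ends e))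
      L-edge {e} h = closed (e , h , refl)

      W-L : ∀ y → W (L y) ≡ W y
      W-L = universal W λ { (e , h , refl) → [ (λ l → trans (proj₁ (E-edge h l)) (sym (proj₂ (E-edge h l)))) , (λ l → cong W (dead-link l)) ]′ (bool? (live ends e)) }

      L-outside : ∀ {z} → W z ≡ false → L z ≡ z
      L-outside {z} Wz = is-≡ (trans (universal (is z) (λ { {a} {b} (e , h , refl) →
          [ (λ l → trans (is-≢ (away (proj₁ (E-edge h l)))) (sym (is-≢ (away (proj₂ (E-edge h l))))))
          , (λ l → cong (is z) (dead-link l)) ]′ (bool? (live ends e)) }) z) (is-refl z))
        where
        away : ∀ {y} → W y ≡ true → y ≢ z
        away p refl = true≢false p Wz

      β : Fin m → ℕ
      β e = if is (L (ψ (src ends e))) (L (ψ (tgt ends e))) then 0 else ⟦ W (ψ (src ends e)) ⟧ + ⟦ W (ψ (tgt ends e)) ⟧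

      β-0 : ∀ {e} → L (ψ (src ends e)) ≡ L (ψ (tgt ends e)) → β e ≡ 0
      β-0 p rewrite is-true (sym p) = refl

      β-≤ : ∀ e {c} → ⟦ W (ψ (src ends e)) ⟧ + ⟦ W (ψ (tgt ends e)) ⟧ ≤ c → β e ≤ c
      β-≤ e le with is (L (ψ (src ends e))) (L (ψ (tgt ends e)))
      ... | true  = z≤n
      ... | false = le

      root : Fin n → Bool
      root z = W z ∧ is z (L z)

      Y : Fin n → Fin n → Bool
      Y z y = is z (L (ψ y))

      K′≤Y : ∀ {z} → root z ≡ true → K′ ≤ d ends (Y z)
      K′≤Y {z} h = large-cut (Y z) (is-≢ Lv) {z} Wz (is-true (trans (cong L (ψ-id (W-B Wz))) (is-≡ (∧-trueʳ {W z} h))))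
        where
        Wz = ∧-trueˡ h
        Lv : L (ψ v) ≢ z
        Lv eq = true≢false (trans (cong W eq) Wz) (trans (cong (W ∘ L) (ψ-id (S-B v∈S))) (trans (W-L v) Wv))

      components≤β : K′ * t ≤ ∑ β
      components≤β = ≤-trans (≤-reflexive (sym (∑-* K′ _))) (≤-trans (∑-mono by-root) (≤-trans (≤-reflexive (∑-swap _)) (∑-mono by-edge)))
        where
        by-root : ∀ z → K′ * ⟦ root z ⟧ ≤ ∑ (λ e → ⟦ root z ⟧ * ⟦ δ ends (Y z) e ⟧)
        by-root z = ≤-trans (go (root z) refl) (≤-reflexive (sym (∑-* ⟦ root z ⟧ _)))
          where
          go : ∀ b → root z ≡ b → K′ * ⟦ b ⟧ ≤ ⟦ b ⟧ * d ends (Y z)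
          go false h = ≤-reflexive (*-zeroʳ K′)
          go true  h = ≤-trans (≤-reflexive (*-identityʳ K′)) (≤-trans (K′≤Y h) (≤-reflexive (sym (*-identityˡ _))))
        by-edge : ∀ e → ∑ (λ z → ⟦ root z ⟧ * ⟦ δ ends (Y z) e ⟧) ≤ β e
        by-edge e = split (L (ψ (src ends e)) ≟ L (ψ (tgt ends e)))
          where
          a = L (ψ (src ends e))
          b = L (ψ (tgt ends e))
          split : Dec (a ≡ b) → ∑ (λ z → ⟦ root z ⟧ * ⟦ δ ends (Y z) e ⟧) ≤ β e
          split (yes p) = ≤-trans (≤-reflexive (∑-zero λ z → trans (cong (λ w → ⟦ root z ⟧ * ⟦ w ⟧) (≡-xor (cong (is z) p))) (*-zeroʳ ⟦ root z ⟧))) z≤n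
          split (no ne) = ≤-trans (∑-mono pointwise) (≤-trans (≤-reflexive (trans (∑-+ _ _) (cong₂ _+_ (∑-is a _) (∑-is b _))))
              (≤-reflexive (trans (cong₂ _+_ (cong ⟦_⟧ (W-L _)) (cong ⟦_⟧ (W-L _))) (sym (cong (λ z → if z then 0 else _) (is-≢ (ne ∘ sym)))))))
            where
            pointwise : ∀ z → ⟦ root z ⟧ * ⟦ is z a xor is z b ⟧ ≤ ⟦ is a z ⟧ * ⟦ W z ⟧ + ⟦ is b z ⟧ * ⟦ W z ⟧
            pointwise z rewrite is-sym a z | is-sym b z =
              b≤ (by-cases 4 (λ w r p q → ⟦ w ∧ r ⟧ * ⟦ p xor q ⟧ ≤ᵇ ⟦ p ⟧ * ⟦ w ⟧ + ⟦ q ⟧ * ⟦ w ⟧) _ (W z) (is z (L z)) (is z a) (is z b))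

      hub-β : ∀ {ℓ x} → hub ℓ ≡ just x → lab ℓ ≡ ℓ → β ℓ ≡ 0
      hub-β {ℓ} {x} hℓ idem = β-0 (cong L (same (link-hub (proj₁ (hub-spec hℓ)) (proj₂ (hub-spec hℓ)))))
        where
        same : (link ℓ ≡ (far ends x (lab ℓ) , far ends x ℓ)) ⊎ (link ℓ ≡ (far ends x ℓ , far ends x (lab ℓ))) → ψ (src ends ℓ) ≡ ψ (tgt ends ℓ)
        same (inj₁ p) = trans (cong proj₁ p) (trans (cong (far ends x) idem) (sym (cong proj₂ p)))
        same (inj₂ p) = trans (cong proj₁ p) (trans (cong (far ends x) (sym idem)) (sym (cong proj₂ p)))

      v-link : ∀ {e} → ∂v (lab e) ≡ true → live ends e ≡ true → W (ψ (src ends e)) ≡ false ⊎ W (ψ (tgt ends e)) ≡ false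
      v-link {e} hv l with hub-view e
      ... | inj₁ p = at (δ-ends ends {v} {e} (subst (λ z → ∂v z ≡ true) (lab-nothing p) hv))
        where
        Wψv : ∀ {y} → y ≡ v → W (ψ y) ≡ false
        Wψv refl = trans (cong W (ψ-id (S-B v∈S))) Wv
        at : _ ⊎ _ → W (ψ (src ends e)) ≡ false ⊎ W (ψ (tgt ends e)) ≡ false
        at (inj₁ (q , _)) = inj₁ (Wψv q)
        at (inj₂ (q , _)) = inj₂ (Wψv q)
      ... | inj₂ (x , p , h) = which (link-hub p h)
        where
        far≡v : far ends x (lab e) ≡ v
        far≡v = ∂v-far (B-v p) (lab-at p h) hv
        which : _ ⊎ _ → W (ψ (src ends e)) ≡ false ⊎ W (ψ (tgt ends e)) ≡ false
        which (inj₁ q) = inj₁ (trans (cong (W ∘ proj₁) q) (trans (cong W far≡v) Wv))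
        which (inj₂ q) = inj₂ (trans (cong (W ∘ proj₂) q) (trans (cong W far≡v) Wv))

      item-bound : ∀ ℓ → ∑ (λ e → ⟦ is ℓ (lab e) ⟧ * β e) ≤ 4 * ⟦ free ℓ ∧ not (E ℓ) ⟧ + 2 * ⟦ ∂v ℓ ⟧
      item-bound ℓ = go (lab ℓ ≟ ℓ) (bool? (∂v ℓ)) (bool? (E ℓ))
        where
        Σβ = ∑ (λ e → ⟦ is ℓ (lab e) ⟧ * β e)
        bounded : ∀ c → (∀ {e} → lab e ≡ ℓ → live ends e ≡ true → β e ≤ c) → lab ℓ ≡ ℓ → Σβ ≤ 2 * c
        bounded c f idem = fibre-∑≤ β c (λ h → hub-β h idem) (β-0 ∘ cong L ∘ dead-link) f idem
        one : ∂v ℓ ≡ true → ∀ {e} → lab e ≡ ℓ → live ends e ≡ true → β e ≤ 1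
        one hv {e} refl l = β-≤ e ([ (λ p → subst (λ z → ⟦ z ⟧ + ⟦ W (ψ (tgt ends e)) ⟧ ≤ 1) (sym p) (⟦⟧≤1 (W (ψ (tgt ends e)))))
                                   , (λ p → subst (λ z → ⟦ W (ψ (src ends e)) ⟧ + ⟦ z ⟧ ≤ 1) (sym p)
                                       (≤-trans (≤-reflexive (+-identityʳ _)) (⟦⟧≤1 (W (ψ (src ends e)))))) ]′ (v-link {e} hv l))
        none : E ℓ ≡ true → ∀ {e} → lab e ≡ ℓ → live ends e ≡ true → β e ≤ 0
        none hE refl l = ≤-reflexive (β-0 (L-edge hE))
        go : Dec (lab ℓ ≡ ℓ) → ∂v ℓ ≡ true ⊎ ∂v ℓ ≡ false → E ℓ ≡ true ⊎ E ℓ ≡ false → Σβ ≤ 4 * ⟦ free ℓ ∧ not (E ℓ) ⟧ + 2 * ⟦ ∂v ℓ ⟧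
        go (no ne)    _         _         = ≤-trans (≤-reflexive (fibre-∅ ne β)) z≤n
        go (yes idem) (inj₁ hv) _         = ≤-trans (bounded 1 (one hv) idem) (≤-trans (≤-reflexive (cong (λ z → 2 * ⟦ z ⟧) (sym hv))) (m≤n+m (2 * ⟦ ∂v ℓ ⟧) (4 * ⟦ free ℓ ∧ not (E ℓ) ⟧)))
        go (yes idem) (inj₂ hv) (inj₁ hE) = ≤-trans (bounded 0 (none hE) idem) z≤n
        go (yes idem) (inj₂ hv) (inj₂ hE) = ≤-trans (bounded 2 (λ {e} _ l → β-≤ e (+-mono-≤ (⟦⟧≤1 (W (ψ (src ends e)))) (⟦⟧≤1 (W (ψ (tgt ends e)))))) idem)
          (≤-trans (≤-reflexive (cong (λ z → 4 * ⟦ z ⟧) (sym (∧-true (∧-true (is-true {u = ℓ} idem) (not-false hv)) (not-false hE))))) (m≤m+n (4 * ⟦ free ℓ ∧ not (E ℓ) ⟧) (2 * ⟦ ∂v ℓ ⟧)))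

      crude : K′ * t ≤ 4 * count (λ ℓ → free ℓ ∧ not (E ℓ)) + 2 * K
      crude = ≤-trans components≤β (≤-trans (≤-reflexive (∑-fibres β)) (≤-trans (∑-mono item-bound)
        (≤-reflexive (trans (∑-+ _ _) (cong₂ _+_ (∑-* 4 _) (trans (∑-* 2 _) (cong (2 *_) degree-v)))))))

    crossings : (Fin n → Bool) → ℕ
    crossings g = count (free ∩ᵇ cr g)

    v-crossings : (Fin n → Bool) → ℕ
    v-crossings g = count (∂v ∩ᵇ cr g)

    cr-false : ∀ {g ℓ} → (∃ λ b → ∀ {y} → W y ≡ true → g y ≢ b) → cr g ℓ ≡ false
    cr-false {g} {ℓ} (b , none) = ≢true λ h → let e , y , _ , _ , Wy , gy = touch-elim (cr-touch {g} {ℓ} b h) in none Wy gy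

    -- Both sides of the partition g, each hub put on the side of the majority of its edges.
    module Majority (g : Fin n → Bool) where

      to : Bool → Fin n → Fin m → Bool
      to b x e = δ ends (is x) e ∧ end g b (far ends x e)

      side : Bool → Fin n → Bool
      side b y = if B y then 2 ≤ᵇ count (to b y) else end g b y

      side-W : ∀ {b y} → B y ≡ false → side b y ≡ end g b y
      side-W h rewrite h = refl

      side-B : ∀ {b y} → B y ≡ true → side b y ≡ (2 ≤ᵇ count (to b y))
      side-B h rewrite h = refl

      side-v : ∀ b → side b v ≡ false
      side-v b = trans (side-W (S-B v∈S)) (cong (_∧ not (g v xor b)) Wv)

      H : Fin m → ℕ
      H e = ⟦ δ ends (side true) e ⟧ + ⟦ δ ends (side false) e ⟧

      H-dead : ∀ {e} → live ends e ≡ false → H e ≡ 0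
      H-dead l = cong₂ (λ p q → ⟦ p ⟧ + ⟦ q ⟧) (≡-xor (cong (side true) (dead-ends l))) (≡-xor (cong (side false) (dead-ends l)))

      RHS : Fin m → ℕ
      RHS ℓ = 2 * ⟦ (free ∩ᵇ cr g) ℓ ⟧ + (⟦ ∂v ℓ ⟧ + ⟦ (∂v ∩ᵇ cr g) ℓ ⟧)

      plain : ∀ {ℓ} → lab ℓ ≡ ℓ → hub ℓ ≡ nothing → H ℓ ≤ RHS ℓ
      plain {ℓ} idem hℓ with bool? (live ends ℓ)
      ... | inj₂ l = ≤-trans (≤-reflexive (H-dead l)) z≤n
      ... | inj₁ l = ≤-trans (≤-reflexive (cong₂ (λ p q → ⟦ p ⟧ + ⟦ q ⟧) (cong₂ _xor_ (side-W Bs) (side-W Bt)) (cong₂ _xor_ (side-W Bs) (side-W Bt))))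
          (≤-trans (b≤ (by-cases 4 (λ ws gs wt gt → ⟦ (ws ∧ not (gs xor true)) xor (wt ∧ not (gt xor true)) ⟧ + ⟦ (ws ∧ not (gs xor false)) xor (wt ∧ not (gt xor false)) ⟧
              ≤ᵇ 2 * ⟦ ws ∧ wt ∧ (gs xor gt) ⟧ + ⟦ ws xor wt ⟧) _ (W s) (g s) (W t) (g t)))
            (+-mono-≤ (*-monoʳ-≤ 2 (⟦⟧-mono crossing)) (≤-trans (⟦⟧-mono at-v) (m≤m+n _ _))))
        where
        s = src ends ℓ
        t = tgt ends ℓ
        Bs = proj₁ (hub-nothing hℓ l)
        Bt = proj₂ (hub-nothing hℓ l)
        ne : s ≢ t
        ne q = is-false (not-true l) (sym q)
        at-v : W s xor W t ≡ true → ∂v ℓ ≡ true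
        at-v h with bool? (W s) | bool? (W t)
        ... | inj₂ p | _      = src-δ ends (not-W Bs p) (λ q → ne (trans (not-W Bs p) (sym q)))
        ... | inj₁ p | inj₂ q = tgt-δ ends (not-W Bt q) (W-v p)
        ... | inj₁ p | inj₁ q = ⊥-elim (xor-≢ h (trans p (sym q)))
        crossing : W s ∧ W t ∧ (g s xor g t) ≡ true → (free ∩ᵇ cr g) ℓ ≡ true
        crossing h = ∧-true (∧-true (is-true idem) (not-false (cong₂ _xor_ (is-≢ (W-v Ws)) (is-≢ (W-v Wt))))) (sides (g s) refl (g t) refl)
          where
          Ws : W s ≡ true
          Ws = ∧-trueˡ h
          Wt : W t ≡ true
          Wt = ∧-trueˡ (∧-trueʳ {W s} h)
          gst : g s xor g t ≡ true
          gst = ∧-trueʳ {W t} (∧-trueʳ {W s} h)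
          sides : ∀ a → g s ≡ a → ∀ b → g t ≡ b → cr g ℓ ≡ true
          sides true  p false q = ∧-true (touch-intro idem (inj₁ refl) Ws p) (touch-intro idem (inj₂ refl) Wt q)
          sides false p true  q = ∧-true (touch-intro idem (inj₂ refl) Wt q) (touch-intro idem (inj₁ refl) Ws p)
          sides true  p true  q = ⊥-elim (xor-≢ gst (trans p (sym q)))
          sides false p false q = ⊥-elim (xor-≢ gst (trans p (sym q)))

      module AtHub {ℓ x} (idem : lab ℓ ≡ ℓ) (hℓ : hub ℓ ≡ just x) where
        Bx = proj₁ (hub-spec hℓ)
        xℓ = proj₂ (hub-spec hℓ)

        ∂ : Fin m → Bool
        ∂ = δ ends (is x)

        neither : Fin m → Bool
        neither e = ∂ e ∧ not (W (far ends x e))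

        far-v : ∀ {e} → ∂ e ≡ true → W (far ends x e) ≡ false → far ends x e ≡ v
        far-v h p = not-W (S-B (B-far Bx h)) p

        three-kinds : count (to true x) + count (to false x) + count neither ≡ 3
        three-kinds = trans (cong (_+ count neither) (sym (∑-+ _ _))) (trans (sym (∑-+ _ _)) (trans (∑-cong pointwise) (degree-3 Bx xℓ)))
          where
          pointwise : ∀ e → ⟦ to true x e ⟧ + ⟦ to false x e ⟧ + ⟦ neither e ⟧ ≡ ⟦ ∂ e ⟧
          pointwise e = kinds (∂ e) (W (far ends x e)) (g (far ends x e))
            where
            kinds : ∀ p w g → ⟦ p ∧ (w ∧ not (g xor true)) ⟧ + ⟦ p ∧ (w ∧ not (g xor false)) ⟧ + ⟦ p ∧ not w ⟧ ≡ ⟦ p ⟧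
            kinds false w     g     = refl
            kinds true  false g     = refl
            kinds true  true  true  = refl
            kinds true  true  false = refl

        neither-v : count neither ≡ ⟦ ∂v ℓ ⟧
        neither-v = by (∂v ℓ) refl
          where
          to-v : ∀ {e} → neither e ≡ true → ∂v e ≡ true
          to-v {e} h = far-∂v (B-v Bx) (∧-trueˡ h) (far-v (∧-trueˡ h) (not-true (∧-trueʳ {∂ e} h)))
          by : ∀ b → ∂v ℓ ≡ b → count neither ≡ ⟦ b ⟧
          by false h = ∑-zero λ e → cong ⟦_⟧ (≢true λ p → true≢false (rep-v (trans (rep-lab Bx xℓ) (cong just idem)) (∧-trueˡ p) (to-v p)) h)
          by true  h = trans (∑-cong λ e → cong ⟦_⟧ (only e)) (∑-is-1 ℓ)
            where
            only : ∀ e → neither e ≡ is ℓ e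
            only e with e ≟ ℓ
            ... | yes refl = ∧-true xℓ (not-false (trans (cong W (∂v-far (B-v Bx) xℓ h)) Wv))
            ... | no ne    = ≢true λ p → ne (v-edge-unique Bx (∧-trueˡ p) xℓ (to-v p) h)

        touching : ∀ b → 1 ≤ count (to b x) → touch g b ℓ ≡ true
        touching b h with count-witness (to b x) h
        ... | e , p = touch-intro (trans (lab-same Bx (∧-trueˡ p) xℓ) idem) (far-End (∧-trueˡ p)) (∧-trueˡ q) (xor-≡ (not-true (∧-trueʳ {W (far ends x e)} q)))
          where
          q : end g b (far ends x e) ≡ true
          q = ∧-trueʳ {∂ e} p

        H-∂ : ∑ (λ e → ⟦ ∂ e ⟧ * H e) ≡ (if 2 ≤ᵇ count (to true x) then count (to false x) + ⟦ ∂v ℓ ⟧ else count (to true x))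
                                     + (if 2 ≤ᵇ count (to false x) then count (to true x) + ⟦ ∂v ℓ ⟧ else count (to false x))
        H-∂ = trans (∑-cong λ e → *-distribˡ-+ ⟦ ∂ e ⟧ _ _) (trans (∑-+ _ _) (cong₂ _+_
                (trans (∑-cong (at true)) (trans (by true (2 ≤ᵇ count (to true x))) (cong (λ z → if 2 ≤ᵇ count (to true x) then count (to false x) + z else count (to true x)) neither-v)))
                (trans (∑-cong (at false)) (trans (by false (2 ≤ᵇ count (to false x))) (cong (λ z → if 2 ≤ᵇ count (to false x) then count (to true x) + z else count (to false x)) neither-v)))))
          where
          at : ∀ b e → ⟦ ∂ e ⟧ * ⟦ δ ends (side b) e ⟧ ≡ ⟦ ∂ e ∧ ((2 ≤ᵇ count (to b x)) xor end g b (far ends x e)) ⟧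
          at b e = go (∂ e) refl
            where
            go : ∀ p → ∂ e ≡ p → ⟦ p ⟧ * ⟦ δ ends (side b) e ⟧ ≡ ⟦ p ∧ ((2 ≤ᵇ count (to b x)) xor end g b (far ends x e)) ⟧
            go false h = refl
            go true  h = trans (+-identityʳ _) (cong ⟦_⟧ (trans (δ-at ends (side b) h) (cong₂ _xor_ (side-B Bx) (side-W (S-B (B-far Bx h))))))
          by : ∀ b c → ∑ (λ e → ⟦ ∂ e ∧ (c xor end g b (far ends x e)) ⟧) ≡ (if c then count (to (not b) x) + count neither else count (to b x))
          by b false = refl
          by b true  = trans (∑-cong λ e → kinds b (∂ e) (W (far ends x e)) (g (far ends x e))) (∑-+ _ _)
            where
            kinds : ∀ b p w g → ⟦ p ∧ not (w ∧ not (g xor b)) ⟧ ≡ ⟦ p ∧ (w ∧ not (g xor not b)) ⟧ + ⟦ p ∧ not w ⟧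
            kinds b     false w     g     = refl
            kinds b     true  false g     = refl
            kinds true  true  true  true  = refl
            kinds true  true  true  false = refl
            kinds false true  true  true  = refl
            kinds false true  true  false = refl

        bound : ∑ (λ e → ⟦ is ℓ (lab e) ⟧ * H e) ≤ RHS ℓ
        bound = ≤-trans (∑-mono pointwise) (≤-trans (≤-reflexive H-∂) (≤-trans
            (majority-numbers (∂v ℓ) (cr g ℓ) _ _ (trans (cong (_ +_) (sym neither-v)) three-kinds) (λ p q → ∧-true (touching true p) (touching false q)))
            (≤-reflexive (cong (λ z → 2 * ⟦ (z ∧ not (∂v ℓ)) ∧ cr g ℓ ⟧ + (⟦ ∂v ℓ ⟧ + ⟦ (∂v ∩ᵇ cr g) ℓ ⟧)) (sym (is-true {u = ℓ} idem))))))
          where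
          pointwise : ∀ e → ⟦ is ℓ (lab e) ⟧ * H e ≤ ⟦ ∂ e ⟧ * H e
          pointwise e with bool? (live ends e)
          ... | inj₂ l rewrite H-dead l = ≤-reflexive (trans (*-zeroʳ ⟦ is ℓ (lab e) ⟧) (sym (*-zeroʳ ⟦ ∂ e ⟧)))
          ... | inj₁ l = *-monoˡ-≤ (H e) (⟦⟧-mono λ p → fibre-hub (is-≡ p) l hℓ)

      item : ∀ ℓ → ∑ (λ e → ⟦ is ℓ (lab e) ⟧ * H e) ≤ RHS ℓ
      item ℓ = go (lab ℓ ≟ ℓ) (hub ℓ) refl
        where
        go : Dec (lab ℓ ≡ ℓ) → ∀ h → hub ℓ ≡ h → ∑ (λ e → ⟦ is ℓ (lab e) ⟧ * H e) ≤ RHS ℓ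
        go (no ne)    _        _  = ≤-trans (≤-reflexive (fibre-∅ ne H)) z≤n
        go (yes idem) (just x) hℓ = AtHub.bound idem hℓ
        go (yes idem) nothing  hℓ = ≤-trans (∑-mono pointwise) (≤-trans (≤-reflexive (∑-is ℓ (λ _ → H ℓ))) (plain idem hℓ))
          where
          pointwise : ∀ e → ⟦ is ℓ (lab e) ⟧ * H e ≤ ⟦ is ℓ e ⟧ * H ℓ
          pointwise e = by (is ℓ (lab e)) refl
            where
            by : ∀ b → is ℓ (lab e) ≡ b → ⟦ b ⟧ * H e ≤ ⟦ is ℓ e ⟧ * H ℓ
            by false p = z≤n
            by true  p = ≤-reflexive (same (fibre-nothing (is-≡ p) hℓ))
              where
              same : e ≡ ℓ → 1 * H e ≡ ⟦ is ℓ e ⟧ * H ℓ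
              same refl = cong (λ z → ⟦ z ⟧ * H e) (sym (is-refl e))

      majority : d ends (side true) + d ends (side false) ≤ 2 * crossings g + (K + v-crossings g)
      majority = ≤-trans (≤-reflexive (sym (∑-+ _ _))) (≤-trans (≤-reflexive (∑-fibres H)) (≤-trans (∑-mono item)
        (≤-reflexive (trans (∑-+ _ _) (cong₂ _+_ (∑-* 2 _) (trans (∑-+ _ _) (cong (_+ v-crossings g) degree-v)))))))

      side-witness : ∀ {b y} → W y ≡ true → g y ≡ b → side b y ≡ true
      side-witness Wy gy = trans (side-W (W-B Wy)) (∧-true Wy (not-false (≡-xor gy)))

    N : ℕ
    N = k + k

    N-suc : ∃ λ n → N ≡ suc n
    N-suc = double k 1≤k
      where
      double : ∀ k → 1 ≤ k → ∃ λ n → k + k ≡ suc n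
      double (suc k) _ = k + suc k , refl

    1≤N : 1 ≤ N
    1≤N = ≤-trans 1≤k (m≤m+n k k)

    all : Fin m → Bool
    all _ = true

    record Trees (g : Fin n → Bool) : Set where
      field
        C         : Fin m → Maybe (Fin N)
        C-free    : ∀ {ℓ j} → C ℓ ≡ just j → free ℓ ≡ true × cr g ℓ ≡ false
        connected : ∀ j (f : Fin n → Bool) → (∀ e → C (lab e) ≡ just j → f (ψ (src ends e)) ≡ f (ψ (tgt ends e))) →
                    ∀ {y z} → W y ≡ true → W z ≡ true → g y ≡ g z → f y ≡ f z

    module Run (g : Fin n → Bool) where
      U : Fin m → Bool
      U = free ∖ cr g

      U-free : ∀ A ℓ → (U ∩ᵇ A) ℓ ≡ true → free ℓ ≡ true
      U-free A ℓ h = ∧-trueˡ {free ℓ} (∧-trueˡ h)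

      module C A = Crude (U ∩ᵇ A) (U-free A)

      κ : (Fin m → Bool) → ℕ
      κ A = components link ((U ∩ᵇ A) ∘ lab)

      κ-t : ∀ A → κ A ≡ C.t A + count (not ∘ W)
      κ-t A = trans (∑-cong pointwise) (∑-+ _ _)
        where
        pointwise : ∀ z → ⟦ is z (C.L A z) ⟧ ≡ ⟦ W z ∧ is z (C.L A z) ⟧ + ⟦ not (W z) ⟧
        pointwise z with W z in eq
        ... | true  = sym (+-identityʳ _)
        ... | false = cong ⟦_⟧ (is-true (C.L-outside A eq))

      κ-supermodular : Supermodular κ
      κ-supermodular = ∘-supermodular (components-supermodular link) lab (U ∘ lab)

      module _ (τ : ℕ) (few : ∀ A → N * C.t A ≤ count (U ∖ A) + N * τ) (τ≤ : τ ≤ C.t all)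
               (classes : C.t all ≤ τ → ∀ {y z} → W y ≡ true → W z ≡ true → g y ≡ g z → C.L all y ≡ C.L all z) where

        t-all≤τ : C.t all ≤ τ
        t-all≤τ = *-cancelˡ-≤ N {{>-nonZero 1≤N}} (≤-trans (few all) (≤-reflexive (cong (_+ N * τ) (∑-zero λ ℓ → cong ⟦_⟧ (Boolₚ.∧-zeroʳ (U ℓ))))))

        enough : ∀ A → N * κ A ≤ count (U ∖ A) + N * κ all
        enough A = ≤-trans (≤-reflexive (trans (cong (N *_) (κ-t A)) (*-distribˡ-+ N _ _)))
          (≤-trans (+-monoˡ-≤ (N * count (not ∘ W)) (≤-trans (few A) (+-monoʳ-≤ (count (U ∖ A)) (*-monoʳ-≤ N τ≤))))
            (≤-reflexive (trans (+-assoc (count (U ∖ A)) _ _) (cong (count (U ∖ A) +_) (trans (sym (*-distribˡ-+ N _ _)) (cong (N *_) (sym (κ-t all))))))))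

        module Pk = Packing κ κ-supermodular N (κ all) (λ A → Supermodular.antitone κ-supermodular {A} {all} (λ _ _ → refl))

        trees : Trees g
        trees = build (Pk.pack (proj₂ N-suc) U enough)
          where
          build : Pk.Packed U → Trees g
          build (C′ , C′⊆U , κ≤) = record
            { C = C′
            ; C-free = λ {ℓ} {j} h → ∧-trueˡ (C′⊆U ℓ j h) , not-true (∧-trueʳ {free ℓ} (C′⊆U ℓ j h))
            ; connected = λ j f closed {y} {z} Wy Wz gyz → trans (sym (along j f closed y)) (trans (cong f (classes t-all≤τ Wy Wz gyz)) (along j f closed z)) }
            where
            along : ∀ j (f : Fin n → Bool) → (∀ e → C′ (lab e) ≡ just j → f (ψ (src ends e)) ≡ f (ψ (tgt ends e))) → ∀ y → f (C.L all y) ≡ f y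
            along j f closed y = trans (cong f (sym (same y)))
              (Labelling.universal ℓ₁ f (λ { (e , h , refl) → closed e (hasColour-≡ (∧-trueʳ {U (lab e)} h)) }) y)
              where
              ℓ₁ = labelling link ((U ∩ᵇ class C′ j) ∘ lab)
              same : ∀ y → Labelling.L ℓ₁ y ≡ C.L all y
              same = same-roots⇒same-labels ℓ₁ (C.ℒ all) (λ { (e , h , p) → e , ∧-true (∧-trueˡ h) refl , p }) (κ≤ j)

      root-of : ∀ A {y} → W y ≡ true → W (C.L A y) ∧ is (C.L A y) (C.L A (C.L A y)) ≡ true
      root-of A {y} Wy = ∧-true (trans (C.W-L A y) Wy) (is-true (C.idempotent A y))

      g-L : ∀ A {y} → W y ≡ true → g (C.L A y) ≡ g y
      g-L A {y} Wy = xor-≡ (not-true (∧-trueʳ {W (C.L A y)} (trans (C.universal A inside closed y) (∧-true Wy (not-false (≡-xor {g y} refl))))))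
        where
        inside : Fin n → Bool
        inside z = W z ∧ not (g z xor g y)
        closed : ∀ {a b} → Edges link ((U ∩ᵇ A) ∘ lab) a b → inside a ≡ inside b
        closed (e , h , refl) with bool? (live ends e)
        ... | inj₂ l = cong inside (C.dead-link A l)
        ... | inj₁ l = cong₂ (λ p q → p ∧ not (q xor g y)) (trans (proj₁ ww) (sym (proj₂ ww))) (same (g (ψ (src ends e))) refl (g (ψ (tgt ends e))) refl)
          where
          ww = C.E-edge A h l
          uncrossed : cr g (lab e) ≡ false
          uncrossed = not-true (∧-trueʳ {free (lab e)} (∧-trueˡ h))
          reach : ∀ {y} → End y e → W (ψ y) ≡ true → ∀ b → g (ψ y) ≡ b → touch g b (lab e) ≡ true
          reach {y} ye Wψ b gψ with bool? (B y)
          ... | inj₂ By = touch-intro refl ye (trans (cong W (sym (ψ-id By))) Wψ) (trans (cong g (sym (ψ-id By))) gψ)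
          ... | inj₁ By = touch-intro (lab-idem e) (far-End (lab-at By ye′)) (trans (cong W (sym (ψ-hub By ye′))) Wψ) (trans (cong g (sym (ψ-hub By ye′))) gψ)
            where
            ye′ : δ ends (is y) e ≡ true
            ye′ = End-live ye l
          same : ∀ a → g (ψ (src ends e)) ≡ a → ∀ b → g (ψ (tgt ends e)) ≡ b → g (ψ (src ends e)) ≡ g (ψ (tgt ends e))
          same true  p true  q = trans p (sym q)
          same false p false q = trans p (sym q)
          same true  p false q = ⊥-elim (true≢false (∧-true (reach (inj₁ refl) (proj₁ ww) true p) (reach (inj₂ refl) (proj₂ ww) false q)) uncrossed)
          same false p true  q = ⊥-elim (true≢false (∧-true (reach (inj₂ refl) (proj₂ ww) true q) (reach (inj₁ refl) (proj₁ ww) false p)) uncrossed)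

      many : crossings g ≤ N → ∀ A → 3 ≤ C.t A → N * C.t A ≤ count (U ∖ A) + N * 1
      many fg A t≥3 = ≤-trans (many-components k r (C.t A) (count (U ∖ A)) (crossings g)
          (subst₂ (λ a b → a * C.t A ≤ 4 * (count (U ∖ A) + crossings g) + 2 * b) K′-eq K-eq
            (≤-trans (C.crude A) (+-monoˡ-≤ (2 * K) (*-monoʳ-≤ 4 (≤-trans (∑-mono pointwise) (≤-reflexive (∑-+ _ _)))))))
          fg t≥3) (≤-reflexive (cong (count (U ∖ A) +_) (sym (*-identityʳ N))))
        where
        pointwise : ∀ ℓ → ⟦ free ℓ ∧ not ((U ∩ᵇ A) ℓ) ⟧ ≤ ⟦ (U ∖ A) ℓ ⟧ + ⟦ (free ∩ᵇ cr g) ℓ ⟧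
        pointwise ℓ = b≤ (by-cases 3 (λ f c a → ⟦ f ∧ not ((f ∧ not c) ∧ a) ⟧ ≤ᵇ ⟦ (f ∧ not c) ∧ not a ⟧ + ⟦ f ∧ c ⟧) _ (free ℓ) (cr g ℓ) (A ℓ))

    BothSides : (Fin n → Bool) → Set
    BothSides g = ∀ b → ∃ λ y → W y ≡ true × g y ≡ b

    -- Few free items cross g: the trees are packed inside the two classes.
    trees-A : ∀ g → BothSides g → crossings g ≤ N → Trees g
    trees-A g both fg = trees 2 few two classes
      where
      open Run g
      few : ∀ A → N * C.t A ≤ count (U ∖ A) + N * 2
      few A with 3 ≤? C.t A
      ... | yes t≥3 = ≤-trans (many fg A t≥3) (+-monoʳ-≤ (count (U ∖ A)) (*-monoʳ-≤ N (s≤s z≤n)))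
      ... | no t≱3  = ≤-trans (*-monoʳ-≤ N (≤-pred (≰⇒> t≱3))) (m≤n+m _ _)
      apart : ∀ A {y z} → W y ≡ true → W z ≡ true → g y ≢ g z → C.L A y ≢ C.L A z
      apart A Wy Wz ne eq = ne (trans (sym (g-L A Wy)) (trans (cong g eq) (g-L A Wz)))
      two : 2 ≤ C.t all
      two = let a , Wa , ga = both true ; b , Wb , gb = both false in
        count-2 _ (apart all Wa Wb (λ q → true≢false ga (trans q gb))) (root-of all Wa) (root-of all Wb)
      classes : C.t all ≤ 2 → ∀ {y z} → W y ≡ true → W z ≡ true → g y ≡ g z → C.L all y ≡ C.L all z
      classes le {y} {z} Wy Wz gyz with C.L all y ≟ C.L all z
      ... | yes p = p
      ... | no ne = let w , Ww , gw = both (not (g y)) in ⊥-elim (<⇒≱ (count-3 _ ne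
              (apart all Wy Ww (λ q → Boolₚ.not-¬ (sym (trans q gw)) refl)) (apart all Wz Ww (λ q → Boolₚ.not-¬ (sym (trans gyz (trans q gw))) refl))
              (root-of all Wy) (root-of all Wz) (root-of all Ww)) le)

    -- Every bipartition of W is crossed by many free items: the trees span W.
    trees-B : (∀ g → BothSides g → N ≤ crossings g) → Trees (λ _ → true)
    trees-B large = trees 1 few one classes
      where
      g : Fin n → Bool
      g _ = true
      open Run g
      cr-g : ∀ ℓ → cr g ℓ ≡ false
      cr-g ℓ = cr-false {g} (false , λ _ ())
      none : crossings g ≤ N
      none = ≤-trans (≤-reflexive (∑-zero λ ℓ → cong ⟦_⟧ (trans (cong (free ℓ ∧_) (cr-g ℓ)) (Boolₚ.∧-zeroʳ (free ℓ))))) z≤n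
      item-label : ∀ A {ℓ} → U ℓ ≡ true → A ℓ ≡ true → ∃ λ z → ∀ {e y} → lab e ≡ ℓ → End y e → W y ≡ true → C.L A y ≡ z
      item-label A {ℓ} Uℓ Aℓ = C.L A (ψ (src ends ℓ)) , λ {e} {y} eq ye Wy →
          trans (cong (C.L A) (sym (ψ-id (W-B Wy)))) (trans (ends-same eq ye) (base eq))
        where
        inU : ∀ {e} → lab e ≡ ℓ → (U ∩ᵇ A) (lab e) ≡ true
        inU refl = ∧-true Uℓ Aℓ
        idem : lab ℓ ≡ ℓ
        idem = free-lab {ℓ} (∧-trueˡ Uℓ)
        ends-same : ∀ {e y} → lab e ≡ ℓ → End y e → C.L A (ψ y) ≡ C.L A (ψ (src ends e))
        ends-same eq (inj₁ refl) = refl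
        ends-same eq (inj₂ refl) = sym (C.L-edge A (inU eq))
        base : ∀ {e} → lab e ≡ ℓ → C.L A (ψ (src ends e)) ≡ C.L A (ψ (src ends ℓ))
        base {e} eq = by (hub ℓ) refl (bool? (live ends e))
          where
          by : ∀ h → hub ℓ ≡ h → live ends e ≡ true ⊎ live ends e ≡ false → C.L A (ψ (src ends e)) ≡ C.L A (ψ (src ends ℓ))
          by nothing  hℓ _ = cong (λ z → C.L A (ψ (src ends z))) (fibre-nothing eq hℓ)
          by (just x) hℓ (inj₁ l) = trans (sym (ends-same eq (δ-End (fibre-hub eq l hℓ)))) (ends-same idem (δ-End (proj₂ (hub-spec hℓ))))
          by (just x) hℓ (inj₂ l) with hub-view e
          ... | inj₁ p = cong (λ z → C.L A (ψ (src ends z))) (trans (sym (lab-nothing p)) eq)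
          ... | inj₂ (y , p , h) = ⊥-elim (true≢false (δ-live ends {is y} h) l)
      few : ∀ A → N * C.t A ≤ count (U ∖ A) + N * 1
      few A with 3 ≤? C.t A | 2 ≤? C.t A
      ... | yes t≥3 | _       = many none A t≥3
      ... | no t≱3  | no t≱2  = ≤-trans (*-monoʳ-≤ N (≤-pred (≰⇒> t≱2))) (m≤n+m _ _)
      ... | no t≱3  | yes t≥2 = ≤-trans (*-monoʳ-≤ N (≤-pred (≰⇒> t≱3))) (≤-trans (≤-reflexive (*-distribˡ-+ N 1 1))
              (+-monoˡ-≤ (N * 1) (≤-trans (≤-reflexive (*-identityʳ N)) (cut-N (count-pair _ t≥2)))))
        where
        cut-N : (∃ λ a → ∃ λ b → a ≢ b × W a ∧ is a (C.L A a) ≡ true × W b ∧ is b (C.L A b) ≡ true) → N ≤ count (U ∖ A)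
        cut-N (a , b , ne , ra , rb) = ≤-trans (large f sides) (count-mono uncovered)
          where
          f : Fin n → Bool
          f y = is a (C.L A y)
          sides : BothSides f
          sides true  = a , ∧-trueˡ ra , is-true (is-≡ (∧-trueʳ {W a} ra))
          sides false = b , ∧-trueˡ rb , is-≢ (λ eq → ne (trans (sym eq) (is-≡ (∧-trueʳ {W b} rb))))
          uncovered : ∀ ℓ → (free ∩ᵇ cr f) ℓ ≡ true → (U ∖ A) ℓ ≡ true
          uncovered ℓ h = ∧-true Uℓ (not-false (≢true λ Aℓ → split (item-label A Uℓ Aℓ)))
            where
            Uℓ : U ℓ ≡ true
            Uℓ = ∧-true (∧-trueˡ h) (not-false (cr-g ℓ))
            crℓ : cr f ℓ ≡ true
            crℓ = ∧-trueʳ {free ℓ} h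
            split : (∃ λ z → ∀ {e y} → lab e ≡ ℓ → End y e → W y ≡ true → C.L A y ≡ z) → ⊥
            split (z , same) =
              let e , y , le , ye , Wy , fy = touch-elim (cr-touch {f} {ℓ} true crℓ)
                  e′ , y′ , le′ , ye′ , Wy′ , fy′ = touch-elim (cr-touch {f} {ℓ} false crℓ)
              in true≢false (trans (cong (is a) (trans (same le′ ye′ Wy′) (sym (same le ye Wy)))) fy) fy′
      w : ∃ λ y → W y ≡ true
      w = proj₁ other , S-W (proj₁ (proj₂ other)) (proj₂ (proj₂ other))
      one : 1 ≤ C.t all
      one = count-pos _ (root-of all (proj₂ w))
      classes : C.t all ≤ 1 → ∀ {y z} → W y ≡ true → W z ≡ true → g y ≡ g z → C.L all y ≡ C.L all z
      classes le {y} {z} Wy Wz _ with C.L all y ≟ C.L all z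
      ... | yes p = p
      ... | no ne = ⊥-elim (<⇒≱ (count-2 _ ne (root-of all Wy) (root-of all Wz)) le)

    half : Fin N → Fin k
    half j = [ (λ i → i) , (λ i → i) ]′ (Fin.splitAt k j)

    halve : Maybe (Fin N) → Maybe (Fin k)
    halve nothing  = nothing
    halve (just j) = just (half j)

    zapped : (Fin n → Bool) → Maybe Bool → Fin m → Bool
    zapped g nothing  e = false
    zapped g (just b) e = end g b (src ends e) ∨ end g b (tgt ends e)

    cr-hub : ∀ {g ℓ} → ∂v ℓ ≡ true → cr g ℓ ≡ true → ∃ λ x → hub ℓ ≡ just x
    cr-hub {g} {ℓ} hv h = by (hub ℓ) refl
      where
      by : ∀ x → hub ℓ ≡ x → ∃ λ x → hub ℓ ≡ just x
      by (just x) p = x , p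
      by nothing  p with touch-elim (cr-touch {g} {ℓ} true h) | touch-elim (cr-touch {g} {ℓ} false h)
      ... | e , y , le , ye , Wy , gy | e′ , y′ , le′ , ye′ , Wy′ , gy′ with fibre-nothing le p | fibre-nothing le′ p
      ...   | refl | refl = ⊥-elim (true≢false gy (trans (cong g (trans (other-End hv ye (W-v Wy)) (sym (other-End hv ye′ (W-v Wy′))))) gy′))

    cr-edge : ∀ {g ℓ x} → hub ℓ ≡ just x → cr g ℓ ≡ true → ∀ b →
      ∃ λ e → δ ends (is x) e ≡ true × lab e ≡ ℓ × W (far ends x e) ≡ true × g (far ends x e) ≡ b
    cr-edge {g} {ℓ} {x} hℓ h b with touch-elim (cr-touch {g} {ℓ} b h)
    ... | e , y , le , ye , Wy , gy = e , xe , le , trans (cong W (sym y≡far)) Wy , trans (cong g (sym y≡far)) gy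
      where
      alive : live ends e ≡ true
      alive with hub-view e
      ... | inj₂ (x , _ , h) = δ-live ends {is x} h
      ... | inj₁ p = trans (cong (live ends) (trans (sym (lab-nothing p)) le)) (δ-live ends {is x} (proj₂ (hub-spec hℓ)))
      xe : δ ends (is x) e ≡ true
      xe = fibre-hub le alive hℓ
      y≡far : y ≡ far ends x e
      y≡far = other-End xe ye (λ q → true≢false Wy (trans (cong W q) (B-W (proj₁ (hub-spec hℓ)))))

    -- Colour i consists of two trees in each class of g, of the items of colour i at v, and of
    -- the free crossing items given to it by h; z says which crossing items at v lose their edges
    -- to one of the sides.
    module Colouring (g : Fin n → Bool) (forest : Trees g) (h : Fin m → Maybe (Fin k)) (z : Fin m → Maybe Bool)
      (h-cr : ∀ {ℓ i} → h ℓ ≡ just i → free ℓ ≡ true × cr g ℓ ≡ true)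
      (z-cr : ∀ {ℓ b} → z ℓ ≡ just b → ∂v ℓ ≡ true × cr g ℓ ≡ true) where
      open Trees forest

      col : Fin m → Maybe (Fin k)
      col ℓ = if cr g ℓ then h ℓ else halve (C ℓ)

      c : Fin m → Maybe (Fin k)
      c e = if ∂v (lab e) then (if zapped g (z (lab e)) e then nothing else just (pc (lab e))) else col (lab e)

      c-v : ∀ {e} → ∂v (lab e) ≡ true → zapped g (z (lab e)) e ≡ false → c e ≡ just (pc (lab e))
      c-v p q rewrite p | q = refl

      c-zapped : ∀ {e} → ∂v (lab e) ≡ true → zapped g (z (lab e)) e ≡ true → c e ≡ nothing
      c-zapped p q rewrite p | q = refl

      c-free : ∀ {e} → free (lab e) ≡ true → c e ≡ col (lab e)
      c-free {e} p = cong (λ b → if b then (if zapped g (z (lab e)) e then nothing else just (pc (lab e))) else col (lab e)) (free-v p)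

      c-tree : ∀ {e j} → C (lab e) ≡ just j → c e ≡ just (half j)
      c-tree {e} p = trans (c-free (proj₁ (C-free p))) (trans (cong (λ b → if b then h (lab e) else halve (C (lab e))) (proj₂ (C-free p))) (cong halve p))

      c-h : ∀ {e i} → h (lab e) ≡ just i → c e ≡ just i
      c-h {e} p = trans (c-free (proj₁ (h-cr p))) (trans (cong (λ b → if b then h (lab e) else halve (C (lab e))) (proj₂ (h-cr p))) p)

      zapped-elim : ∀ {b e} → zapped g (just b) e ≡ true → ∃ λ y → End y e × W y ≡ true × g y ≡ b
      zapped-elim {b} {e} p with ∨-true {end g b (src ends e)} p
      ... | inj₁ q = src ends e , inj₁ refl , ∧-trueˡ q , xor-≡ (not-true (∧-trueʳ {W (src ends e)} q))
      ... | inj₂ q = tgt ends e , inj₂ refl , ∧-trueˡ q , xor-≡ (not-true (∧-trueʳ {W (tgt ends e)} q))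

      zapped-far : ∀ {b x e} → B x ≡ true → δ ends (is x) e ≡ true → zapped g (just b) e ≡ true → W (far ends x e) ≡ true × g (far ends x e) ≡ b
      zapped-far {b} {x} {e} Bx xe p with zapped-elim {b} {e} p
      ... | y , ye , Wy , gy = trans (cong W (sym y≡far)) Wy , trans (cong g (sym y≡far)) gy
        where
        y≡far : y ≡ far ends x e
        y≡far = other-End xe ye (λ q → true≢false Wy (trans (cong W q) (B-W Bx)))

      c-extends : ∀ e → ∂v e ≡ true → c e ≡ just (pc e)
      c-extends e hv = trans (c-v (trans (cong ∂v (lab-v hv)) hv) (≢true unzapped)) (cong (just ∘ pc) (lab-v hv))
        where
        unzapped : ¬ zapped g (z (lab e)) e ≡ true
        unzapped p with z (lab e) in eq
        ... | just b with cr-hub {g} {e} hv (subst (λ ℓ → cr g ℓ ≡ true) (lab-v hv) (proj₂ (z-cr eq)))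
        ...   | x , he with hub-spec he
        ...     | Bx , xe = true≢false (proj₁ (zapped-far Bx xe p)) (trans (cong W (∂v-far (B-v Bx) xe hv)) Wv)

      Joined-by : Fin k → Set
      Joined-by i = (∀ {y y′} → W y ≡ true → W y′ ≡ true → g y ≡ g y′)
        ⊎ (∃ λ ℓ → ∂v ℓ ≡ true × cr g ℓ ≡ true × pc ℓ ≡ i × z ℓ ≡ nothing)
        ⊎ (∃ λ ℓ → h ℓ ≡ just i)

      module _ (i : Fin k) (f : Fin n → Bool) (closed : Closed ends c v i f) where
        along : ∀ {x e} → δ ends (is x) e ≡ true → c e ≡ just i → ∂v e ≡ false → f x ≡ f (far ends x e)
        along {x} {e} p ce hv with δ-ends ends {x} {e} p
        ... | inj₁ (s , _ , q) = trans (cong f (sym s)) (trans (closed e ce hv) (cong f (sym q)))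
        ... | inj₂ (t , _ , q) = trans (cong f (sym t)) (trans (sym (closed e ce hv)) (cong f (sym q)))

        tree-link : ∀ {j} → half j ≡ i → ∀ e → C (lab e) ≡ just j → f (ψ (src ends e)) ≡ f (ψ (tgt ends e))
        tree-link {j} hj e Ce with bool? (live ends e)
        ... | inj₂ l = cong (f ∘ ψ) (dead-ends l)
        ... | inj₁ l = trans (f-ψ (inj₁ refl)) (trans (closed e ce (free-edge-v (proj₁ (C-free Ce)))) (sym (f-ψ (inj₂ refl))))
          where
          ce : c e ≡ just i
          ce = trans (c-tree Ce) (cong just hj)
          f-ψ : ∀ {y} → End y e → f (ψ y) ≡ f y
          f-ψ {y} ye with bool? (B y)
          ... | inj₂ By = cong f (ψ-id By)
          ... | inj₁ By = trans (cong f (ψ-hub By ye′)) (sym (along (lab-at By ye′)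
                  (trans (c-tree (trans (cong C (lab-idem e)) Ce)) (cong just hj)) (free-v (proj₁ (C-free Ce)))))
            where
            ye′ = End-live ye l

        same-class : ∀ {y y′} → W y ≡ true → W y′ ≡ true → g y ≡ g y′ → f y ≡ f y′
        same-class = connected (i Fin.↑ˡ k) f (tree-link (cong [ (λ i → i) , (λ i → i) ]′ (Finₚ.splitAt-↑ˡ k i k)))

        Bridge : Set
        Bridge = ∃ λ a → ∃ λ b → W a ≡ true × W b ≡ true × g a ≡ true × g b ≡ false × f a ≡ f b

        hub-bridge : ∀ {ℓ x} → hub ℓ ≡ just x → cr g ℓ ≡ true → (∀ {e} → lab e ≡ ℓ → c e ≡ just i) → Bridge
        hub-bridge {ℓ} {x} hℓ crℓ coloured with cr-edge {g} {ℓ} hℓ crℓ true | cr-edge {g} {ℓ} hℓ crℓ false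
        ... | e , xe , le , We , ge | e′ , xe′ , le′ , We′ , ge′ = far ends x e , far ends x e′ , We , We′ , ge , ge′ , trans (sym (to xe le We)) (to xe′ le′ We′)
          where
          to : ∀ {e} → δ ends (is x) e ≡ true → lab e ≡ ℓ → W (far ends x e) ≡ true → f x ≡ f (far ends x e)
          to xe le We = along xe (coloured le) (≢true λ hv → W-v We (∂v-far (B-v (proj₁ (hub-spec hℓ))) xe hv))

        bridge-v : ∀ {ℓ} → ∂v ℓ ≡ true → cr g ℓ ≡ true → pc ℓ ≡ i → z ℓ ≡ nothing → Bridge
        bridge-v {ℓ} hv crℓ pcℓ zℓ = hub-bridge (proj₂ (cr-hub {g} {ℓ} hv crℓ)) crℓ
          (λ { {e} refl → trans (c-v hv (cong (λ w → zapped g w e) zℓ)) (cong just pcℓ) })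

        bridge-h : ∀ {ℓ} → h ℓ ≡ just i → Bridge
        bridge-h {ℓ} hℓ = by (hub ℓ) refl
          where
          crℓ = proj₂ (h-cr hℓ)
          by : ∀ x → hub ℓ ≡ x → Bridge
          by (just x) p = hub-bridge p crℓ (λ { refl → c-h hℓ })
          by nothing  p with touch-elim (cr-touch {g} {ℓ} true crℓ) | touch-elim (cr-touch {g} {ℓ} false crℓ)
          ... | e , y , le , ye , Wy , gy | e′ , y′ , le′ , ye′ , Wy′ , gy′ with fibre-nothing le p | fibre-nothing le′ p
          ...   | refl | refl = y , y′ , Wy , Wy′ , gy , gy′ , trans (to-src ye) (sym (to-src ye′))
            where
            to-src : ∀ {y} → End y ℓ → f y ≡ f (src ends ℓ)
            to-src (inj₁ refl) = refl
            to-src (inj₂ refl) = sym (closed ℓ (c-h (trans (cong h (lab-nothing p)) hℓ)) (free-v (proj₁ (h-cr hℓ))))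

        across : Bridge → ∀ {y y′} → W y ≡ true → W y′ ≡ true → f y ≡ f y′
        across (a , b , Wa , Wb , ga , gb , fab) Wy Wy′ = trans (to-a Wy) (sym (to-a Wy′))
          where
          to-a : ∀ {y} → W y ≡ true → f y ≡ f a
          to-a {y} Wy = [ (λ gy → same-class Wy Wa (trans gy (sym ga))) , (λ gy → trans (same-class Wy Wb (trans gy (sym gb))) (sym fab)) ]′ (bool? (g y))

        constant : Joined-by i → ∀ {y y′} → W y ≡ true → W y′ ≡ true → f y ≡ f y′
        constant (inj₁ one)                       Wy Wy′ = same-class Wy Wy′ (one Wy Wy′)
        constant (inj₂ (inj₁ (ℓ , hv , crℓ , p , q))) = across (bridge-v hv crℓ p q)
        constant (inj₂ (inj₂ (ℓ , p)))            = across (bridge-h p)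

        escape : ∀ {e y} → B y ≡ true → δ ends (is y) e ≡ true → ∂v e ≡ true → pc e ≡ i → ∃ λ w → W w ≡ true × f y ≡ f w
        escape {e} {y} By ye hv pce with bool? (cr g e)
        ... | inj₁ cre = via (cr-edge {g} {e} (hub-at By ye) cre (side (z e)))
          where
          side : Maybe Bool → Bool
          side nothing  = true
          side (just b) = not b
          via : (∃ λ e′ → δ ends (is y) e′ ≡ true × lab e′ ≡ e × W (far ends y e′) ≡ true × g (far ends y e′) ≡ side (z e)) → ∃ λ w → W w ≡ true × f y ≡ f w
          via (e′ , ye′ , le′ , We′ , ge′) = far ends y e′ , We′ ,
              along ye′ (trans (c-v (trans (cong ∂v le′) hv) (trans (cong (λ ℓ → zapped g (z ℓ) e′) le′) (≢true (kept (z e) ge′)))) (cong just (trans (cong pc le′) pce)))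
                        (≢true λ q → W-v We′ (∂v-far (B-v By) ye′ q))
            where
            kept : ∀ w → g (far ends y e′) ≡ side w → ¬ zapped g w e′ ≡ true
            kept (just b) q p = Boolₚ.not-¬ {b} refl (trans (sym (proj₂ (zapped-far By ye′ p))) q)
        ... | inj₂ cre = via (missing (δ ends (is y)) (is e) others)
          where
          others : count (δ ends (is y) ∩ᵇ is e) < count (δ ends (is y))
          others = ≤-trans (s≤s (≤-trans (count-mono (λ e′ → ∧-trueʳ {δ ends (is y) e′})) (≤-reflexive (∑-is-1 e)))) (≤-trans (s≤s (s≤s z≤n)) (≤-reflexive (sym (degree-3 By ye))))
          via : (∃ λ e′ → δ ends (is y) e′ ≡ true × is e e′ ≡ false) → ∃ λ w → W w ≡ true × f y ≡ f w
          via (e′ , ye′ , ne) = far ends y e′ , S-W (B-far By ye′) (λ q → ¬v (far-∂v (B-v By) ye′ q)) ,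
              along ye′ (trans (c-v (trans (cong ∂v le′) hv) (trans (cong (λ ℓ → zapped g (z ℓ) e′) le′) (kept (z e) refl))) (cong just (trans (cong pc le′) pce))) (≢true ¬v)
            where
            le′ : lab e′ ≡ e
            le′ = trans (lab-same By ye′ ye) (lab-v hv)
            ¬v : ¬ ∂v e′ ≡ true
            ¬v q = is-false ne (v-edge-unique By ye′ ye q hv)
            kept : ∀ w → z e ≡ w → zapped g w e′ ≡ false
            kept nothing  _ = refl
            kept (just b) q = ⊥-elim (true≢false (proj₂ (z-cr q)) cre)

        terminal : ∀ y → Terminal ends S v pc i y → ∃ λ w → W w ≡ true × f y ≡ f w
        terminal y (inj₁ (Sy , ne)) = y , S-W Sy ne , refl
        terminal y (inj₂ (e , hv , pce , refl)) with bool? (B (far ends v e)) | bool? (W (far ends v e))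
        ... | inj₁ By | _       = escape By (δ-far ends hv) hv pce
        ... | inj₂ By | inj₁ Wy = far ends v e , Wy , refl
        ... | inj₂ By | inj₂ Wy = ⊥-elim (far≢ ends hv (not-W By Wy))

        c-connected : Joined-by i → ∀ y y′ → Terminal ends S v pc i y → Terminal ends S v pc i y′ → f y ≡ f y′
        c-connected joined y y′ t t′ = let w , Ww , q = terminal y t ; w′ , Ww′ , q′ = terminal y′ t′ in
          trans q (trans (constant joined Ww Ww′) (sym q′))

      tree-edge : ∀ j {u y} → W u ≡ true → W y ≡ true → y ≢ u → g y ≡ g u → ∃ λ e → δ ends (is u) e ≡ true × C (lab e) ≡ just j
      tree-edge j {u} {y} Wu Wy ne gyu = by (Finₚ.any? λ e → (hasColour (C (lab e)) j Boolₚ.≟ true) ×-dec ((is u (ψ (src ends e)) xor is u (ψ (tgt ends e))) Boolₚ.≟ true))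
        where
        Result = ∃ λ e → δ ends (is u) e ≡ true × C (lab e) ≡ just j
        by : Dec (∃ λ e → hasColour (C (lab e)) j ≡ true × (is u (ψ (src ends e)) xor is u (ψ (tgt ends e))) ≡ true) → Result
        by (no none) = ⊥-elim (true≢false (is-refl u) (trans (connected j (is u) (λ e p → xor-≡ (≢true λ q → none (e , hasColour-refl p , q))) Wu Wy (sym gyu)) (is-≢ ne)))
        by (yes (e , hC , crosses)) = at (bool? (live ends e))
          where
          Ce : C (lab e) ≡ just j
          Ce = hasColour-≡ hC
          at : live ends e ≡ true ⊎ live ends e ≡ false → Result
          at (inj₂ l) = ⊥-elim (xor-≢ crosses (cong (is u ∘ ψ) (dead-ends l)))
          at (inj₁ l) with hub-view e
          ... | inj₁ p = e , trans (cong₂ (λ a b → is u a xor is u b) (sym (ψ-id (proj₁ Bs))) (sym (ψ-id (proj₂ Bs)))) crosses , Ce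
            where
            Bs = hub-nothing p l
          ... | inj₂ (x , Bx , xe) with is u (far ends x e) in q | is u (far ends x (lab e)) in q′
          ...   | true  | _    = e , subst (λ w → δ ends (is w) e ≡ true) (is-≡ q) (δ-far ends xe) , Ce
          ...   | false | true = lab e , subst (λ w → δ ends (is w) (lab e) ≡ true) (is-≡ q′) (δ-far ends (lab-at Bx xe)) , trans (cong C (lab-idem e)) Ce
          ...   | false | false = ⊥-elim (true≢false crosses (flat (link-hub Bx xe)))
            where
            flat : (link e ≡ (far ends x (lab e) , far ends x e)) ⊎ (link e ≡ (far ends x e , far ends x (lab e))) → (is u (ψ (src ends e)) xor is u (ψ (tgt ends e))) ≡ false
            flat (inj₁ w) = cong₂ _xor_ (trans (cong (is u ∘ proj₁) w) q′) (trans (cong (is u ∘ proj₂) w) q)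
            flat (inj₂ w) = cong₂ _xor_ (trans (cong (is u ∘ proj₁) w) q) (trans (cong (is u ∘ proj₂) w) q′)

      Spread : Fin n → Set
      Spread u = k * 2 ≤ count (λ e → δ ends (is u) e ∧ uncoloured (c e)) ⊎ (∀ i → 2 ≤ degree ends c u i)

      spread : ∀ {u y} → W u ≡ true → W y ≡ true → y ≢ u → g y ≡ g u → Spread u
      spread {u} Wu Wy ne gyu = inj₂ λ i → two i (tree-edge (i Fin.↑ˡ k) Wu Wy ne gyu) (tree-edge (k Fin.↑ʳ i) Wu Wy ne gyu)
        where
        two : ∀ i → (∃ λ e → δ ends (is u) e ≡ true × C (lab e) ≡ just (i Fin.↑ˡ k)) → (∃ λ e → δ ends (is u) e ≡ true × C (lab e) ≡ just (k Fin.↑ʳ i)) → 2 ≤ degree ends c u i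
        two i (e , p , q) (e′ , p′ , q′) = count-2 _ {e} {e′} (λ { refl → left≢right i (just-injective (trans (sym q) q′)) })
            (∧-true p (hasColour-refl (trans (c-tree q) (cong just (cong [ (λ i → i) , (λ i → i) ]′ (Finₚ.splitAt-↑ˡ k i k))))))
            (∧-true p′ (hasColour-refl (trans (c-tree q′) (cong just (cong [ (λ i → i) , (λ i → i) ]′ (Finₚ.splitAt-↑ʳ k k i))))))
          where
          left≢right : ∀ i → i Fin.↑ˡ k ≢ k Fin.↑ʳ i
          left≢right i eq with trans (sym (Finₚ.splitAt-↑ˡ k i k)) (trans (cong (Fin.splitAt k) eq) (Finₚ.splitAt-↑ʳ k k i))
          ... | ()

      spread⇒balanced : ∀ {u} → u ≢ v → S u ∨ R u ≡ true → Spread u → ∑ (λ i → 2 ⊔ degree ends c u i) ≤ D u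
      spread⇒balanced {u} ne SR (inj₁ room) = sparse⇒balanced ends c u (D u)
        (≤-trans (+-monoʳ-≤ _ room) (≤-trans (≤-reflexive (coloured-or-not (δ ends (is u)) c)) (budget u ne SR)))
      spread⇒balanced {u} ne SR (inj₂ two) = ≤-trans (≤-reflexive (trans (∑-cong λ i → m≤n⇒m⊔n≡n (two i)) (∑-by-colour (δ ends (is u)) c)))
        (≤-trans (coloured≤d ends c u) (budget u ne SR))

      solution : (∀ i → Joined-by i) → (∀ u → W u ≡ true → (∀ y → W y ≡ true → g y ≡ g u → y ≡ u) → Spread u) → Solution ends S R D v pc
      solution joined alone = record
        { c = c ; extends = c-extends ; connected = λ i f closed → c-connected i f closed (joined i)
        ; balanced = λ u ne SR → spread⇒balanced ne SR (spreads (∧-true SR (not-false (is-≢ ne)))) }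
        where
        spreads : ∀ {u} → W u ≡ true → Spread u
        spreads {u} Wu with Finₚ.any? (λ y → (W y Boolₚ.≟ true) ×-dec ((g y Boolₚ.≟ g u) ×-dec ¬? (y ≟ u)))
        ... | yes (y , Wy , gy , ne) = spread Wu Wy ne gy
        ... | no none = alone u Wu (λ y Wy gy → decidable-stable (y ≟ u) (λ ne → none (y , Wy , gy , ne)))

    module CaseA (g : Fin n → Bool) (both : BothSides g) (fg : crossings g ≤ N) where
      open Majority g

      p f : ℕ
      p = v-crossings g
      f = crossings g

      sides-≥ : ∀ {M} → (∀ b → M ≤ d ends (side b)) → M + M ≤ 2 * f + (K + p)
      sides-≥ le = ≤-trans (+-mono-≤ (le true) (le false)) majority

      p-large : 24 * k ≤ p
      p-large = ≤-by r (+-mono-≤ (sides-≥ {K′} λ b → let y , Wy , gy = both b in large-cut (side b) (side-v b) Wy (side-witness Wy gy)) (*-monoʳ-≤ 2 fg))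
        (trans (cong (λ z → 24 * k + (2 * f + (z + p) + 2 * (k + k)) + r) K-eq)
               (trans (equation k r p f) (cong (λ z → p + (z + z + 2 * f)) (sym K′-eq))))
        where
        equation : ∀ k r p f → 24 * k + (2 * f + (36 * k + r + p) + 2 * (k + k)) + r ≡ p + (32 * k + r + (32 * k + r) + 2 * f)
        equation k r p f = solve (k ∷ r ∷ p ∷ f ∷ [])

      v-crossing : ∃ λ ℓ → (∂v ∩ᵇ cr g) ℓ ≡ true
      v-crossing = count-witness _ (≤-trans 1≤k (≤-trans (m≤m+n k _) p-large))

      side-cut : ∀ b → K ≤ d ends (side b)
      side-cut b = let ℓ , h = v-crossing
                       x , hℓ = cr-hub {g} {ℓ} (∧-trueˡ h) (∧-trueʳ {∂v ℓ} h)
                       e , xe , _ , We , ge = cr-edge {g} {ℓ} hℓ (∧-trueʳ {∂v ℓ} h) b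
                   in cut (side b) ((far ends x e , B-far (proj₁ (hub-spec hℓ)) xe , side-witness We ge) , (v , v∈S , side-v b))

      K≤ : K ≤ 2 * f + p
      K≤ = +-cancelʳ-≤ K K (2 * f + p) (≤-trans (sides-≥ side-cut) (≤-reflexive (equation (2 * f) K p)))
        where
        equation : ∀ a b c → a + (b + c) ≡ a + c + b
        equation a b c = solve (a ∷ b ∷ c ∷ [])

      has? : ∀ i → Dec (∃ λ ℓ → (∂v ∩ᵇ cr g) ℓ ∧ is i (pc ℓ) ≡ true)
      has? i = Finₚ.any? λ ℓ → (∂v ∩ᵇ cr g) ℓ ∧ is i (pc ℓ) Boolₚ.≟ true

      demand : ∀ {i} → Dec (∃ λ ℓ → (∂v ∩ᵇ cr g) ℓ ∧ is i (pc ℓ) ≡ true) → ℕ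
      demand (yes _) = 0
      demand (no _)  = 1

      -- A colour without crossing item at v has two edges at v that do not cross, and at most
      -- 2f edges at v do not cross.
      demand-≤ : ∑ (λ i → demand (has? i)) ≤ count (free ∩ᵇ cr g)
      demand-≤ = *-cancelˡ-≤ 2 (≤-trans (≤-reflexive (sym (∑-* 2 _))) (≤-trans (∑-mono λ i → two i (has? i)) (≤-trans (≤-reflexive (∑-by-colour (∂v ∖ cr g) (just ∘ pc)))
          (+-cancelʳ-≤ p _ _ (≤-trans (≤-reflexive total) K≤)))))
        where
        two : ∀ i (dec : Dec (∃ λ ℓ → (∂v ∩ᵇ cr g) ℓ ∧ is i (pc ℓ) ≡ true)) → 2 * demand dec ≤ count (λ e → (∂v ∖ cr g) e ∧ is i (pc e))
        two i (yes _) = z≤n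
        two i (no none) = ≤-trans (twice i) (count-mono stays)
          where
          stays : ∀ e → ∂v e ∧ is i (pc e) ≡ true → (∂v ∖ cr g) e ∧ is i (pc e) ≡ true
          stays e h = ∧-true {(∂v ∖ cr g) e} (∧-true {∂v e} (∧-trueˡ h) (not-false (≢true λ c → none (e , ∧-true {(∂v ∩ᵇ cr g) e} (∧-true {∂v e} (∧-trueˡ h) c) ofColour)))) ofColour
            where
            ofColour : is i (pc e) ≡ true
            ofColour = ∧-trueʳ {∂v e} h
        total : count (λ e → (∂v ∖ cr g) e ∧ true) + p ≡ K
        total = trans (sym (∑-+ _ _)) (trans (∑-cong pointwise) degree-v)
          where
          pointwise : ∀ e → ⟦ (∂v ∖ cr g) e ∧ true ⟧ + ⟦ (∂v ∩ᵇ cr g) e ⟧ ≡ ⟦ ∂v e ⟧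
          pointwise e with ∂v e | cr g e
          ... | false | _     = refl
          ... | true  | true  = refl
          ... | true  | false = refl

      pickOf : ∀ {i} → Dec (∃ λ ℓ → (∂v ∩ᵇ cr g) ℓ ∧ is i (pc ℓ) ≡ true) → Maybe (Fin m)
      pickOf (yes (ℓ , _)) = just ℓ
      pickOf (no _)        = nothing

      pick : Fin k → Maybe (Fin m)
      pick i = pickOf (has? i)

      picked spare : Fin m → Bool
      picked ℓ = 0 <ᵇ count (λ i → hasColour (pick i) ℓ)
      spare ℓ = (∂v ∩ᵇ cr g) ℓ ∧ not (picked ℓ)

      spare-≥ : ∑ {2} (λ _ → k * 2) ≤ count spare
      spare-≥ = ≤-trans (≤-reflexive (∑-const 2 (k * 2))) (≤-by (19 * k) (+-mono-≤ p-large p≤) (equation k p (count spare)))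
        where
        p≤ : p ≤ count spare + k * 1
        p≤ = ≤-trans (∑-mono pointwise) (≤-trans (≤-reflexive (∑-+ _ _)) (+-monoʳ-≤ (count spare)
               (≤-trans (≤-reflexive (trans (∑-swap _) (∑-cong λ i → ∑-hasColour (pick i)))) (≤-trans (∑-mono λ i → ⟦⟧≤1 (coloured (pick i))) (≤-reflexive (∑-const k 1))))))
          where
          pointwise : ∀ ℓ → ⟦ (∂v ∩ᵇ cr g) ℓ ⟧ ≤ ⟦ spare ℓ ⟧ + ∑ (λ i → ⟦ hasColour (pick i) ℓ ⟧)
          pointwise ℓ with bool? (picked ℓ)
          ... | inj₁ eq = ≤-trans (⟦⟧≤1 ((∂v ∩ᵇ cr g) ℓ)) (≤-trans (<ᵇ⇒< 0 (count (λ i → hasColour (pick i) ℓ)) (T≡ eq)) (m≤n+m _ ⟦ spare ℓ ⟧))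
          ... | inj₂ eq = ≤-trans (⟦⟧-mono {(∂v ∩ᵇ cr g) ℓ} {spare ℓ} λ h → ∧-true h (not-false eq)) (m≤m+n ⟦ spare ℓ ⟧ _)
        equation : ∀ k p s → 2 * (k * 2) + (p + (s + k * 1)) + 19 * k ≡ s + (24 * k + p)
        equation k p s = solve (k ∷ p ∷ s ∷ [])

      module Assigned (forest : Trees g) (h-items : Distribution (λ i → demand (has? i)) (free ∩ᵇ cr g)) (z-items : Distribution {k = 2} (λ _ → k * 2) spare) where
        private
          module 𝒽 = Distribution h-items
          module 𝓏 = Distribution z-items

        sideOf : Fin 2 → Bool
        sideOf zero    = true
        sideOf (suc _) = false

        index : Bool → Fin 2
        index true  = zero
        index false = suc zero

        sideOf-index : ∀ b → sideOf (index b) ≡ b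
        sideOf-index true  = refl
        sideOf-index false = refl

        zOf : Maybe (Fin 2) → Maybe Bool
        zOf nothing  = nothing
        zOf (just s) = just (sideOf s)

        z : Fin m → Maybe Bool
        z ℓ = zOf (𝓏.to ℓ)

        z-spare : ∀ {ℓ b} → z ℓ ≡ just b → spare ℓ ≡ true
        z-spare {ℓ} h with 𝓏.to ℓ in eq
        ... | just s = 𝓏.within ℓ s eq

        h-cr : ∀ {ℓ i} → 𝒽.to ℓ ≡ just i → free ℓ ≡ true × cr g ℓ ≡ true
        h-cr {ℓ} {i} h = let w = 𝒽.within ℓ i h in ∧-trueˡ w , ∧-trueʳ {free ℓ} w

        z-cr : ∀ {ℓ b} → z ℓ ≡ just b → ∂v ℓ ≡ true × cr g ℓ ≡ true
        z-cr {ℓ} h = let w = ∧-trueˡ (z-spare h) in ∧-trueˡ w , ∧-trueʳ {∂v ℓ} w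

        module Col = Colouring g forest 𝒽.to z h-cr z-cr

        joined : ∀ i → Col.Joined-by i
        joined i = by (has? i) refl
          where
          by : (dec : Dec (∃ λ ℓ → (∂v ∩ᵇ cr g) ℓ ∧ is i (pc ℓ) ≡ true)) → has? i ≡ dec → Col.Joined-by i
          by (yes (ℓ , h)) eq = inj₂ (inj₁ (ℓ , ∧-trueˡ {∂v ℓ} (∧-trueˡ h) , ∧-trueʳ {∂v ℓ} (∧-trueˡ h) , is-≡ (∧-trueʳ {(∂v ∩ᵇ cr g) ℓ} h) , unused (z ℓ) refl))
            where
            isPicked : picked ℓ ≡ true
            isPicked = ≡true (<⇒<ᵇ (count-pos (λ i → hasColour (pick i) ℓ) {i} (hasColour-refl (cong pickOf eq))))
            unused : ∀ w → z ℓ ≡ w → z ℓ ≡ nothing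
            unused nothing  q = q
            unused (just b) q = ⊥-elim (true≢false isPicked (not-true (∧-trueʳ {(∂v ∩ᵇ cr g) ℓ} (z-spare q))))
          by (no none) eq = let ℓ , hc = count-witness _ (≤-trans (≤-reflexive (sym (cong demand eq))) (𝒽.enough i)) in inj₂ (inj₂ (ℓ , hasColour-≡ hc))

        alone : ∀ u → W u ≡ true → (∀ y → W y ≡ true → g y ≡ g u → y ≡ u) → Col.Spread u
        alone u Wu only = inj₁ (≤-trans (𝓏.enough (index (g u))) (≤-trans (∑-mono per-item) (≤-reflexive (sym (∑-fibres unc)))))
          where
          unc : Fin m → ℕ
          unc e = ⟦ δ ends (is u) e ∧ uncoloured (Col.c e) ⟧
          per-item : ∀ ℓ → ⟦ hasColour (𝓏.to ℓ) (index (g u)) ⟧ ≤ ∑ (λ e → ⟦ is ℓ (lab e) ⟧ * unc e)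
          per-item ℓ with bool? (hasColour (𝓏.to ℓ) (index (g u)))
          ... | inj₂ ¬hc = ≤-trans (≤-reflexive (cong ⟦_⟧ ¬hc)) z≤n
          ... | inj₁ hc = at (cr-hub {g} {ℓ} hv crℓ)
            where
            zℓ : z ℓ ≡ just (g u)
            zℓ = trans (cong zOf (hasColour-≡ hc)) (cong just (sideOf-index (g u)))
            w = ∧-trueˡ {(∂v ∩ᵇ cr g) ℓ} (z-spare {ℓ} zℓ)
            hv : ∂v ℓ ≡ true
            hv = ∧-trueˡ w
            crℓ : cr g ℓ ≡ true
            crℓ = ∧-trueʳ {∂v ℓ} w
            at : (∃ λ x → hub ℓ ≡ just x) → ⟦ hasColour (𝓏.to ℓ) (index (g u)) ⟧ ≤ ∑ (λ e → ⟦ is ℓ (lab e) ⟧ * unc e)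
            at (x , hℓ) with cr-edge {g} {ℓ} hℓ crℓ (g u)
            ... | e , xe , le , We , ge = ≤-trans (⟦⟧≤1 _) (≤-trans (≤-reflexive (sym (cong₂ (λ p q → ⟦ p ⟧ * ⟦ q ⟧) (is-true le) (∧-true ue (cong uncoloured dead)))))
                  (term≤∑ (λ e → ⟦ is ℓ (lab e) ⟧ * unc e) e))
              where
              far≡u : far ends x e ≡ u
              far≡u = only _ We ge
              ue : δ ends (is u) e ≡ true
              ue = subst (λ y → δ ends (is y) e ≡ true) far≡u (δ-far ends xe)
              endU : end g (g u) u ≡ true
              endU = ∧-true Wu (not-false (≡-xor {g u} refl))
              hit : end g (g u) (src ends e) ∨ end g (g u) (tgt ends e) ≡ true
              hit with δ-End ue
              ... | inj₁ q = ∨-trueˡ (trans (cong (end g (g u)) (sym q)) endU)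
              ... | inj₂ q = ∨-trueʳ {end g (g u) (src ends e)} (trans (cong (end g (g u)) (sym q)) endU)
              dead : Col.c e ≡ nothing
              dead = Col.c-zapped {e} (trans (cong ∂v le) hv) (trans (cong (λ w → zapped g w e) (trans (cong z le) zℓ)) hit)

        solution : Solution ends S R D v pc
        solution = Col.solution joined alone

      solved : Solution ends S R D v pc
      solved = Assigned.solution (trees-A g both fg) (distribute k (λ i → demand (has? i)) (free ∩ᵇ cr g) demand-≤) (distribute 2 (λ _ → k * 2) spare spare-≥)

    module CaseB (large : ∀ g → BothSides g → N ≤ crossings g) where

      module Col = Colouring (λ _ → true) (trees-B large) (λ _ → nothing) (λ _ → nothing) (λ ()) (λ ())

      alone : ∀ u → W u ≡ true → (∀ y → W y ≡ true → true ≡ true → y ≡ u) → Col.Spread u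
      alone u Wu only = inj₂ λ i → ≤-trans (twice i) (count-mono λ e h → ∧-true (at-u (∧-trueˡ h))
          (hasColour-refl (trans (Col.c-extends e (∧-trueˡ h)) (cong just (is-≡ (∧-trueʳ {∂v e} h))))))
        where
        module _ {e} (hv : ∂v e ≡ true) where
          y = far ends v e
          ye : δ ends (is y) e ≡ true
          ye = δ-far ends hv
          no-hub : B y ≡ true → ⊥
          no-hub By = second (missing (δ ends (is y)) (is e) (few (is e) (≤-trans (≤-reflexive (∑-is-1 e)) (s≤s z≤n))))
            where
            few : ∀ X → count X ≤ 2 → count (δ ends (is y) ∩ᵇ X) < count (δ ends (is y))
            few X le = ≤-trans (s≤s (≤-trans (count-mono (λ e′ → ∧-trueʳ {δ ends (is y) e′})) le)) (≤-reflexive (sym (degree-3 By ye)))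
            to-u : ∀ {e′} → δ ends (is y) e′ ≡ true → is e e′ ≡ false → far ends y e′ ≡ u
            to-u ye′ ne = only _ (S-W (B-far By ye′) (λ q → is-false ne (v-edge-unique By ye′ ye (far-∂v (B-v By) ye′ q) hv))) refl
            second : (∃ λ e′ → δ ends (is y) e′ ≡ true × is e e′ ≡ false) → ⊥
            second (e′ , ye′ , ne) = third (missing (δ ends (is y)) (is e ∪ᵇ is e′) (few (is e ∪ᵇ is e′)
                (≤-trans (∑-mono λ f → b≤ (by-cases 2 (λ p q → ⟦ p ∨ q ⟧ ≤ᵇ ⟦ p ⟧ + ⟦ q ⟧) _ (is e f) (is e′ f)))
                  (≤-reflexive (trans (∑-+ _ _) (cong₂ _+_ (∑-is-1 e) (∑-is-1 e′)))))))
              where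
              third : (∃ λ e″ → δ ends (is y) e″ ≡ true × (is e ∪ᵇ is e′) e″ ≡ false) → ⊥
              third (e″ , ye″ , ne′) = is-false (≢true λ q → true≢false (∨-trueʳ {is e e″} q) ne′)
                (no-parallel By ye″ ye′ (trans (to-u ye″ (≢true λ q → true≢false (∨-trueˡ q) ne′)) (sym (to-u ye′ ne))))
          at-u : δ ends (is u) e ≡ true
          at-u with bool? (B y) | bool? (W y)
          ... | inj₁ By | _       = ⊥-elim (no-hub By)
          ... | inj₂ By | inj₁ Wy = subst (λ w → δ ends (is w) e ≡ true) (only y Wy refl) ye
          ... | inj₂ By | inj₂ Wy = ⊥-elim (far≢ ends hv (not-W By Wy))

      solved : Solution ends S R D v pc
      solved = Col.solution (λ i → inj₁ λ _ _ → refl) alone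

    solved : Solution ends S R D v pc
    solved = by (search {P = λ g → BothSides g × crossings g ≤ N} ext (λ g → both? g ×-dec (crossings g ≤? N)))
      where
      both? : ∀ g → Dec (BothSides g)
      both? g = map′ (λ { (t , f) true → t ; (t , f) false → f }) (λ h → h true , h false) (at true ×-dec at false)
        where
        at : ∀ b → Dec (∃ λ y → W y ≡ true × g y ≡ b)
        at b = Finₚ.any? λ y → (W y Boolₚ.≟ true) ×-dec (g y Boolₚ.≟ b)
      ext : ∀ {g g′} → g ≗ g′ → BothSides g × crossings g ≤ N → BothSides g′ × crossings g′ ≤ N
      ext h (both , le) = (λ b → let y , Wy , gy = both b in y , Wy , trans (sym (h y)) gy) ,
        ≤-trans (≤-reflexive (count-cong λ ℓ → cong (free ℓ ∧_) (cong₂ _∧_ (sym (touch-cong h true ℓ)) (sym (touch-cong h false ℓ))))) le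
      by : Dec (∃ λ g → BothSides g × crossings g ≤ N) → Solution ends S R D v pc
      by (yes (g , both , le)) = CaseA.solved g both le
      by (no none) = CaseB.solved λ g both → <⇒≤ (≰⇒> λ le → none (g , both , le))

  module Recursion (1≤k : 1 ≤ k) (36≤Q : 36 ≤ Q) where

    r : ℕ
    r = (Q ∸ 36) * k

    Q-eq : Q ≡ 36 + (Q ∸ 36)
    Q-eq = sym (m+[n∸m]≡n 36≤Q)

    K-eq : K ≡ 36 * k + r
    K-eq = trans (cong (_* k) Q-eq) (*-distribʳ-+ k 36 (Q ∸ 36))

    K-eq′ : (Q ∸ 2) * k ≡ 34 * k + r
    K-eq′ = trans (cong (λ q → (q ∸ 2) * k) Q-eq) (*-distribʳ-+ k 34 (Q ∸ 36))

    2≤K : 2 ≤ K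
    2≤K = ≤-trans (≤-trans (*-monoʳ-≤ 2 1≤k) (*-monoˡ-≤ k {2} {36} (s≤s (s≤s z≤n)))) (≤-trans (m≤m+n (36 * k) r) (≤-reflexive (sym K-eq)))

    K′≤K : 32 * k + r ≤ K
    K′≤K = ≤-trans (+-monoˡ-≤ r (*-monoˡ-≤ k (≤ᵇ⇒≤ 32 36 _))) (≤-reflexive (sym K-eq))

    sep? : ∀ (S X : Fin n → Bool) → Dec (Sep S X)
    sep? S X = (Finₚ.any? λ s → (S s Boolₚ.≟ true) ×-dec (X s Boolₚ.≟ true)) ×-dec (Finₚ.any? λ s → (S s Boolₚ.≟ true) ×-dec (X s Boolₚ.≟ false))

    sep-cong : ∀ {S X Y : Fin n → Bool} → X ≗ Y → Sep S X → Sep S Y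
    sep-cong h ((a , Sa , Xa) , (b , Sb , Xb)) = (a , Sa , trans (sym (h a)) Xa) , (b , Sb , trans (sym (h b)) Xb)

    module Step {ends S R D v pc} (I : Instance ends S R D v pc) (R-tight : ∀ {u} → R u ≡ true → D u < d ends (is u) + k * 2)
      (ih : ∀ {ends′ S′ R′ D′ pc′} → size ends′ < size ends → Instance ends′ S′ R′ D′ v pc′ → Solution ends′ S′ R′ D′ v pc′) where
      open Instance I

      inside? : ∀ X → Dec (Inside ends X)
      inside? X = Finₚ.any? λ e → (live ends e Boolₚ.≟ true) ×-dec (X (src ends e) Boolₚ.≟ true) ×-dec (X (tgt ends e) Boolₚ.≟ true)

      inside-cong : ∀ {X Y} → X ≗ Y → Inside ends X → Inside ends Y
      inside-cong h (e , l , p , q) = e , l , trans (sym (h _)) p , trans (sym (h _)) q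

      Tight : (Fin n → Bool) → Set
      Tight X = X v ≡ false × (∃ λ s → S s ≡ true × X s ≡ true) × d ends X ≡ K × Inside ends X × Inside ends (not ∘ X)

      tight? : Dec (∃ Tight)
      tight? = search
        (λ h (Xv , (s , Ss , Xs) , dX , i , o) → trans (sym (h v)) Xv , (s , Ss , trans (sym (h s)) Xs) ,
          trans (sym (d-cong ends h)) dX , inside-cong h i , inside-cong (cong not ∘ h) o)
        (λ X → (X v Boolₚ.≟ false) ×-dec (Finₚ.any? λ s → (S s Boolₚ.≟ true) ×-dec (X s Boolₚ.≟ true)) ×-dec (d ends X Data.Nat.≟ K) ×-dec inside? X ×-dec inside? (not ∘ X))

      Blocks : Fin m → (Fin n → Bool) → Set
      Blocks e X = Sep S X × d ends X ≡ K × δ ends X e ≡ true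

      blocked? : ∀ e → Dec (∃ (Blocks e))
      blocked? e = search
        (λ h (sep , dX , eX) → sep-cong h sep , trans (sym (d-cong ends h)) dX , trans (sym (δ-cong ends h e)) eX)
        (λ X → sep? S X ×-dec (d ends X Data.Nat.≟ K) ×-dec (δ ends X e Boolₚ.≟ true))

      Endangers : Fin n → Fin n → Fin n → (Fin n → Bool) → Set
      Endangers x a b Y = Sep S Y × Y a ≡ true × Y b ≡ true × Y x ≡ false × d ends Y ≤ K + 1

      endangered? : ∀ x a b → Dec (∃ (Endangers x a b))
      endangered? x a b = search
        (λ h (sep , Ya , Yb , Yx , dY) → sep-cong h sep , trans (sym (h a)) Ya , trans (sym (h b)) Yb , trans (sym (h x)) Yx ,
          ≤-trans (≤-reflexive (sym (d-cong ends h))) dY)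
        (λ Y → sep? S Y ×-dec (Y a Boolₚ.≟ true) ×-dec (Y b Boolₚ.≟ true) ×-dec (Y x Boolₚ.≟ false) ×-dec (d ends Y ≤? K + 1))

      Splittable : Fin n → Fin m → Fin m → Set
      Splittable x e f = S x ∨ R x ≡ false × δ ends (is x) e ≡ true × δ ends (is x) f ≡ true ×
        far ends x e ≢ far ends x f × far ends x f ≢ v × ¬ ∃ (Endangers x (far ends x e) (far ends x f))

      splittable? : ∀ x e f → Dec (Splittable x e f)
      splittable? x e f = (S x ∨ R x Boolₚ.≟ false) ×-dec (δ ends (is x) e Boolₚ.≟ true) ×-dec (δ ends (is x) f Boolₚ.≟ true) ×-dec
        ¬? (far ends x e ≟ far ends x f) ×-dec ¬? (far ends x f ≟ v) ×-dec ¬? (endangered? x (far ends x e) (far ends x f))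

      by-contraction : ∃ Tight → Solution ends S R D v pc
      by-contraction (X , Xv , (s , Ss , Xs) , dX , (e , l , es , et) , (e′ , l′ , es′ , et′)) = glued sol₁ (ih small₂ (inst₂ sol₁))
        where
        open Contraction I X Xv s Ss Xs dX
        small₁ : size ends₁ < size ends
        small₁ = contract-size ends φ₁ e l (trans (in₁ es) (sym (in₁ et)))
        small₂ : size ends₂ < size ends
        small₂ = contract-size ends φ₂ e′ l′ (trans (out₂ (not-true es′)) (sym (out₂ (not-true et′))))
        sol₁ : Solution ends₁ S₁ R₁ D₁ v pc
        sol₁ = ih small₁ inst₁

      by-deletion : (∃ λ e → live ends e ≡ true × ¬ ∃ (Blocks e)) → Solution ends S R D v pc
      by-deletion (e , l , free) = undelete (ih smaller deleted)
        where
        open Deletion I e l (λ X sep eX → ≤∧≢⇒< (cut X sep) (λ eq → free (X , sep , sym eq , eX)))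

      by-splitting : (∃ λ x → ∃ λ e → ∃ λ f → Splittable x e f) → Solution ends S R D v pc
      by-splitting (x , e , f , x∉ , xe , xf , ne , nv , safe) = unsplit (ih smaller split)
        where
        open Splitting I x e f x∉ xe xf ne nv (λ Y sep Ya Yb Yx → ≤-trans (≤-reflexive (+-suc K 1)) (≰⇒> λ le → safe (Y , sep , Ya , Yb , Yx , le)))

      irreducible : ¬ ∃ Tight → ¬ (∃ λ e → live ends e ≡ true × ¬ ∃ (Blocks e)) → ¬ (∃ λ x → ∃ λ e → ∃ λ f → Splittable x e f) → Irreducible ends S R
      irreducible ¬tight ¬slack ¬split = record { no-cut = no-cut ; no-slack = no-slack ; no-split = no-split }
        where
        no-cut : ∀ X → Sep S X → d ends X ≡ K → Inside ends X → Inside ends (not ∘ X) → ⊥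
        no-cut X (a@(s , Ss , Xs) , b@(s′ , Ss′ , Xs′)) dX i o with bool? (X v)
        ... | inj₂ Xv = ¬tight (X , Xv , a , dX , i , o)
        ... | inj₁ Xv = ¬tight (not ∘ X , cong not Xv , (s′ , Ss′ , not-false Xs′) , trans (d-not ends X) dX , o ,
                                inside-cong (λ y → sym (Boolₚ.not-involutive (X y))) i)
        no-slack : ∀ e → live ends e ≡ true → ∃ (Blocks e)
        no-slack e l = decidable-stable (blocked? e) λ free → ¬slack (e , l , free)
        no-split : ∀ x e f → S x ∨ R x ≡ false → δ ends (is x) e ≡ true → δ ends (is x) f ≡ true → far ends x e ≢ far ends x f →
          ∃ (Endangers x (far ends x e) (far ends x f))
        no-split x e f x∉ xe xf ne = decidable-stable (endangered? x (far ends x e) (far ends x f)) λ safe → by safe (far ends x f ≟ v)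
          where
          by : ¬ ∃ (Endangers x (far ends x e) (far ends x f)) → Dec (far ends x f ≡ v) → ⊥
          by safe (no nv) = ¬split (x , e , f , x∉ , xe , xf , ne , nv , safe)
          by safe (yes p) = ¬split (x , f , e , x∉ , xf , xe , ne ∘ sym , (λ q → ne (trans q (sym p))) ,
            λ (Y , sep , Ya , Yb , rest) → safe (Y , sep , Yb , Ya , rest))

      solved : Solution ends S R D v pc
      solved with tight?
      ... | yes t = by-contraction t
      ... | no ¬t with Finₚ.any? (λ e → (live ends e Boolₚ.≟ true) ×-dec ¬? (blocked? e))
      ...   | yes s = by-deletion s
      ...   | no ¬s with Finₚ.any? (λ x → Finₚ.any? λ e → Finₚ.any? λ f → splittable? x e f)
      ...     | yes p = by-splitting p
      ...     | no ¬p = Final.solved I (irreducible ¬t ¬s ¬p) 2≤K (32 * k + r) K′≤K R-degree 1≤k r K-eq refl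
        where
        R-degree : ∀ u → R u ≡ true → 32 * k + r ≤ d ends (is u)
        R-degree u h = ≤-by 1 (+-mono-≤ (budget-R u h) (R-tight h))
          (trans (equation k r (d ends (is u)) (D u)) (cong (λ z → d ends (is u) + (z + suc (D u))) (sym K-eq′)))
          where
          equation : ∀ k r e D → 32 * k + r + (D + (e + k * 2)) + 1 ≡ e + (34 * k + r + suc D)
          equation k r e D = solve (k ∷ r ∷ e ∷ D ∷ [])

    solvable : ∀ N → Solvable N
    solvable (suc N) ends S R D v pc lt I = Restrict.unrestrict I
      (Step.solved (Restrict.restricted I) (Restrict.R′-tight I) (λ lt′ I′ → solvable N _ _ _ _ _ _ (≤-trans lt′ (≤-pred lt)) I′))

    solve-instance : ∀ {ends S R D v pc} → Instance ends S R D v pc → Solution ends S R D v pc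
    solve-instance {ends} I = solvable (suc (size ends)) _ _ _ _ _ _ ≤-refl I

open import Defs
open import Data.Fin.Subset using (Subset; _∈_; _∩_; _∪_; ∁; ∣_∣; Empty)
open import Data.Fin.Subset.Properties using (x∈p∩q⁺; x∈p∩q⁻; x∈p∪q⁻; x∉p⇒x∈∁p)
open import Data.Vec using ([]; _∷_)
open import Data.Vec.Properties using ([]=⇒lookup; lookup⇒[]=)
import Data.List as List
open import Data.List.Properties using (map-tabulate)
open import Data.Nat.ListAction using () renaming (sum to List-sum)
open import Data.Sum using (swap)

-- Cuts and colourings of the multigraphs of the statement

size≡count : ∀ {m} (p : Subset m) → ∣ p ∣ ≡ count (lookup p)
size≡count []          = sym (∑-empty _)
size≡count (true ∷ p)  = trans (cong suc (size≡count p)) (sym (∑-suc _))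
size≡count (false ∷ p) = trans (size≡count p) (sym (∑-suc _))

∈⇒ : ∀ {m} {p : Subset m} {e} → e ∈ p → lookup p e ≡ true
∈⇒ = []=⇒lookup

⇒∈ : ∀ {m} {p : Subset m} {e} → lookup p e ≡ true → e ∈ p
⇒∈ {p = p} {e} = lookup⇒[]= e p

∈tabulate⇒ : ∀ {m} {f : Fin m → Bool} {e} → e ∈ tabulate f → f e ≡ true
∈tabulate⇒ {f = f} {e} h = trans (sym (lookup∘tabulate f e)) (∈⇒ h)

⇒∈tabulate : ∀ {m} {f : Fin m → Bool} {e} → f e ≡ true → e ∈ tabulate f
⇒∈tabulate {f = f} {e} h = ⇒∈ (trans (lookup∘tabulate f e) h)

list-sum≡∑ : ∀ {m} (f : Fin m → ℕ) → List-sum (List.tabulate f) ≡ ∑ f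
list-sum≡∑ {zero}  f = sym (∑-empty f)
list-sum≡∑ {suc m} f = trans (cong (f zero +_) (list-sum≡∑ (f ∘ suc))) (sym (∑-suc f))

count≤1 : ∀ {k} (b : Fin k → Bool) → (∀ i j → i ≢ j → b i ≡ true → b j ≡ true → ⊥) → count b ≤ 1
count≤1 b disjoint = ≮⇒≥ λ two → let i , j , ne , bi , bj = count-pair b two in disjoint i j ne bi bj

module Walks (G : Multigraph) where

  Conn-trans : ∀ {A x y z} → Conn G A x y → Conn G A y z → Conn G A x z
  Conn-trans p here            = p
  Conn-trans p (step q e h j) = step (Conn-trans p q) e h j

  Conn-sym : ∀ {A x y} → Conn G A x y → Conn G A y x
  Conn-sym here = here
  Conn-sym (step p e h j) = Conn-trans (step here e h (swap j)) (Conn-sym p)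

  connect : ∀ {A x y} → (∀ (g : Vertex G → Bool) → (∀ e → e ∈ A → g (src (ends G) e) ≡ g (tgt (ends G) e)) → g x ≡ g y) → Conn G A x y
  connect {A} {x} {y} uncut = Conn-trans (Conn-sym (to-root x)) (subst (λ z → Conn G A z y) Ly≡Lx (to-root y))
    where
    open Labelling (labelling (ends G) (lookup A))
    to-root : ∀ z → Conn G A (L z) z
    to-root = joined (record { refl = here ; sym = Conn-sym ; trans = Conn-trans }) λ (e , h , p) → step here e (⇒∈ h) (inj₁ p)
    Ly≡Lx : L y ≡ L x
    Ly≡Lx = is-≡ (trans (sym (uncut (is (L x) ∘ L) λ e h → cong (is (L x)) (closed (e , ∈⇒ h , refl)))) (is-refl (L x)))

  along-walk : ∀ {A x y} (g : Vertex G → Bool) → (∀ e → e ∈ A → g (src (ends G) e) ≡ g (tgt (ends G) e)) → Conn G A x y → g x ≡ g y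
  along-walk g closed here = refl
  along-walk g closed (step p e h (inj₁ j)) = trans (along-walk g closed p) (trans (cong (g ∘ proj₁) (sym j)) (trans (closed e h) (cong (g ∘ proj₂) j)))
  along-walk g closed (step p e h (inj₂ j)) = trans (along-walk g closed p) (trans (cong (g ∘ proj₂) (sym j)) (trans (sym (closed e h)) (cong (g ∘ proj₁) j)))

  crossing-edge : ∀ {A x y} (X : Vertex G → Bool) → X x ≢ X y → Conn G A x y → ∃ λ e → e ∈ A × δ (ends G) X e ≡ true
  crossing-edge {A} X ne p with Finₚ.any? (λ e → (lookup A e Boolₚ.≟ true) ×-dec (δ (ends G) X e Boolₚ.≟ true))
  ... | yes (e , h , q) = e , ⇒∈ h , q
  ... | no none = ⊥-elim (ne (along-walk X (λ e h → xor-≡ (≢true λ q → none (e , ∈⇒ h , q))) p))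

  incident-δ : ∀ {u e} → incidentB G u e ≡ true → live (ends G) e ≡ true → δ (ends G) (is u) e ≡ true
  incident-δ {u} {e} h l with ∨-true {is u (src (ends G) e)} h
  ... | inj₁ p = subst (λ w → δ (ends G) (is w) e ≡ true) (is-≡ p) (proj₁ (live-δ (ends G) l))
  ... | inj₂ p = subst (λ w → δ (ends G) (is w) e ≡ true) (is-≡ p) (proj₂ (live-δ (ends G) l))

  δ-incident : ∀ {u e} → δ (ends G) (is u) e ≡ true → incidentB G u e ≡ true
  δ-incident {u} {e} h with is u (src (ends G) e) | is u (tgt (ends G) e)
  ... | true  | _    = refl
  ... | false | true = refl

  -- Of c edge-disjoint paths, each has its own edge in a cut between the ends.
  disjoint-paths⇒cut : ∀ c S → EdgeConnected G c S → ∀ X → Sep (lookup S) X → c ≤ d (ends G) X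
  disjoint-paths⇒cut c S conn X ((s , Ss , Xs) , (s′ , Ss′ , Xs′)) with conn s s′ (⇒∈ Ss) (⇒∈ Ss′)
  ... | D , disjoint , path = ≤-trans (≤-reflexive (trans (sym (*-identityʳ c)) (sym (∑-const c 1))))
      (≤-trans (∑-mono on-path) (≤-trans (≤-reflexive (∑-swap _)) (∑-mono once)))
    where
    on-path : ∀ j → 1 ≤ count (λ e → lookup (D j) e ∧ δ (ends G) X e)
    on-path j = let e , h , q = crossing-edge X (λ p → true≢false Xs (trans p Xs′)) (path j) in count-pos _ {e} (∧-true (∈⇒ h) q)
    once : ∀ e → ∑ (λ j → ⟦ lookup (D j) e ∧ δ (ends G) X e ⟧) ≤ ⟦ δ (ends G) X e ⟧
    once e with δ (ends G) X e
    ... | false = ≤-reflexive (∑-zero λ j → cong ⟦_⟧ (Boolₚ.∧-zeroʳ (lookup (D j) e)))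
    ... | true  = count≤1 (λ j → lookup (D j) e ∧ true) λ i j ne p q → disjoint i j ne (e , x∈p∩q⁺ (⇒∈ (∧-trueˡ p) , ⇒∈ (∧-trueˡ q)))

  degree≡cut : ∀ v → (∀ e → ¬ SelfLoopAt G e v) → deg G v ≡ d (ends G) (is v)
  degree≡cut v noLoop = trans (cong List-sum (map-tabulate (λ e → e) (endCount G v))) (trans (list-sum≡∑ (endCount G v)) (∑-cong pointwise))
    where
    pointwise : ∀ e → endCount G v e ≡ ⟦ δ (ends G) (is v) e ⟧
    pointwise e with proj₁ (ends G e) ≟ v | proj₂ (ends G e) ≟ v
    ... | yes p | yes q = ⊥-elim (noLoop e (p , q))
    ... | yes _ | no _  = refl
    ... | no _  | yes _ = refl
    ... | no _  | no _  = refl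

  size-E : ∀ u → ∣ E G u ∣ ≡ count (incidentB G u)
  size-E u = trans (size≡count (E G u)) (count-cong (lookup∘tabulate (incidentB G u)))

module Main (k Q : ℕ) (1≤k : 1 ≤ k) (36≤Q : 36 ≤ Q) (G : Multigraph) (S R : Subset (n G)) (2≤S : 2 ≤ ∣ S ∣)
  (v : Vertex G) (v∈S : v ∈ S) (noLoop : ∀ e → ¬ SelfLoopAt G e v) (deg-v : deg G v ≡ Q * k)
  (P : Fin k → EdgeSet G) (balancedP : BalancedSubpartition G k (E G v) P)
  (connected : EdgeConnected G (Q * k) S) (R-large : ∀ u → u ∈ R → (Q ∸ 2) * k ≤ ∣ E G u ∣) where

  open Walks G
  open Problem k Q (n G) (m G)

  P′ : Fin k → EdgeSet G
  P′ = proj₁ balancedP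

  private
    𝔼 = ends G
    ∂v : Edge G → Bool
    ∂v = δ 𝔼 (is v)

  P′⊆E : ∀ i {e} → e ∈ P′ i → e ∈ E G v
  P′⊆E i h = proj₁ (proj₁ (proj₂ balancedP)) i h

  v-live : ∀ {e} → incidentB G v e ≡ true → live 𝔼 e ≡ true
  v-live {e} h = not-false (is-≢ λ q → noLoop e (both (∨-true {is v (src 𝔼 e)} h) q))
    where
    both : is v (src 𝔼 e) ≡ true ⊎ is v (tgt 𝔼 e) ≡ true → tgt 𝔼 e ≡ src 𝔼 e → src 𝔼 e ≡ v × tgt 𝔼 e ≡ v
    both (inj₁ p) q = is-≡ p , trans q (is-≡ p)
    both (inj₂ p) q = trans (sym q) (is-≡ p) , is-≡ p

  E⇒∂v : ∀ {e} → e ∈ E G v → ∂v e ≡ true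
  E⇒∂v h = incident-δ (∈tabulate⇒ h) (v-live (∈tabulate⇒ h))

  ∂v⇒E : ∀ {e} → ∂v e ≡ true → e ∈ E G v
  ∂v⇒E h = ⇒∈tabulate (δ-incident h)

  part : ∀ e → ∃ λ i → ∂v e ≡ true → e ∈ P′ i
  part e with bool? (∂v e)
  ... | inj₁ h = let i , p = proj₁ (proj₂ (proj₂ (proj₁ (proj₂ balancedP)))) e (∂v⇒E h) in i , λ _ → p
  ... | inj₂ h = fromℕ< 1≤k , λ h′ → ⊥-elim (true≢false h′ h)

  pc : Edge G → Fin k
  pc e = proj₁ (part e)

  pc-unique : ∀ {e i} → e ∈ P′ i → pc e ≡ i
  pc-unique {e} {i} h with pc e ≟ i
  ... | yes p = p
  ... | no ne = ⊥-elim (proj₁ (proj₂ (proj₁ (proj₂ balancedP))) (pc e) i ne (e , x∈p∩q⁺ (proj₂ (part e) (E⇒∂v (P′⊆E i h)) , h)))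

  inst : Instance 𝔼 (lookup S) (lookup R) (λ u → ∣ E G u ∣) v pc
  inst = record
    { v∈S = ∈⇒ v∈S
    ; other = other
    ; cut = disjoint-paths⇒cut (Q * k) S connected
    ; degree-v = trans (sym (degree≡cut v noLoop)) deg-v
    ; budget = λ u _ _ → ≤-trans (count-mono λ e → δ-incident) (≤-reflexive (sym (size-E u)))
    ; budget-R = λ u h → R-large u (⇒∈ h)
    ; twice = λ i → ≤-trans (proj₂ (proj₂ (proj₂ (proj₁ (proj₂ balancedP)))) i) (≤-trans (≤-reflexive (size≡count (P′ i)))
        (count-mono λ e h → ∧-true (E⇒∂v (P′⊆E i (⇒∈ h))) (is-true (pc-unique (⇒∈ h))))) }
    where
    other : ∃ λ s → lookup S s ≡ true × s ≢ v
    other with count-pair (lookup S) (≤-trans 2≤S (≤-reflexive (size≡count S)))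
    ... | a , b , ne , Sa , Sb with a ≟ v
    ...   | no a≢v   = a , Sa , a≢v
    ...   | yes refl = b , Sb , ne ∘ sym

  opaque
    solution : Solution 𝔼 (lookup S) (lookup R) (λ u → ∣ E G u ∣) v pc
    solution = Recursion.solve-instance 1≤k 36≤Q inst

  open Solution solution renaming (connected to c-connected)

  -- Loops stay uncoloured, since `balanced` does not bound the number of coloured loops.
  colour : Edge G → Maybe (Fin k)
  colour e = if live 𝔼 e then c e else nothing

  colour-c : ∀ {e i} → colour e ≡ just i → live 𝔼 e ≡ true × c e ≡ just i
  colour-c {e} h with live 𝔼 e
  ... | true = refl , h

  c-colour : ∀ {e i} → live 𝔼 e ≡ true → c e ≡ just i → colour e ≡ just i
  c-colour l h rewrite l = h

  H : Fin k → EdgeSet G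
  H i = tabulate (λ e → hasColour (colour e) i)

  H⇒ : ∀ {i e} → e ∈ H i → colour e ≡ just i
  H⇒ h = hasColour-≡ (∈tabulate⇒ h)

  ⇒H : ∀ {i e} → colour e ≡ just i → e ∈ H i
  ⇒H h = ⇒∈tabulate (hasColour-refl h)

  H-v : ∀ {i e} → ∂v e ≡ true → pc e ≡ i → e ∈ H i
  H-v {i} {e} h p = ⇒H (c-colour (δ-live 𝔼 {is v} h) (trans (extends e h) (cong just p)))

  v-H : ∀ {i e} → ∂v e ≡ true → e ∈ H i → pc e ≡ i
  v-H {i} {e} h p = just-injective (trans (sym (extends e h)) (proj₂ (colour-c (H⇒ p))))

  H-disjoint : PairwiseDisjoint G H
  H-disjoint i j ne (e , h) = let p , q = x∈p∩q⁻ (H i) (H j) h in ne (just-injective (trans (sym (H⇒ p)) (H⇒ q)))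

  v-edge : ∀ i → ∃ λ e → ∂v e ≡ true × pc e ≡ i
  v-edge i = let e , h = count-witness _ (≤-trans (s≤s z≤n) (Instance.twice inst i)) in e , ∧-trueˡ h , is-≡ (∧-trueʳ {∂v e} h)

  terminals-joined : ∀ i (g : Vertex G → Bool) → (∀ e → e ∈ H i → e ∈ ∁ (E G v) → g (src 𝔼 e) ≡ g (tgt 𝔼 e)) →
    ∀ y z → Terminal 𝔼 (lookup S) v pc i y → Terminal 𝔼 (lookup S) v pc i z → g y ≡ g z
  terminals-joined i g closed = c-connected i g λ e ce h → [ (λ l → closed e (⇒H (c-colour l ce)) (x∉p⇒x∈∁p λ p → true≢false (E⇒∂v p) h))
                                                          , (λ l → cong g (sym (is-≡ (trans (sym (Boolₚ.not-involutive _)) (cong not l))))) ]′ (bool? (live 𝔼 e))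

  H-connected : ∀ i → SSubgraph G S (H i)
  H-connected i x y x∈S y∈S = connect λ g closed →
      let x′ , tx , gx = terminal g closed x x∈S
          y′ , ty , gy = terminal g closed y y∈S
      in trans gx (trans (terminals-joined i g (λ e h _ → closed e h) x′ y′ tx ty) (sym gy))
    where
    terminal : ∀ g → (∀ e → e ∈ H i → g (src 𝔼 e) ≡ g (tgt 𝔼 e)) → ∀ x → x ∈ S →
      ∃ λ x′ → Terminal 𝔼 (lookup S) v pc i x′ × g x ≡ g x′
    terminal g closed x x∈S with x ≟ v
    ... | no ne    = x , inj₁ (∈⇒ x∈S , ne) , refl
    ... | yes refl with v-edge i
    ...   | e , h , p = far 𝔼 v e , inj₂ (e , h , p , refl) , across (δ-ends 𝔼 {v} {e} h)
      where
      across : _ ⊎ _ → g v ≡ g (far 𝔼 v e)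
      across (inj₁ (s , _ , q)) = trans (cong g (sym s)) (trans (closed e (H-v h p)) (cong g (sym q)))
      across (inj₂ (t , _ , q)) = trans (cong g (sym t)) (trans (sym (closed e (H-v h p))) (cong g (sym q)))

  no-cut-vertex : ∀ i → ¬ CutVertex G (H i) v
  no-cut-vertex i (x , y , x≢v , y≢v , walk , cut) = cut (connect uncut)
    where
    uncut : ∀ g → (∀ e → e ∈ H i ∩ ∁ (E G v) → g (src 𝔼 e) ≡ g (tgt 𝔼 e)) → g x ≡ g y
    uncut g closed = trans (sym (g′-off x≢v)) (trans (along-walk g′ closed′ walk) (g′-off y≢v))
      where
      e₀ = v-edge i
      -- moving v to the side of its neighbours in H i
      g′ : Vertex G → Bool
      g′ z = if is v z then g (far 𝔼 v (proj₁ e₀)) else g z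
      g′-off : ∀ {z} → z ≢ v → g′ z ≡ g z
      g′-off ne rewrite is-≢ ne = refl
      g′-v : ∀ {z} → z ≡ v → g′ z ≡ g (far 𝔼 v (proj₁ e₀))
      g′-v refl rewrite is-refl v = refl
      neighbour : ∀ {e} → ∂v e ≡ true → e ∈ H i → g (far 𝔼 v e) ≡ g (far 𝔼 v (proj₁ e₀))
      neighbour {e} h p = terminals-joined i g (λ e q r → closed e (x∈p∩q⁺ (q , r))) _ _
        (inj₂ (e , h , v-H h p , refl)) (inj₂ (proj₁ e₀ , proj₁ (proj₂ e₀) , proj₂ (proj₂ e₀) , refl))
      closed′ : ∀ e → e ∈ H i → g′ (src 𝔼 e) ≡ g′ (tgt 𝔼 e)
      closed′ e p with bool? (∂v e)
      ... | inj₁ h = at (δ-ends 𝔼 {v} {e} h)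
        where
        at : (src 𝔼 e ≡ v × tgt 𝔼 e ≢ v × far 𝔼 v e ≡ tgt 𝔼 e) ⊎ (tgt 𝔼 e ≡ v × src 𝔼 e ≢ v × far 𝔼 v e ≡ src 𝔼 e) → g′ (src 𝔼 e) ≡ g′ (tgt 𝔼 e)
        at (inj₁ (s , t , q)) = trans (g′-v s) (trans (sym (neighbour h p)) (trans (cong g q) (sym (g′-off t))))
        at (inj₂ (t , s , q)) = trans (g′-off s) (trans (cong g (sym q)) (trans (neighbour h p) (sym (g′-v t))))
      ... | inj₂ h = trans (g′-off (avoid ∘ inj₁)) (trans (closed e (x∈p∩q⁺ (p , x∉p⇒x∈∁p λ q → true≢false (E⇒∂v q) h))) (sym (g′-off (avoid ∘ inj₂))))
        where
        avoid : ¬ (src 𝔼 e ≡ v ⊎ tgt 𝔼 e ≡ v)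
        avoid at = true≢false (incident-δ ([ (λ s → ∨-trueˡ (is-true s)) , (λ t → ∨-trueʳ {is v (src 𝔼 e)} (is-true t)) ]′ at) (proj₁ (colour-c (H⇒ p)))) h

  balances-v : Balances G H v
  balances-v = P′ , proj₁ (proj₂ balancedP) , λ i {e} h → let p , q = x∈p∩q⁻ (E G v) (H i) h in
    subst (λ j → e ∈ P′ j) (v-H (E⇒∂v p) q) (proj₂ (part e) (E⇒∂v p))

  balances : ∀ u → u ∈ S ∪ R → Balances G H u
  balances u u∈ with u ≟ v
  ... | yes refl = balances-v
  ... | no u≢v   = Pu , ((λ i h → proj₁ (x∈p∩q⁻ (E G u) _ h)) , disjoint , total , enough) , contains
    where
    F : Edge G → Bool
    F = incidentB G u
    u∈′ : lookup S u ∨ lookup R u ≡ true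
    u∈′ = [ (λ p → ∨-trueˡ (∈⇒ p)) , (λ p → ∨-trueʳ {lookup S u} (∈⇒ p)) ]′ (x∈p∪q⁻ S R u∈)
    room : ∑ (λ i → 2 ⊔ count (λ e → F e ∧ hasColour (colour e) i)) ≤ count F
    room = ≤-trans (∑-mono λ i → ⊔-monoʳ-≤ 2 (count-mono λ e h → let l , ce = colour-c (hasColour-≡ (∧-trueʳ {F e} h)) in
              ∧-true (incident-δ (∧-trueˡ h) l) (hasColour-refl ce))) (≤-trans (balanced u u≢v u∈′) (≤-reflexive (size-E u)))
    full = complete F colour pc room
    col : Edge G → Fin k
    col = proj₁ full
    Pu : Fin k → EdgeSet G
    Pu i = E G u ∩ tabulate (λ e → is i (col e))
    Pu⇒ : ∀ {i e} → e ∈ Pu i → col e ≡ i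
    Pu⇒ {i} h = is-≡ (∈tabulate⇒ (proj₂ (x∈p∩q⁻ (E G u) _ h)))
    ⇒Pu : ∀ {i e} → e ∈ E G u → col e ≡ i → e ∈ Pu i
    ⇒Pu h p = x∈p∩q⁺ (h , ⇒∈tabulate (is-true p))
    disjoint : PairwiseDisjoint G Pu
    disjoint i j ne (e , h) = let p , q = x∈p∩q⁻ (Pu i) (Pu j) h in ne (trans (sym (Pu⇒ p)) (Pu⇒ q))
    total : ∀ e → e ∈ E G u → ∃ λ i → e ∈ Pu i
    total e h = col e , ⇒Pu h refl
    enough : ∀ i → 2 ≤ ∣ Pu i ∣
    enough i = ≤-trans (proj₂ (proj₂ full) i) (≤-trans (count-mono λ e h → ∈⇒ (⇒Pu (⇒∈tabulate (∧-trueˡ h)) (is-≡ (∧-trueʳ {F e} h)))) (≤-reflexive (sym (size≡count (Pu i)))))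
    contains : ∀ i {e} → e ∈ E G u ∩ H i → e ∈ Pu i
    contains i {e} h = let p , q = x∈p∩q⁻ (E G u) (H i) h in ⇒Pu p (proj₁ (proj₂ full) e i (H⇒ q))

  extends-P : Extends G H P v
  extends-P i = (λ {e} h → let h′ = proj₂ (proj₂ balancedP) i h in H-v (E⇒∂v (P′⊆E i h′)) (pc-unique h′)) , no-cut-vertex i

mainTheorem6 : (k Q : ℕ) → 1 ≤ k → 36 ≤ Q →
    (G : Multigraph) (S R : Subset (n G)) → Empty (S ∩ R) → 2 ≤ ∣ S ∣ →
    (v : Vertex G) → v ∈ S → (∀ e → ¬ SelfLoopAt G e v) → deg G v ≡ Q * k →
    (P : Fin k → EdgeSet G) → BalancedSubpartition G k (E G v) P →
    EdgeConnected G (Q * k) S →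
    (∀ u → u ∈ R → (Q ∸ 2) * k ≤ ∣ E G u ∣) →
    Σ (Fin k → EdgeSet G) λ H →
    PairwiseDisjoint G H × (∀ i → SSubgraph G S (H i)) ×
    (∀ u → u ∈ S ∪ R → Balances G H u) × Extends G H P v
mainTheorem6 k Q 1≤k 36≤Q G S R _ 2≤S v v∈S noLoop deg-v P balancedP connected R-large =
  H , H-disjoint , H-connected , balances , extends-P
  where open Main k Q 1≤k 36≤Q G S R 2≤S v v∈S noLoop deg-v P balancedP connected R-large
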